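{- Let $K$ be a field of characteristic $\neq 2$. There exists a family $(G_n)$ of polynomial size bipartite graphs such that: (1) the family $(\mathrm{VCP}(G_n))$ is $\mathrm{VNP}$-complete; (2) $\mathrm{VCP}(G_n)=P(\phi_n)$ where $(\phi_n)$ is a $p$-family of $\{\mathrm{OR}_0\}$-formulas.
   Context: Vertex cover polynomial. For a graph $G=(V,E)$ with $V=\{v_1,\dots,v_k\}$ in which each vertex $v_i$ has as weight an indeterminate $X_i$, $\mathrm{VCP}(G)=\sum_{C}\prod_{v_i\in C}X_i$, the sum running over all vertex covers $C\subseteq V$ of $G$ (sets containing at least one endpoint of each edge). Polynomial size means that the size of $G_n$ is polynomially bounded in $n$. Formulas. $\mathrm{OR}_0$ is the logical relation $(x,y)\mapsto x\vee y$. An $\{\mathrm{OR}_0\}$-formula over a finite list of boolean variables is a conjunction of clauses $x_i\vee x_j$ on these variables. A family $(\phi_n)$ of such formulas is a $p$-family if $\phi_n$ is a conjunction of at most $p(n)$ clauses for some polynomial $p$ (and has polynomially many variables). If $\phi$ is a boolean formula over $x_1,\dots,x_k$, then $P(\phi)(X_1,\dots,X_k)=\sum_{\varepsilon\in\{0,1\}^k}\phi(\varepsilon)X_1^{\varepsilon_1}\cdots X_k^{\varepsilon_k}$. Valiant's model over $K$. A $p$-family of polynomials is a sequence $(f_n)$ of multivariate polynomials over $K$ whose number of variables and degree are polynomially bounded in $n$. $\mathrm{VP}$ is the class of $p$-families $(f_n)$ such that the minimum number of nodes of an arithmetic circuit (operations $+,\times$; inputs variables or constants of $K$) computing $f_n$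 is polynomially bounded. $\mathrm{VNP}$ is the class of $p$-families $(f_n)$ for which there is $(g_n)\in\mathrm{VP}$ with $f_n(X_1,\dots,X_{p(n)})=\sum_{\varepsilon\in\{0,1\}^{q(n)}}g_n(X_1,\dots,X_{p(n)},\varepsilon_1,\dots,\varepsilon_{q(n)})$. A polynomial $f$ is a projection of $g$ ($f\le g$) if $f=g(a_1,\dots,a_u)$ where each $a_i$ is a variable of $f$ or a constant of $K$. A $p$-family $(f_n)$ is a $p$-projection of $(g_m)$ if there is a polynomially bounded $t:\mathbb{N}\to\mathbb{N}$ such that $f_n\le g_{t(n)}$ for all sufficiently large $n$. A $p$-family $g\in\mathrm{VNP}$ is $\mathrm{VNP}$-complete if every $f\in\mathrm{VNP}$ is a $p$-projection of $g$. -}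

module Defs where

open import Algebra.Bundles using (CommutativeRing)
import Algebra.Definitions.RawMonoid as RawMonoidDefinitions
open import Data.Bool.Base using (Bool; true; false; _∨_; if_then_else_)
open import Data.Bool.ListAction using (all)
open import Data.Fin.Base using (Fin)
import Data.Fin.Properties as Fin
open import Data.Fin.Subset using (Subset; _∈_)
open import Data.Fin.Subset.Properties using (_∈?_)
open import Data.List.Base as List
  using (List; []; _∷_; [_]; _++_; allFin; cartesianProduct; cartesianProductWith)
open import Data.Nat.Base as ℕ using (ℕ; zero; suc)
open import Data.Nat.Divisibility using (_∣_)
import Data.Nat.Properties as ℕ
open import Data.Product.Base using (_×_; _,_; Σ-syntax; ∃-syntax)
open import Data.Sum.Base using (_⊎_; [_,_]′)
open import Data.Vec.Base as Vec using (Vec; []; _∷_)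
import Data.Vec.Properties as Vec
open import Function.Base using (_∘_)
open import Function.Bundles using (_⇔_)
open import Level using (0ℓ; _⊔_) renaming (suc to lsuc)
open import Relation.Binary.Core using (Rel)
open import Relation.Binary.Definitions using (Decidable; Symmetric)
open import Relation.Binary.PropositionalEquality.Core using (_≢_)
open import Relation.Nullary.Decidable.Core using (Dec; does; _×-dec_; _⊎-dec_; _→-dec_)
open import Relation.Nullary.Negation.Core using (¬_)

------------------------------------------------------------------------
-- Fields

-- Equality is not required to be decidable.
record Field c ℓ : Set (lsuc (c ⊔ ℓ)) where
  field
    commutativeRing : CommutativeRing c ℓ
  open CommutativeRing commutativeRing public
  field
    1≉0     : ¬ (1# ≈ 0#)
    inverse : ∀ x → ¬ (x ≈ 0#) → ∃[ y ] x * y ≈ 1#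

-- p is the nonnegative generator of the ideal of all n with n · 1 = 0;
-- in particular p = 0 means that n · 1 = 0 only for n = 0.
HasCharacteristic : ∀ {c ℓ} → Field c ℓ → ℕ → Set ℓ
HasCharacteristic K p = ∀ n → (n · 1# ≈ 0#) ⇔ (p ∣ n)
  where
  open Field K using (_≈_; 0#; 1#; +-rawMonoid)
  open RawMonoidDefinitions +-rawMonoid using () renaming (_×_ to _·_)

------------------------------------------------------------------------
-- Polynomial growth

-- Univariate polynomials over ℕ, constant coefficient first.
evalℕ : List ℕ → ℕ → ℕ
evalℕ p n = List.foldr (λ a r → a ℕ.+ n ℕ.* r) 0 p

PolynomiallyBounded : (ℕ → ℕ) → Set
PolynomiallyBounded t = ∃[ p ] (∀ n → t n ℕ.≤ evalℕ p n)

------------------------------------------------------------------------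
-- Finite simple graphs

record Graph : Set₁ where
  infix 4 _~_ _~?_
  field
    order    : ℕ
    _~_      : Rel (Fin order) 0ℓ
    _~?_     : Decidable _~_
    ~-sym    : Symmetric _~_
    ~-irrefl : ∀ {i} → ¬ (i ~ i)

  -- Each edge is listed once, with its smaller endpoint first.
  edges : List (Fin order × Fin order)
  edges = List.filter (λ (i , j) → (i Fin.<? j) ×-dec (i ~? j))
                      (cartesianProduct (allFin order) (allFin order))

  size : ℕ
  size = order ℕ.+ List.length edges

  Bipartite : Set
  Bipartite = Σ[ side ∈ (Fin order → Bool) ] (∀ {i j} → i ~ j → side i ≢ side j)

  IsVertexCover : Subset order → Set
  IsVertexCover C = ∀ i j → i ~ j → i ∈ C ⊎ j ∈ C

  isVertexCover? : ∀ C → Dec (IsVertexCover C)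
  isVertexCover? C = Fin.all? λ i → Fin.all? λ j →
    (i ~? j) →-dec ((i ∈? C) ⊎-dec (j ∈? C))

open Graph public using (order; size; Bipartite)

------------------------------------------------------------------------
-- OR₀-formulas

-- All of {0,1}ᵏ; since Subset k is Vec Bool k, also all subsets of Fin k.
cube : ∀ k → List (Vec Bool k)
cube zero    = [ [] ]
cube (suc k) = List.map (false ∷_) (cube k) ++ List.map (true ∷_) (cube k)

OR₀ : Bool → Bool → Bool
OR₀ x y = x ∨ y

-- The pair (i , j) is the clause OR₀ xᵢ xⱼ.
OR₀Formula : ℕ → Set
OR₀Formula k = List (Fin k × Fin k)

⟦_⟧ : ∀ {k} → OR₀Formula k → Vec Bool k → Bool
⟦ φ ⟧ ε = all (λ (i , j) → OR₀ (Vec.lookup ε i) (Vec.lookup ε j)) φ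

IsPFormulaFamily : (k : ℕ → ℕ) → (∀ n → OR₀Formula (k n)) → Set
IsPFormulaFamily k φ =
  PolynomiallyBounded k × PolynomiallyBounded (λ n → List.length (φ n))

module Valiant {c ℓ} (K : Field c ℓ) where

  open Field K using (Carrier; _≈_; _+_; _*_; 0#; 1#)

  ----------------------------------------------------------------------
  -- Multivariate polynomials

  Monomial : ℕ → Set
  Monomial n = Vec ℕ n

  -- A finite formal sum of terms a · X^m. Monomials may be repeated and
  -- coefficients may vanish, so polynomials are compared with _≈ₚ_.
  Poly : ℕ → Set c
  Poly n = List (Carrier × Monomial n)

  coeff : ∀ {n} → Monomial n → Poly n → Carrier
  coeff m []             = 0#
  coeff m ((a , m′) ∷ f) =
    (if does (Vec.≡-dec ℕ._≟_ m m′) then a else 0#) + coeff m f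

  infix 4 _≈ₚ_
  _≈ₚ_ : ∀ {n} → Poly n → Poly n → Set ℓ
  f ≈ₚ g = ∀ m → coeff m f ≈ coeff m g

  const : ∀ {n} → Carrier → Poly n
  const a = [ a , Vec.replicate _ 0 ]

  var : ∀ {n} → Fin n → Poly n
  var i = [ 1# , Vec.replicate _ 0 Vec.[ i ]≔ 1 ]

  infixl 6 _+ₚ_
  infixl 7 _*ₚ_
  infixr 8 _^ₚ_

  _+ₚ_ : ∀ {n} → Poly n → Poly n → Poly n
  _+ₚ_ = _++_

  _*ₚ_ : ∀ {n} → Poly n → Poly n → Poly n
  _*ₚ_ = cartesianProductWith λ (a , m) (b , m′) → a * b , Vec.zipWith ℕ._+_ m m′

  _^ₚ_ : ∀ {n} → Poly n → ℕ → Poly n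
  f ^ₚ zero  = const 1#
  f ^ₚ suc e = f *ₚ f ^ₚ e

  ∑ ∏ : ∀ {n} {a} {A : Set a} → List A → (A → Poly n) → Poly n
  ∑ xs f = List.foldr (λ x r → f x +ₚ r) [] xs
  ∏ xs f = List.foldr (λ x r → f x *ₚ r) (const 1#) xs

  substitute : ∀ {m n} → (Fin m → Poly n) → Poly m → Poly n
  substitute σ f =
    ∑ f λ (a , m) → const a *ₚ ∏ (allFin _) λ i → σ i ^ₚ Vec.lookup m i

  DegreeAtMost : ∀ {n} → ℕ → Poly n → Set ℓ
  DegreeAtMost d f = ∀ m → d ℕ.< Vec.sum m → coeff m f ≈ 0#

  ----------------------------------------------------------------------
  -- Arithmetic circuits

  data Gate (n k : ℕ) : Set c where
    input     : Fin n → Gate n k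
    constant  : Carrier → Gate n k
    plus mult : (i j : Fin k) → Gate n k

  -- Circuit n k: directed acyclic graphs with n variables and k nodes, in
  -- topological order. The arguments of a gate refer to the preceding
  -- nodes, index zero being the most recent one.
  infixl 5 _▸_
  data Circuit (n : ℕ) : ℕ → Set c where
    ε   : Circuit n 0
    _▸_ : ∀ {k} → Circuit n k → Gate n k → Circuit n (suc k)

  evalGate : ∀ {n k} → Vec (Poly n) k → Gate n k → Poly n
  evalGate v (input x)    = var x
  evalGate v (constant a) = const a
  evalGate v (plus i j)   = Vec.lookup v i +ₚ Vec.lookup v j
  evalGate v (mult i j)   = Vec.lookup v i *ₚ Vec.lookup v j

  values : ∀ {n k} → Circuit n k → Vec (Poly n) k
  values ε       = []
  values (C ▸ g) = evalGate (values C) g ∷ values C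

  output : ∀ {n k} → Circuit n (suc k) → Poly n
  output C = Vec.head (values C)

  -- The minimum number of nodes of a circuit computing f is at most s.
  ComplexityAtMost : ∀ {n} → ℕ → Poly n → Set (c ⊔ ℓ)
  ComplexityAtMost {n} s f =
    ∃[ k ] (suc k ℕ.≤ s × Σ[ C ∈ Circuit n (suc k) ] output C ≈ₚ f)

  ----------------------------------------------------------------------
  -- Valiant's classes

  record Family : Set c where
    constructor family
    field
      vars : ℕ → ℕ
      poly : ∀ n → Poly (vars n)

  open Family public

  IsPFamily : Family → Set ℓ
  IsPFamily f =
    PolynomiallyBounded (vars f) ×
    ∃[ p ] (∀ n → DegreeAtMost (evalℕ p n) (poly f n))

  VP : Family → Set (c ⊔ ℓ)
  VP f = IsPFamily f × ∃[ p ] (∀ n → ComplexityAtMost (evalℕ p n) (poly f n))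

  fromBool : Bool → Carrier
  fromBool b = if b then 1# else 0#

  -- Σ_{ε ∈ {0,1}^q} g(X₁,…,X_v, ε₁,…,ε_q)
  booleanSum : ∀ {v} q → Poly (v ℕ.+ q) → Poly v
  booleanSum {v} q g = ∑ (cube q) λ ε →
    substitute (Vec.lookup (Vec.map var (Vec.allFin v) Vec.++ Vec.map (const ∘ fromBool) ε)) g

  VNP : Family → Set (c ⊔ ℓ)
  VNP f =
    IsPFamily f ×
    Σ[ q ∈ (ℕ → ℕ) ] Σ[ g ∈ (∀ n → Poly (vars f n ℕ.+ q n)) ]
      VP (family (λ n → vars f n ℕ.+ q n) g) ×
      (∀ n → poly f n ≈ₚ booleanSum (q n) (g n))

  IsProjection : ∀ {m n} → Poly m → Poly n → Set (c ⊔ ℓ)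
  IsProjection {m} {n} f g =
    Σ[ a ∈ (Fin n → Fin m ⊎ Carrier) ] f ≈ₚ substitute ([ var , const ]′ ∘ a) g

  IsPProjection : Family → Family → Set (c ⊔ ℓ)
  IsPProjection f g =
    Σ[ t ∈ (ℕ → ℕ) ] PolynomiallyBounded t ×
      ∃[ N ] (∀ n → N ℕ.≤ n → IsProjection (poly f n) (poly g (t n)))

  VNPComplete : Family → Set (c ⊔ ℓ)
  VNPComplete g = VNP g × (∀ f → VNP f → IsPProjection f g)

  ----------------------------------------------------------------------
  -- The polynomials of a graph and of a boolean formula

  VCP : (G : Graph) → Poly (order G)
  VCP G = ∑ (List.filter (Graph.isVertexCover? G) (cube (order G))) λ C →
    ∏ (List.filter (_∈? C) (allFin (order G))) var

  VCPFamily : (ℕ → Graph) → Family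
  VCPFamily G = family (λ n → order (G n)) (λ n → VCP (G n))

  P : ∀ {k} → (Vec Bool k → Bool) → Poly k
  P {k} φ = ∑ (cube k) λ ε →
    const (fromBool (φ ε)) *ₚ
    ∏ (allFin k) λ i → var i ^ₚ (if Vec.lookup ε i then 1 else 0)

{-# OPTIONS --safe #-}
module Submission where

-- Summing over the two states of a vertex of weight y on one side of a
-- bipartite graph contributes the factor y + ∏ x_a, where a runs through its
-- neighbours. With weights in {−1, 0, 1} this yields, for every pair of
-- vertices, a factor 1 − x_i x_j that can be switched on and off. So the
-- independence polynomial of every weighted graph on m vertices is a projection
-- of the vertex cover polynomial of one bipartite graph with O(m²) vertices.
--
-- Now let f = ∑_ε g(X , ε) with g of degree d computed by a small circuit. The
-- homogeneous components of the gates are sums over parse trees. Labelling each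
-- node of a parse tree with the interval of leaves below it makes the nodes of
-- a tree distinct, so that a parse tree is a set of productions in which a node
-- is expanded iff it is the root or has been produced. An auxiliary vertex of
-- weight −1 conflicting with certain productions cancels all independent sets
-- without such a production, which expresses these conditions by an
-- independence polynomial. Finally, ε_k = 0 is a vertex of weight 1 conflicting
-- with the leaves labelled ε_k.

open import Defs
open import Algebra.Bundles using (CommutativeRing; CommutativeMonoid)
import Algebra.Properties.CommutativeSemigroup
import Algebra.Properties.Ring
open import Data.Bool.Base using (Bool; true; false; if_then_else_; not; _∧_; _∨_; T)
open import Data.Bool.ListAction using (any; all)
import Data.Bool.Properties as Bool
open import Data.Empty using (⊥; ⊥-elim)
open import Data.Fin.Base using (Fin; zero; suc; _↑ˡ_; _↑ʳ_; combine; toℕ; splitAt; remQuot)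
import Data.Fin.Properties as Fin
open import Data.Fin.Subset using () renaming (_∈_ to _∈ₛ_)
open import Data.Fin.Subset.Properties using () renaming (_∈?_ to _∈ₛ?_)
open import Data.List.Base as List
  using (List; []; _∷_; [_]; _++_; allFin; foldr; upTo; length; cartesianProduct)
import Data.List.Membership.DecPropositional as DecMembership
open import Data.List.Membership.Propositional using (_∈_; _∉_)
open import Data.List.Membership.Propositional.Properties
  using (∈-++⁺ˡ; ∈-++⁺ʳ; ∈-++⁻; ∈-map⁺; ∈-map⁻; ∈-∃++; ∈-cartesianProduct⁺; ∈-upTo⁺; ∈-upTo⁻
    ; ∈-allFin; ∈-filter⁺)
import Data.List.Properties as List
open import Data.List.Relation.Unary.All as All using (All; []; _∷_)
import Data.List.Relation.Unary.All.Properties as All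
open import Data.List.Relation.Unary.AllPairs using ([]; _∷_)
open import Data.List.Relation.Unary.Any using (here; there)
open import Data.List.Relation.Unary.Unique.Propositional using (Unique)
import Data.List.Relation.Unary.Unique.Propositional.Properties as Unique
open import Data.Nat.Base as ℕ using (ℕ; zero; suc; _∸_; _≤_; _<_; z≤n; s≤s)
import Data.Nat.Properties as ℕ
open import Data.Product.Base using (_×_; _,_; proj₁; proj₂; Σ-syntax)
import Data.Product.Properties as Product
import Data.Sum.Base as Sum
open import Data.Sum.Base using (_⊎_; inj₁; inj₂; [_,_]′)
open import Data.Vec.Base as Vec using (Vec; []; _∷_)
import Data.Vec.Properties as Vec
open import Function.Base using (_∘_; id; _$_)
open import Function.Bundles using (_⇔_; mk⇔; Equivalence)
import Level
open import Relation.Binary.Definitions using (DecidableEquality)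
open import Relation.Binary.PropositionalEquality as ≡ using (_≡_; _≢_)
import Relation.Binary.Reasoning.Setoid
open import Relation.Nullary.Decidable using (T?; dec-true; dec-false; does-⇔)
open import Relation.Nullary.Decidable.Core using (Dec; does; yes; no; ¬?; _×-dec_; _⊎-dec_; map′)
open import Relation.Nullary.Negation.Core using (¬_)

-- A gate may be used several times in one parse tree, for instance by a product of a gate with
-- itself, whereas a vertex can be chosen only once; this is what the interval labels repair. With a
-- degree bound `D` they multiply the number of gates only by `(D + 1)²`. Homogeneous components
-- keep the trees small: inner gates may have exponential degree, but components of degree above `D`
-- never enter a tree for an output of degree at most `D`. Labels tell nodes apart only if all
-- intervals are nonempty, so subtrees of degree 0 are not grown. Such a component is an element of
-- the field, and since a projection may insert field constants, it can serve as the weight of a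
-- production. The universal graph depends on the number of conflict vertices alone; everything
-- specific to the polynomial being projected is carried by the weights. Membership in VNP is
-- obtained separately, by arithmetizing the covering condition.

length-cartesianProduct : ∀ {a b} {A : Set a} {B : Set b} (xs : List A) (ys : List B) →
                          List.length (List.cartesianProduct xs ys) ≡ List.length xs ℕ.* List.length ys
length-cartesianProduct []       ys = ≡.refl
length-cartesianProduct (x ∷ xs) ys = ≡.trans (List.length-++ (List.map (x ,_) ys))
  (≡.cong₂ ℕ._+_ (List.length-map (x ,_) ys) (length-cartesianProduct xs ys))

-- Finite sums and products

module FoldLemmas {c ℓ} (M : CommutativeMonoid c ℓ) where

  open CommutativeMonoid M
  open Algebra.Properties.CommutativeSemigroup commutativeSemigroup using (interchange)
  open Relation.Binary.Reasoning.Setoid setoid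

  -- The same `foldr` as in `∑` and `∏` of `Valiant`, so that over the polynomial ring the two
  -- versions agree definitionally.
  fold : ∀ {a} {A : Set a} → List A → (A → Carrier) → Carrier
  fold xs f = foldr (λ x r → f x ∙ r) ε xs

  fold-cong : ∀ {a} {A : Set a} (xs : List A) {f g : A → Carrier} →
              (∀ x → f x ≈ g x) → fold xs f ≈ fold xs g
  fold-cong []       eq = refl
  fold-cong (x ∷ xs) eq = ∙-cong (eq x) (fold-cong xs eq)

  fold-cong-All : ∀ {a} {A : Set a} {xs : List A} {f g : A → Carrier} →
                  All (λ x → f x ≈ g x) xs → fold xs f ≈ fold xs g
  fold-cong-All []         = refl
  fold-cong-All (eq ∷ eqs) = ∙-cong eq (fold-cong-All eqs)

  fold-++ : ∀ {a} {A : Set a} (xs ys : List A) (f : A → Carrier) →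
            fold (xs ++ ys) f ≈ fold xs f ∙ fold ys f
  fold-++ []       ys f = sym (identityˡ _)
  fold-++ (x ∷ xs) ys f = trans (∙-congˡ (fold-++ xs ys f)) (sym (assoc _ _ _))

  fold-map : ∀ {a b} {A : Set a} {B : Set b} (h : A → B) (xs : List A) (f : B → Carrier) →
             fold (List.map h xs) f ≡ fold xs (f ∘ h)
  fold-map h []       f = ≡.refl
  fold-map h (x ∷ xs) f = ≡.cong (f (h x) ∙_) (fold-map h xs f)

  fold-ε : ∀ {a} {A : Set a} (xs : List A) → fold xs (λ _ → ε) ≈ ε
  fold-ε []       = refl
  fold-ε (x ∷ xs) = trans (identityˡ _) (fold-ε xs)

  fold-∙ : ∀ {a} {A : Set a} (xs : List A) (f g : A → Carrier) →
           fold xs (λ x → f x ∙ g x) ≈ fold xs f ∙ fold xs g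
  fold-∙ []       f g = sym (identityˡ ε)
  fold-∙ (x ∷ xs) f g = trans (∙-congˡ (fold-∙ xs f g)) (interchange _ _ _ _)

  fold-swap : ∀ {a b} {A : Set a} {B : Set b} (xs : List A) (ys : List B) (f : A → B → Carrier) →
              fold xs (λ x → fold ys (f x)) ≈ fold ys (λ y → fold xs (λ x → f x y))
  fold-swap []       ys f = sym (fold-ε ys)
  fold-swap (x ∷ xs) ys f =
    trans (∙-congˡ (fold-swap xs ys f)) (sym (fold-∙ ys (f x) (λ y → fold xs (λ x → f x y))))

  fold-filter : ∀ {a p} {A : Set a} {P : A → Set p} (P? : ∀ x → Dec (P x))
                (xs : List A) (f : A → Carrier) →
                fold (List.filter P? xs) f
                  ≈ fold xs (λ x → if does (P? x) then f x else ε)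
  fold-filter P? []       f = refl
  fold-filter P? (x ∷ xs) f with does (P? x)
  ... | true  = ∙-congˡ (fold-filter P? xs f)
  ... | false = trans (fold-filter P? xs f) (sym (identityˡ _))

  fold-allFin-suc : ∀ n (f : Fin (suc n) → Carrier) →
                    fold (allFin (suc n)) f ≡ f zero ∙ fold (allFin n) (f ∘ suc)
  fold-allFin-suc n f = ≡.cong (f zero ∙_)
    (≡.trans (≡.cong (λ is → fold is f) (≡.sym (List.map-tabulate id suc))) (fold-map suc (allFin n) f))

  fold-allFin-+ : ∀ m n (f : Fin (m ℕ.+ n) → Carrier) →
                  fold (allFin (m ℕ.+ n)) f
                    ≈ fold (allFin m) (λ i → f (i ↑ˡ n)) ∙ fold (allFin n) (λ j → f (m ↑ʳ j))
  fold-allFin-+ zero    n f = sym (identityˡ _)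
  fold-allFin-+ (suc m) n f = begin
    fold (allFin (suc m ℕ.+ n)) f
      ≡⟨ fold-allFin-suc (m ℕ.+ n) f ⟩
    f zero ∙ fold (allFin (m ℕ.+ n)) (f ∘ suc)
      ≈⟨ ∙-congˡ (fold-allFin-+ m n (f ∘ suc)) ⟩
    f zero ∙ (fold (allFin m) (λ i → f (suc (i ↑ˡ n))) ∙ fold (allFin n) (λ j → f (suc m ↑ʳ j)))
      ≈⟨ assoc _ _ _ ⟨
    f zero ∙ fold (allFin m) (λ i → f (suc (i ↑ˡ n))) ∙ fold (allFin n) (λ j → f (suc m ↑ʳ j))
      ≈⟨ ∙-congʳ (reflexive (fold-allFin-suc m (λ i → f (i ↑ˡ n)))) ⟨
    fold (allFin (suc m)) (λ i → f (i ↑ˡ n)) ∙ fold (allFin n) (λ j → f (suc m ↑ʳ j)) ∎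

  fold-allFin-* : ∀ m n (f : Fin (m ℕ.* n) → Carrier) →
                  fold (allFin (m ℕ.* n)) f
                    ≈ fold (allFin m) (λ i → fold (allFin n) (λ j → f (combine i j)))
  fold-allFin-* zero    n f = refl
  fold-allFin-* (suc m) n f = begin
    fold (allFin (n ℕ.+ m ℕ.* n)) f
      ≈⟨ fold-allFin-+ n (m ℕ.* n) f ⟩
    fold (allFin n) (λ j → f (j ↑ˡ (m ℕ.* n))) ∙ fold (allFin (m ℕ.* n)) (λ k → f (n ↑ʳ k))
      ≈⟨ ∙-congˡ (fold-allFin-* m n (λ k → f (n ↑ʳ k))) ⟩
    fold (allFin n) (λ j → f (combine {suc m} zero j)) ∙
    fold (allFin m) (λ i → fold (allFin n) (λ j → f (combine (suc i) j)))
      ≡⟨ fold-allFin-suc m (λ i → fold (allFin n) (λ j → f (combine i j))) ⟨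
    fold (allFin (suc m)) (λ i → fold (allFin n) (λ j → f (combine i j))) ∎

module SumLemmas {c ℓ} (R : CommutativeRing c ℓ) where

  open CommutativeRing R hiding (zero)
  open Relation.Binary.Reasoning.Setoid setoid
  private
    module Σ = FoldLemmas +-commutativeMonoid
    module Π = FoldLemmas *-commutativeMonoid

  open Σ public using () renaming
    ( fold to ∑ ; fold-cong to ∑-cong ; fold-cong-All to ∑-cong-All ; fold-++ to ∑-++ ; fold-map to ∑-map ; fold-ε to ∑-0
    ; fold-∙ to ∑-+ ; fold-swap to ∑-swap ; fold-filter to ∑-filter )
  open Π public using () renaming
    ( fold to ∏ ; fold-cong to ∏-cong ; fold-++ to ∏-++ ; fold-map to ∏-map ; fold-ε to ∏-1
    ; fold-∙ to ∏-* ; fold-filter to ∏-filter ; fold-allFin-suc to ∏-allFin-suc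
    ; fold-allFin-+ to ∏-allFin-+ ; fold-allFin-* to ∏-allFin-* )

  *-distribˡ-∑ : ∀ {a} {A : Set a} x (ys : List A) (f : A → Carrier) →
                 x * ∑ ys f ≈ ∑ ys (λ y → x * f y)
  *-distribˡ-∑ x []       f = zeroʳ x
  *-distribˡ-∑ x (y ∷ ys) f = trans (distribˡ x _ _) (+-congˡ (*-distribˡ-∑ x ys f))

  *-distribʳ-∑ : ∀ {a} {A : Set a} x (ys : List A) (f : A → Carrier) →
                 ∑ ys f * x ≈ ∑ ys (λ y → f y * x)
  *-distribʳ-∑ x ys f =
    trans (*-comm _ x) (trans (*-distribˡ-∑ x ys f) (∑-cong ys λ y → *-comm x (f y)))

  ∑-upTo-suc : ∀ n (h : ℕ → Carrier) → ∑ (upTo (suc n)) h ≡ h 0 + ∑ (upTo n) (h ∘ suc)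
  ∑-upTo-suc n h = ≡.cong (h 0 +_) (≡.trans
    (≡.cong (λ xs → ∑ xs h) (≡.sym (List.map-upTo suc n))) (∑-map suc (upTo n) h))

  ∑-cube-suc : ∀ k (f : Vec Bool (suc k) → Carrier) →
               ∑ (cube (suc k)) f ≈ ∑ (cube k) (f ∘ (false ∷_)) + ∑ (cube k) (f ∘ (true ∷_))
  ∑-cube-suc k f = trans (∑-++ (List.map (false ∷_) (cube k)) _ f)
    (reflexive (≡.cong₂ _+_ (∑-map (false ∷_) (cube k) f) (∑-map (true ∷_) (cube k) f)))

  ∑-cube-+ : ∀ m n (f : Vec Bool (m ℕ.+ n) → Carrier) →
             ∑ (cube (m ℕ.+ n)) f ≈ ∑ (cube m) (λ x → ∑ (cube n) (λ y → f (x Vec.++ y)))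
  ∑-cube-+ zero    n f = sym (+-identityʳ _)
  ∑-cube-+ (suc m) n f = begin
    ∑ (cube (suc m ℕ.+ n)) f
      ≈⟨ ∑-cube-suc (m ℕ.+ n) f ⟩
    ∑ (cube (m ℕ.+ n)) (f ∘ (false ∷_)) + ∑ (cube (m ℕ.+ n)) (f ∘ (true ∷_))
      ≈⟨ +-cong (∑-cube-+ m n (f ∘ (false ∷_))) (∑-cube-+ m n (f ∘ (true ∷_))) ⟩
    ∑ (cube m) (λ x → ∑ (cube n) (λ y → f (false ∷ x Vec.++ y))) +
    ∑ (cube m) (λ x → ∑ (cube n) (λ y → f (true ∷ x Vec.++ y)))
      ≈⟨ ∑-cube-suc m (λ x → ∑ (cube n) (λ y → f (x Vec.++ y))) ⟨
    ∑ (cube (suc m)) (λ x → ∑ (cube n) (λ y → f (x Vec.++ y))) ∎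

  -- This is distributivity; it lets independent boolean choices be summed out one at a time.
  ∑-cube-∏ : ∀ k (f : Fin k → Bool → Carrier) →
             ∑ (cube k) (λ x → ∏ (allFin k) (λ i → f i (Vec.lookup x i)))
               ≈ ∏ (allFin k) (λ i → f i false + f i true)
  ∑-cube-∏ zero    f = +-identityʳ 1#
  ∑-cube-∏ (suc k) f = begin
    ∑ (cube (suc k)) (λ x → ∏ (allFin (suc k)) (λ i → f i (Vec.lookup x i)))
      ≈⟨ ∑-cube-suc k _ ⟩
    part false + part true
      ≈⟨ +-cong (factor false) (factor true) ⟩
    f zero false * rest + f zero true * rest
      ≈⟨ distribʳ rest _ _ ⟨
    (f zero false + f zero true) * rest
      ≈⟨ *-congˡ (∑-cube-∏ k (f ∘ suc)) ⟩
    (f zero false + f zero true) * ∏ (allFin k) (λ i → f (suc i) false + f (suc i) true)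
      ≡⟨ ∏-allFin-suc k (λ i → f i false + f i true) ⟨
    ∏ (allFin (suc k)) (λ i → f i false + f i true) ∎
    where
    part : Bool → Carrier
    part b = ∑ (cube k) (λ x → ∏ (allFin (suc k)) (λ i → f i (Vec.lookup (b ∷ x) i)))
    rest : Carrier
    rest = ∑ (cube k) (λ x → ∏ (allFin k) (λ i → f (suc i) (Vec.lookup x i)))
    factor : ∀ b → part b ≈ f zero b * rest
    factor b = trans
      (∑-cong (cube k) λ x → reflexive (∏-allFin-suc k (λ i → f i (Vec.lookup (b ∷ x) i))))
      (sym (*-distribˡ-∑ (f zero b) (cube k) _))

-- The commutative ring of polynomials

module PolynomialRing {c ℓ} (K : Field c ℓ) where

  open Field K hiding (zero)
  open Valiant K renaming (const to constₚ) hiding (∑; ∏)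
  open Algebra.Properties.Ring ring using (-‿distribˡ-*; -0#≈0#; -‿+-comm; +-cancelˡ; -‿involutive; +-inverseˡ-unique)
  open Algebra.Properties.CommutativeSemigroup *-commutativeSemigroup using (x∙yz≈y∙xz)
  open Relation.Binary.Reasoning.Setoid setoid
  private module S = SumLemmas commutativeRing

  infixl 6 _⊕_
  _⊕_ : ∀ {n} → Monomial n → Monomial n → Monomial n
  _⊕_ = Vec.zipWith ℕ._+_

  𝟘 : ∀ {n} → Monomial n
  𝟘 = Vec.replicate _ 0

  [_]·_ : Bool → Carrier → Carrier
  [ b ]· x = if b then x else 0#

  []·-* : ∀ b x → x * [ b ]· 1# ≈ [ b ]· x
  []·-* true  x = *-identityʳ x
  []·-* false x = zeroʳ x

  []·-cong : ∀ b {x y} → x ≈ y → [ b ]· x ≈ [ b ]· y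
  []·-cong true  eq = eq
  []·-cong false eq = refl

  *-[]· : ∀ b x y → x * [ b ]· y ≈ [ b ]· (x * y)
  *-[]· true  x y = refl
  *-[]· false x y = zeroʳ x

  infix 4 _≟ₘ_
  _≟ₘ_ : ∀ {n} (m m′ : Monomial n) → Dec (m ≡ m′)
  _≟ₘ_ = Vec.≡-dec ℕ._≟_

  δ : ∀ {n} → Monomial n → Monomial n → Carrier
  δ m m′ = [ does (m ≟ₘ m′) ]· 1#

  -- The K-linear functional on polynomials with X^m ↦ φ m. Two polynomials
  -- are equal iff no functional separates them, which turns every ring law
  -- into an identity between double sums.
  ⟨_,_⟩ : ∀ {n} → Poly n → (Monomial n → Carrier) → Carrier
  ⟨ f , φ ⟩ = S.∑ f λ (a , m) → a * φ m

  coeff≈⟨,δ⟩ : ∀ {n} (m : Monomial n) f → coeff m f ≈ ⟨ f , δ m ⟩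
  coeff≈⟨,δ⟩ m []             = refl
  coeff≈⟨,δ⟩ m ((a , m′) ∷ f) = +-cong (sym ([]·-* (does (m ≟ₘ m′)) a)) (coeff≈⟨,δ⟩ m f)

  ⟨,⟩-congʳ : ∀ {n} (f : Poly n) {φ ψ} → (∀ m → φ m ≈ ψ m) → ⟨ f , φ ⟩ ≈ ⟨ f , ψ ⟩
  ⟨,⟩-congʳ f eq = S.∑-cong f λ (a , m) → *-congˡ (eq m)

  ⟨,⟩-++ : ∀ {n} (f g : Poly n) φ → ⟨ f ++ g , φ ⟩ ≈ ⟨ f , φ ⟩ + ⟨ g , φ ⟩
  ⟨,⟩-++ f g φ = S.∑-++ f g _

  ⟨,⟩-*ˡ : ∀ {n} (f : Poly n) x φ → x * ⟨ f , φ ⟩ ≈ ⟨ f , (λ m → x * φ m) ⟩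
  ⟨,⟩-*ˡ f x φ = trans (S.*-distribˡ-∑ x f _) (S.∑-cong f λ (a , m) → x∙yz≈y∙xz x a (φ m))

  ⟨,⟩-swap : ∀ {m n} (f : Poly m) (g : Poly n) (ψ : Monomial m → Monomial n → Carrier) →
             ⟨ f , (λ m₁ → ⟨ g , ψ m₁ ⟩) ⟩ ≈ ⟨ g , (λ m₂ → ⟨ f , (λ m₁ → ψ m₁ m₂) ⟩) ⟩
  ⟨,⟩-swap f g ψ = begin
    ⟨ f , (λ m₁ → ⟨ g , ψ m₁ ⟩) ⟩
      ≈⟨ S.∑-cong f (λ (a , m₁) → ⟨,⟩-*ˡ g a _) ⟩
    S.∑ f (λ (a , m₁) → ⟨ g , (λ m₂ → a * ψ m₁ m₂) ⟩)
      ≈⟨ S.∑-swap f g _ ⟩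
    S.∑ g (λ (b , m₂) → S.∑ f λ (a , m₁) → b * (a * ψ m₁ m₂))
      ≈⟨ S.∑-cong g (λ (b , m₂) → S.*-distribˡ-∑ b f _) ⟨
    ⟨ g , (λ m₂ → ⟨ f , (λ m₁ → ψ m₁ m₂) ⟩) ⟩ ∎

  ⟨,⟩-∑ : ∀ {n a} {A : Set a} (f : Poly n) (xs : List A) (φ : A → Monomial n → Carrier) →
          ⟨ f , (λ m → S.∑ xs λ x → φ x m) ⟩ ≈ S.∑ xs λ x → ⟨ f , φ x ⟩
  ⟨,⟩-∑ f xs φ = trans (S.∑-cong f λ (a , m) → S.*-distribˡ-∑ a xs _) (S.∑-swap f xs _)

  ⟨,⟩-*ₚ : ∀ {n} (f g : Poly n) φ →
           ⟨ f *ₚ g , φ ⟩ ≈ ⟨ f , (λ m₁ → ⟨ g , (λ m₂ → φ (m₁ ⊕ m₂)) ⟩) ⟩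
  ⟨,⟩-*ₚ []            g φ = refl
  ⟨,⟩-*ₚ ((a , m) ∷ f) g φ = begin
    ⟨ List.map _ g ++ f *ₚ g , φ ⟩
      ≈⟨ ⟨,⟩-++ (List.map _ g) (f *ₚ g) φ ⟩
    ⟨ List.map _ g , φ ⟩ + ⟨ f *ₚ g , φ ⟩
      ≡⟨ ≡.cong (_+ _) (S.∑-map (λ (b , m′) → a * b , m ⊕ m′) g (λ (b , m′) → b * φ m′)) ⟩
    S.∑ g (λ (b , m′) → a * b * φ (m ⊕ m′)) + ⟨ f *ₚ g , φ ⟩
      ≈⟨ +-cong (S.∑-cong g λ (b , m′) → *-assoc a b _) (⟨,⟩-*ₚ f g φ) ⟩
    S.∑ g (λ (b , m′) → a * (b * φ (m ⊕ m′))) + _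
      ≈⟨ +-congʳ (S.*-distribˡ-∑ a g _) ⟨
    a * ⟨ g , (λ m′ → φ (m ⊕ m′)) ⟩ + ⟨ f , (λ m₁ → ⟨ g , (λ m₂ → φ (m₁ ⊕ m₂)) ⟩) ⟩ ∎

  remove : ∀ {n} → Monomial n → Poly n → Poly n
  remove m = List.filter (λ (_ , m′) → ¬? (m ≟ₘ m′))

  ⟨,⟩-remove : ∀ {n} (m : Monomial n) f φ → ⟨ f , φ ⟩ ≈ coeff m f * φ m + ⟨ remove m f , φ ⟩
  ⟨,⟩-remove m []             φ = sym (trans (+-identityʳ _) (zeroˡ _))
  ⟨,⟩-remove m ((a , m′) ∷ f) φ with m ≟ₘ m′
  ... | yes ≡.refl = begin
    a * φ m + ⟨ f , φ ⟩
      ≈⟨ +-congˡ (⟨,⟩-remove m f φ) ⟩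
    a * φ m + (coeff m f * φ m + ⟨ remove m f , φ ⟩)
      ≈⟨ +-assoc _ _ _ ⟨
    a * φ m + coeff m f * φ m + ⟨ remove m f , φ ⟩
      ≈⟨ +-congʳ (distribʳ (φ m) a _) ⟨
    (a + coeff m f) * φ m + ⟨ remove m f , φ ⟩ ∎
  ... | no _ = begin
    a * φ m′ + ⟨ f , φ ⟩
      ≈⟨ +-congˡ (⟨,⟩-remove m f φ) ⟩
    a * φ m′ + (coeff m f * φ m + ⟨ remove m f , φ ⟩)
      ≈⟨ x+yz≈y+xz _ _ _ ⟩
    coeff m f * φ m + (a * φ m′ + ⟨ remove m f , φ ⟩)
      ≈⟨ +-congʳ (*-congʳ (+-identityˡ _)) ⟨
    (0# + coeff m f) * φ m + (a * φ m′ + ⟨ remove m f , φ ⟩) ∎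
    where open Algebra.Properties.CommutativeSemigroup +-commutativeSemigroup
            using () renaming (x∙yz≈y∙xz to x+yz≈y+xz)

  private
    coeff-remove : ∀ {n} (m : Monomial n) a f →
                   (∀ m′ → coeff m′ ((a , m) ∷ f) ≈ 0#) → ∀ m′ → coeff m′ (remove m f) ≈ 0#
    coeff-remove m a f zeros m′ with m′ ≟ₘ m | zeros m′ | ⟨,⟩-remove m f (δ m′)
    -- Applied to `δ m`, `⟨,⟩-remove` writes `coeff m f` as itself plus the coefficient in question,
    -- so that the former cancels.
    ... | yes ≡.refl | _ | eq = +-cancelˡ (coeff m f) _ _ $ begin
      coeff m f + coeff m (remove m f)
        ≈⟨ +-cong (sym (*-identityʳ _)) (coeff≈⟨,δ⟩ m (remove m f)) ⟩
      coeff m f * 1# + ⟨ remove m f , δ m ⟩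
        ≈⟨ +-congʳ (*-congˡ (reflexive (≡.cong ([_]· 1#) (dec-true (m ≟ₘ m) ≡.refl)))) ⟨
      coeff m f * δ m m + ⟨ remove m f , δ m ⟩
        ≈⟨ ⟨,⟩-remove m f (δ m) ⟨
      ⟨ f , δ m ⟩
        ≈⟨ coeff≈⟨,δ⟩ m f ⟨
      coeff m f
        ≈⟨ +-identityʳ _ ⟨
      coeff m f + 0# ∎
    ... | no m′≢m | z | _ = begin
      coeff m′ (remove m f)
        ≈⟨ coeff≈⟨,δ⟩ m′ (remove m f) ⟩
      ⟨ remove m f , δ m′ ⟩
        ≈⟨ trans (+-congʳ (zeroʳ _)) (+-identityˡ _) ⟨
      coeff m f * 0# + ⟨ remove m f , δ m′ ⟩
        ≈⟨ +-congʳ (*-congˡ (reflexive (≡.cong ([_]· 1#) (dec-false (m′ ≟ₘ m) m′≢m)))) ⟨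
      coeff m f * δ m′ m + ⟨ remove m f , δ m′ ⟩
        ≈⟨ ⟨,⟩-remove m f (δ m′) ⟨
      ⟨ f , δ m′ ⟩
        ≈⟨ coeff≈⟨,δ⟩ m′ f ⟨
      coeff m′ f
        ≈⟨ +-identityˡ _ ⟨
      0# + coeff m′ f
        ≈⟨ z ⟩
      0# ∎

    -- All terms with the monomial of the first term are collected; their total coefficient is zero
    -- by hypothesis, and the remaining list is shorter and still has only zero coefficients. The
    -- bound `k` carries the recursion, since `remove m f` is not a structural part of the list.
    vanish : ∀ {n} k (f : Poly n) → length f ≤ k → (∀ m → coeff m f ≈ 0#) → ∀ φ → ⟨ f , φ ⟩ ≈ 0#
    vanish k       []            _         zeros φ = refl
    vanish (suc k) ((a , m) ∷ f) (s≤s f≤k) zeros φ = begin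
      a * φ m + ⟨ f , φ ⟩
        ≈⟨ +-congˡ (⟨,⟩-remove m f φ) ⟩
      a * φ m + (coeff m f * φ m + ⟨ remove m f , φ ⟩)
        ≈⟨ +-assoc _ _ _ ⟨
      a * φ m + coeff m f * φ m + ⟨ remove m f , φ ⟩
        ≈⟨ +-cong (sym (distribʳ (φ m) a _))
             (vanish k (remove m f) (ℕ.≤-trans (List.length-filter _ f) f≤k) (coeff-remove m a f zeros) φ) ⟩
      (a + coeff m f) * φ m + 0#
        ≈⟨ trans (+-identityʳ _) (*-congʳ (+-congʳ (reflexive (≡.cong ([_]· a) (≡.sym (dec-true (m ≟ₘ m) ≡.refl)))))) ⟩
      coeff m ((a , m) ∷ f) * φ m
        ≈⟨ *-congʳ (zeros m) ⟩
      0# * φ m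
        ≈⟨ zeroˡ _ ⟩
      0# ∎

  negₚ : ∀ {n} → Poly n → Poly n
  negₚ = List.map λ (a , m) → - a , m

  ⟨,⟩-negₚ : ∀ {n} (f : Poly n) φ → ⟨ negₚ f , φ ⟩ ≈ - ⟨ f , φ ⟩
  ⟨,⟩-negₚ []            φ = sym -0#≈0#
  ⟨,⟩-negₚ ((a , m) ∷ f) φ =
    trans (+-cong (sym (-‿distribˡ-* a (φ m))) (⟨,⟩-negₚ f φ)) (-‿+-comm _ _)

  -- The term lists of `f` and `g` need not match in any way, so the claim is reduced to the single
  -- list for `f − g`, to which `vanish` applies.
  ⟨,⟩-congˡ : ∀ {n} {f g : Poly n} → f ≈ₚ g → ∀ φ → ⟨ f , φ ⟩ ≈ ⟨ g , φ ⟩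
  ⟨,⟩-congˡ {f = f} {g} f≈g φ = begin
    ⟨ f , φ ⟩       ≈⟨ +-inverseˡ-unique _ _ (trans (sym (split φ)) difference) ⟩
    - ⟨ negₚ g , φ ⟩ ≈⟨ -‿cong (⟨,⟩-negₚ g φ) ⟩
    - - ⟨ g , φ ⟩   ≈⟨ -‿involutive _ ⟩
    ⟨ g , φ ⟩       ∎
    where
    split : ∀ φ → ⟨ f ++ negₚ g , φ ⟩ ≈ ⟨ f , φ ⟩ + ⟨ negₚ g , φ ⟩
    split = ⟨,⟩-++ f (negₚ g)
    difference : ⟨ f ++ negₚ g , φ ⟩ ≈ 0#
    difference = vanish (length (f ++ negₚ g)) (f ++ negₚ g) ℕ.≤-refl (λ m → begin
      coeff m (f ++ negₚ g)              ≈⟨ coeff≈⟨,δ⟩ m (f ++ negₚ g) ⟩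
      ⟨ f ++ negₚ g , δ m ⟩              ≈⟨ split (δ m) ⟩
      ⟨ f , δ m ⟩ + ⟨ negₚ g , δ m ⟩      ≈⟨ +-cong (sym (coeff≈⟨,δ⟩ m f)) (⟨,⟩-negₚ g (δ m)) ⟩
      coeff m f + - ⟨ g , δ m ⟩          ≈⟨ +-cong (f≈g m) (-‿cong (sym (coeff≈⟨,δ⟩ m g))) ⟩
      coeff m g + - coeff m g            ≈⟨ -‿inverseʳ _ ⟩
      0# ∎) φ

  -- _≈ₚ_ as a record: unlike the function type it unfolds to, it lets Agda
  -- infer the polynomials from a proof.
  infix 4 _≋_
  record _≋_ {n} (f g : Poly n) : Set ℓ where
    constructor mk≋
    field coeffs : f ≈ₚ g
  open _≋_ public

  separate : ∀ {n} {f g : Poly n} → (∀ φ → ⟨ f , φ ⟩ ≈ ⟨ g , φ ⟩) → f ≋ g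
  separate {f = f} {g} eq = mk≋ λ m →
    trans (coeff≈⟨,δ⟩ m f) (trans (eq (δ m)) (sym (coeff≈⟨,δ⟩ m g)))

  ⟨_,⟩ : ∀ {n} {f g : Poly n} → f ≋ g → ∀ φ → ⟨ f , φ ⟩ ≈ ⟨ g , φ ⟩
  ⟨_,⟩ {f = f} {g} f≋g = ⟨,⟩-congˡ {f = f} {g} (coeffs f≋g)

  ⊕-assoc : ∀ {n} (m₁ m₂ m₃ : Monomial n) → (m₁ ⊕ m₂) ⊕ m₃ ≡ m₁ ⊕ (m₂ ⊕ m₃)
  ⊕-assoc = Vec.zipWith-assoc ℕ.+-assoc

  ⊕-comm : ∀ {n} (m₁ m₂ : Monomial n) → m₁ ⊕ m₂ ≡ m₂ ⊕ m₁
  ⊕-comm = Vec.zipWith-comm ℕ.+-comm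

  ⊕-identityˡ : ∀ {n} (m : Monomial n) → 𝟘 ⊕ m ≡ m
  ⊕-identityˡ = Vec.zipWith-identityˡ ℕ.+-identityˡ

  ⟨,⟩-const : ∀ {n} a (φ : Monomial n → Carrier) → ⟨ constₚ a , φ ⟩ ≈ a * φ 𝟘
  ⟨,⟩-const a φ = +-identityʳ _

  ⟨,⟩-const-*ₚ : ∀ {n} a (f : Poly n) φ → ⟨ constₚ a *ₚ f , φ ⟩ ≈ a * ⟨ f , φ ⟩
  ⟨,⟩-const-*ₚ a f φ = begin
    ⟨ constₚ a *ₚ f , φ ⟩
      ≈⟨ ⟨,⟩-*ₚ (constₚ a) f φ ⟩
    ⟨ constₚ a , (λ m₁ → ⟨ f , (λ m₂ → φ (m₁ ⊕ m₂)) ⟩) ⟩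
      ≈⟨ ⟨,⟩-const a (λ m₁ → ⟨ f , (λ m₂ → φ (m₁ ⊕ m₂)) ⟩) ⟩
    a * ⟨ f , (λ m₂ → φ (𝟘 ⊕ m₂)) ⟩
      ≈⟨ *-congˡ (⟨,⟩-congʳ f λ m → reflexive (≡.cong φ (⊕-identityˡ m))) ⟩
    a * ⟨ f , φ ⟩ ∎

  private
    *ₚ-cong : ∀ {n} {f f′ g g′ : Poly n} → f ≋ f′ → g ≋ g′ → f *ₚ g ≋ f′ *ₚ g′
    *ₚ-cong {f = f} {f′} {g} {g′} f≋f′ g≋g′ = separate λ φ → begin
      ⟨ f *ₚ g , φ ⟩                                       ≈⟨ ⟨,⟩-*ₚ f g φ ⟩
      ⟨ f , (λ m₁ → ⟨ g , (λ m₂ → φ (m₁ ⊕ m₂)) ⟩) ⟩        ≈⟨ ⟨ f≋f′ ,⟩ _ ⟩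
      ⟨ f′ , (λ m₁ → ⟨ g , (λ m₂ → φ (m₁ ⊕ m₂)) ⟩) ⟩       ≈⟨ ⟨,⟩-congʳ f′ (λ m₁ → ⟨ g≋g′ ,⟩ _) ⟩
      ⟨ f′ , (λ m₁ → ⟨ g′ , (λ m₂ → φ (m₁ ⊕ m₂)) ⟩) ⟩      ≈⟨ ⟨,⟩-*ₚ f′ g′ φ ⟨
      ⟨ f′ *ₚ g′ , φ ⟩ ∎

    *ₚ-assoc : ∀ {n} (f g h : Poly n) → (f *ₚ g) *ₚ h ≋ f *ₚ (g *ₚ h)
    *ₚ-assoc f g h = separate λ φ → begin
      ⟨ (f *ₚ g) *ₚ h , φ ⟩
        ≈⟨ ⟨,⟩-*ₚ (f *ₚ g) h φ ⟩
      ⟨ f *ₚ g , (λ m → ⟨ h , (λ m₃ → φ (m ⊕ m₃)) ⟩) ⟩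
        ≈⟨ ⟨,⟩-*ₚ f g _ ⟩
      ⟨ f , (λ m₁ → ⟨ g , (λ m₂ → ⟨ h , (λ m₃ → φ (m₁ ⊕ m₂ ⊕ m₃)) ⟩) ⟩) ⟩
        ≈⟨ ⟨,⟩-congʳ f (λ m₁ → ⟨,⟩-congʳ g λ m₂ → ⟨,⟩-congʳ h λ m₃ →
             reflexive (≡.cong φ (⊕-assoc m₁ m₂ m₃))) ⟩
      ⟨ f , (λ m₁ → ⟨ g , (λ m₂ → ⟨ h , (λ m₃ → φ (m₁ ⊕ (m₂ ⊕ m₃))) ⟩) ⟩) ⟩
        ≈⟨ ⟨,⟩-congʳ f (λ m₁ → ⟨,⟩-*ₚ g h _) ⟨
      ⟨ f , (λ m₁ → ⟨ g *ₚ h , (λ m → φ (m₁ ⊕ m)) ⟩) ⟩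
        ≈⟨ ⟨,⟩-*ₚ f (g *ₚ h) φ ⟨
      ⟨ f *ₚ (g *ₚ h) , φ ⟩ ∎

    *ₚ-comm : ∀ {n} (f g : Poly n) → f *ₚ g ≋ g *ₚ f
    *ₚ-comm f g = separate λ φ → begin
      ⟨ f *ₚ g , φ ⟩
        ≈⟨ ⟨,⟩-*ₚ f g φ ⟩
      ⟨ f , (λ m₁ → ⟨ g , (λ m₂ → φ (m₁ ⊕ m₂)) ⟩) ⟩
        ≈⟨ ⟨,⟩-swap f g _ ⟩
      ⟨ g , (λ m₂ → ⟨ f , (λ m₁ → φ (m₁ ⊕ m₂)) ⟩) ⟩
        ≈⟨ ⟨,⟩-congʳ g (λ m₂ → ⟨,⟩-congʳ f λ m₁ → reflexive (≡.cong φ (⊕-comm m₁ m₂))) ⟩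
      ⟨ g , (λ m₂ → ⟨ f , (λ m₁ → φ (m₂ ⊕ m₁)) ⟩) ⟩
        ≈⟨ ⟨,⟩-*ₚ g f φ ⟨
      ⟨ g *ₚ f , φ ⟩ ∎

    *ₚ-identityˡ : ∀ {n} (f : Poly n) → constₚ 1# *ₚ f ≋ f
    *ₚ-identityˡ f = separate λ φ → trans (⟨,⟩-const-*ₚ 1# f φ) (*-identityˡ _)

    +ₚ-cong : ∀ {n} {f f′ g g′ : Poly n} → f ≋ f′ → g ≋ g′ → f ++ g ≋ f′ ++ g′
    +ₚ-cong {f = f} {f′} {g} {g′} f≋f′ g≋g′ = separate λ φ →
      trans (⟨,⟩-++ f g φ) (trans (+-cong (⟨ f≋f′ ,⟩ φ) (⟨ g≋g′ ,⟩ φ)) (sym (⟨,⟩-++ f′ g′ φ)))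

    +ₚ-comm : ∀ {n} (f g : Poly n) → f ++ g ≋ g ++ f
    +ₚ-comm f g = separate λ φ →
      trans (⟨,⟩-++ f g φ) (trans (+-comm _ _) (sym (⟨,⟩-++ g f φ)))

    negₚ-inverseˡ : ∀ {n} (f : Poly n) → negₚ f ++ f ≋ []
    negₚ-inverseˡ f = separate λ φ →
      trans (⟨,⟩-++ (negₚ f) f φ) (trans (+-congʳ (⟨,⟩-negₚ f φ)) (-‿inverseˡ _))

    *ₚ-distribʳ : ∀ {n} (h f g : Poly n) → (f ++ g) *ₚ h ≋ f *ₚ h ++ g *ₚ h
    *ₚ-distribʳ h f g = separate λ φ → begin
      ⟨ (f ++ g) *ₚ h , φ ⟩
        ≈⟨ trans (⟨,⟩-*ₚ (f ++ g) h φ) (⟨,⟩-++ f g _) ⟩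
      ⟨ f , _ ⟩ + ⟨ g , _ ⟩
        ≈⟨ +-cong (⟨,⟩-*ₚ f h φ) (⟨,⟩-*ₚ g h φ) ⟨
      ⟨ f *ₚ h , φ ⟩ + ⟨ g *ₚ h , φ ⟩
        ≈⟨ ⟨,⟩-++ (f *ₚ h) (g *ₚ h) φ ⟨
      ⟨ f *ₚ h ++ g *ₚ h , φ ⟩ ∎

    ≋-refl : ∀ {n} {f : Poly n} → f ≋ f
    ≋-refl = mk≋ λ m → refl

    ≋-sym : ∀ {n} {f g : Poly n} → f ≋ g → g ≋ f
    ≋-sym eq = mk≋ λ m → sym (coeffs eq m)

    ≋-trans : ∀ {n} {f g h : Poly n} → f ≋ g → g ≋ h → f ≋ h
    ≋-trans eq eq′ = mk≋ λ m → trans (coeffs eq m) (coeffs eq′ m)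

    ≋-reflexive : ∀ {n} {f g : Poly n} → f ≡ g → f ≋ g
    ≋-reflexive ≡.refl = ≋-refl

    negₚ-cong : ∀ {n} {f g : Poly n} → f ≋ g → negₚ f ≋ negₚ g
    negₚ-cong {f = f} {g} eq = separate λ φ →
      trans (⟨,⟩-negₚ f φ) (trans (-‿cong (⟨ eq ,⟩ φ)) (sym (⟨,⟩-negₚ g φ)))

  polyRing : ℕ → CommutativeRing c ℓ
  polyRing n = record
    { Carrier = Poly n
    ; _≈_ = _≋_
    ; _+_ = _+ₚ_
    ; _*_ = _*ₚ_
    ; -_  = negₚ
    ; 0#  = []
    ; 1#  = constₚ 1#
    ; isCommutativeRing = record
      { isRing = record
        { +-isAbelianGroup = record
          { isGroup = record
            { isMonoid = record
              { isSemigroup = record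
                { isMagma = record
                  { isEquivalence = record { refl = ≋-refl ; sym = ≋-sym ; trans = ≋-trans }
                  ; ∙-cong = +ₚ-cong
                  }
                ; assoc = λ f g h → ≋-reflexive (List.++-assoc f g h)
                }
              ; identity = (λ f → ≋-refl) , (λ f → ≋-reflexive (List.++-identityʳ f))
              }
            ; inverse = negₚ-inverseˡ , (λ f → ≋-trans (+ₚ-comm f (negₚ f)) (negₚ-inverseˡ f))
            ; ⁻¹-cong = negₚ-cong
            }
          ; comm = +ₚ-comm
          }
        ; *-cong = *ₚ-cong
        ; *-assoc = *ₚ-assoc
        ; *-identity = *ₚ-identityˡ , (λ f → ≋-trans (*ₚ-comm f _) (*ₚ-identityˡ f))
        ; distrib = (λ h f g → ≋-trans (*ₚ-comm h (f ++ g)) (≋-trans (*ₚ-distribʳ h f g)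
                      (+ₚ-cong (*ₚ-comm f h) (*ₚ-comm g h)))) , *ₚ-distribʳ
        }
      ; *-comm = *ₚ-comm
      }
    }

  const-0 : ∀ {n} → constₚ {n} 0# ≋ []
  const-0 {n} = separate λ φ → trans (⟨,⟩-const {n} 0# φ) (zeroˡ _)

  sum-⊕ : ∀ {n} (m₁ m₂ : Monomial n) → Vec.sum (m₁ ⊕ m₂) ≡ Vec.sum m₁ ℕ.+ Vec.sum m₂
  sum-⊕ []       []       = ≡.refl
  sum-⊕ (a ∷ m₁) (b ∷ m₂) = ≡.trans (≡.cong (a ℕ.+ b ℕ.+_) (sum-⊕ m₁ m₂))
    (interchange a b (Vec.sum m₁) (Vec.sum m₂))
    where open Algebra.Properties.CommutativeSemigroup ℕ.+-commutativeSemigroup using (interchange)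

  sum-𝟘 : ∀ n → Vec.sum (𝟘 {n}) ≡ 0
  sum-𝟘 zero    = ≡.refl
  sum-𝟘 (suc n) = sum-𝟘 n

  sum≡0 : ∀ {n} (m : Monomial n) → Vec.sum m ≡ 0 → 𝟘 ≡ m
  sum≡0 []         eq = ≡.refl
  sum≡0 (zero ∷ m) eq = ≡.cong (0 ∷_) (sum≡0 m eq)

  sum-unit : ∀ {n} (i : Fin n) → Vec.sum (𝟘 Vec.[ i ]≔ 1) ≡ 1
  sum-unit {suc n} zero    = ≡.cong suc (sum-𝟘 n)
  sum-unit {suc n} (suc i) = sum-unit i

-- Substitution as a ring homomorphism

module Substitution {c ℓ} (K : Field c ℓ) where

  open Field K using (Carrier)
  open Valiant K renaming (const to constₚ) hiding (∑; ∏)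
  open PolynomialRing K
  private module F = Field K

  monomial : ∀ {m n} → (Fin m → Poly n) → Monomial m → Poly n
  monomial σ m = Valiant.∏ K (allFin _) λ i → σ i ^ₚ Vec.lookup m i

  module _ {n : ℕ} where

    open CommutativeRing (polyRing n) hiding (zero)
    open SumLemmas (polyRing n) using (∏-cong; ∏-*; ∏-1; ∏-allFin-suc)
    open Relation.Binary.Reasoning.Setoid setoid

    ^ₚ-+ : ∀ (f : Poly n) a b → f ^ₚ (a ℕ.+ b) ≈ f ^ₚ a * f ^ₚ b
    ^ₚ-+ f zero    b = sym (*-identityˡ _)
    ^ₚ-+ f (suc a) b = trans (*-congˡ {f} (^ₚ-+ f a b)) (sym (*-assoc f (f ^ₚ a) (f ^ₚ b)))

    monomial-⊕ : ∀ {m} (σ : Fin m → Poly n) m₁ m₂ →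
                 monomial σ (m₁ ⊕ m₂) ≈ monomial σ m₁ * monomial σ m₂
    monomial-⊕ {m} σ m₁ m₂ = trans
      (∏-cong (allFin m) λ i → trans
        (reflexive (≡.cong (σ i ^ₚ_) (Vec.lookup-zipWith ℕ._+_ i m₁ m₂)))
        (^ₚ-+ (σ i) (Vec.lookup m₁ i) (Vec.lookup m₂ i)))
      (∏-* (allFin m) (λ i → σ i ^ₚ Vec.lookup m₁ i) (λ i → σ i ^ₚ Vec.lookup m₂ i))

    monomial-𝟘 : ∀ {m} (σ : Fin m → Poly n) → monomial σ 𝟘 ≈ 1#
    monomial-𝟘 {m} σ = trans
      (∏-cong (allFin m) λ i → reflexive (≡.cong (σ i ^ₚ_) (Vec.lookup-replicate i 0)))
      (∏-1 (allFin m))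

    monomial-var : ∀ {m} (σ : Fin m → Poly n) i → monomial σ (𝟘 Vec.[ i ]≔ 1) ≈ σ i
    monomial-var {suc m} σ zero = begin
      monomial σ (1 ∷ 𝟘)
        ≡⟨ ∏-allFin-suc m (λ i → σ i ^ₚ Vec.lookup (1 ∷ 𝟘) i) ⟩
      σ zero * 1# * monomial (σ ∘ suc) 𝟘
        ≈⟨ *-congˡ {σ zero * 1#} (monomial-𝟘 (σ ∘ suc)) ⟩
      σ zero * 1# * 1#
        ≈⟨ trans (*-identityʳ (σ zero * 1#)) (*-identityʳ (σ zero)) ⟩
      σ zero ∎
    monomial-var {suc m} σ (suc i) = begin
      monomial σ (0 ∷ unit)
        ≡⟨ ∏-allFin-suc m (λ j → σ j ^ₚ Vec.lookup (0 ∷ unit) j) ⟩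
      1# * monomial (σ ∘ suc) unit
        ≈⟨ *-identityˡ (monomial (σ ∘ suc) unit) ⟩
      monomial (σ ∘ suc) unit
        ≈⟨ monomial-var (σ ∘ suc) i ⟩
      σ (suc i) ∎
      where unit = 𝟘 Vec.[ i ]≔ 1

  -- Substitution is the transpose of a pullback of functionals. Thus multiplicativity of
  -- `substitute` reduces to that of `monomial σ` and an interchange of sums.
  ⟨,⟩-substitute : ∀ {m n} (σ : Fin m → Poly n) f φ →
                   ⟨ substitute σ f , φ ⟩ F.≈ ⟨ f , (λ m → ⟨ monomial σ m , φ ⟩) ⟩
  ⟨,⟩-substitute σ []            φ = F.refl
  ⟨,⟩-substitute σ ((a , m) ∷ f) φ =
    F.trans (⟨,⟩-++ (constₚ a *ₚ monomial σ m) (substitute σ f) φ)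
      (F.+-cong (⟨,⟩-const-*ₚ a (monomial σ m) φ) (⟨,⟩-substitute σ f φ))

  substitute-* : ∀ {m n} (σ : Fin m → Poly n) f g →
                 substitute σ (f *ₚ g) ≋ substitute σ f *ₚ substitute σ g
  substitute-* σ f g = separate λ φ → begin
    ⟨ substitute σ (f *ₚ g) , φ ⟩
      ≈⟨ F.trans (⟨,⟩-substitute σ (f *ₚ g) φ) (⟨,⟩-*ₚ f g (λ m → ⟨ M m , φ ⟩)) ⟩
    ⟨ f , (λ m₁ → ⟨ g , (λ m₂ → ⟨ M (m₁ ⊕ m₂) , φ ⟩) ⟩) ⟩
      ≈⟨ ⟨,⟩-congʳ f (λ m₁ → ⟨,⟩-congʳ g λ m₂ →
           F.trans (⟨ monomial-⊕ σ m₁ m₂ ,⟩ φ) (⟨,⟩-*ₚ (M m₁) (M m₂) φ)) ⟩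
    ⟨ f , (λ m₁ → ⟨ g , (λ m₂ → ⟨ M m₁ , (λ k₁ → ⟨ M m₂ , (λ k₂ → φ (k₁ ⊕ k₂)) ⟩) ⟩) ⟩) ⟩
      ≈⟨ ⟨,⟩-congʳ f (λ m₁ → ⟨,⟩-swap g (M m₁) (λ m₂ k₁ → ⟨ M m₂ , (λ k₂ → φ (k₁ ⊕ k₂)) ⟩)) ⟩
    ⟨ f , (λ m₁ → ⟨ M m₁ , (λ k₁ → ⟨ g , (λ m₂ → ⟨ M m₂ , (λ k₂ → φ (k₁ ⊕ k₂)) ⟩) ⟩) ⟩) ⟩
      ≈⟨ ⟨,⟩-congʳ f (λ m₁ → ⟨,⟩-congʳ (M m₁) λ k₁ → ⟨,⟩-substitute σ g (λ k₂ → φ (k₁ ⊕ k₂))) ⟨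
    ⟨ f , (λ m₁ → ⟨ M m₁ , (λ k₁ → ⟨ substitute σ g , (λ k₂ → φ (k₁ ⊕ k₂)) ⟩) ⟩) ⟩
      ≈⟨ ⟨,⟩-substitute σ f (λ k₁ → ⟨ substitute σ g , (λ k₂ → φ (k₁ ⊕ k₂)) ⟩) ⟨
    ⟨ substitute σ f , (λ k₁ → ⟨ substitute σ g , (λ k₂ → φ (k₁ ⊕ k₂)) ⟩) ⟩
      ≈⟨ ⟨,⟩-*ₚ (substitute σ f) (substitute σ g) φ ⟨
    ⟨ substitute σ f *ₚ substitute σ g , φ ⟩ ∎
    where
    open Relation.Binary.Reasoning.Setoid F.setoid
    M = monomial σ

  substitute-cong : ∀ {m n} (σ : Fin m → Poly n) {f g} → f ≋ g → substitute σ f ≋ substitute σ g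
  substitute-cong σ {f} {g} f≋g = separate λ φ → F.trans (⟨,⟩-substitute σ f φ)
    (F.trans (⟨ f≋g ,⟩ _) (F.sym (⟨,⟩-substitute σ g φ)))

  module _ {m n : ℕ} where

    open CommutativeRing (polyRing n) hiding (zero)
    open SumLemmas (polyRing n)
    open Relation.Binary.Reasoning.Setoid setoid

    substitute-+ : ∀ (σ : Fin m → Poly n) f g → substitute σ (f +ₚ g) ≈ substitute σ f + substitute σ g
    substitute-+ σ f g = ∑-++ f g _

    substitute-const : ∀ (σ : Fin m → Poly n) a → substitute σ (constₚ a) ≈ constₚ a
    substitute-const σ a = begin
      constₚ a * monomial σ 𝟘 + 0# ≈⟨ +-identityʳ _ ⟩
      constₚ a * monomial σ 𝟘      ≈⟨ *-congˡ {constₚ a} (monomial-𝟘 σ) ⟩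
      constₚ a * 1#                ≈⟨ *-identityʳ _ ⟩
      constₚ a                     ∎

    substitute-var : ∀ (σ : Fin m → Poly n) i → substitute σ (var i) ≈ σ i
    substitute-var σ i = begin
      1# * monomial σ (𝟘 Vec.[ i ]≔ 1) + 0# ≈⟨ +-identityʳ _ ⟩
      1# * monomial σ (𝟘 Vec.[ i ]≔ 1)      ≈⟨ *-identityˡ _ ⟩
      monomial σ (𝟘 Vec.[ i ]≔ 1)           ≈⟨ monomial-var σ i ⟩
      σ i                                   ∎

    substitute-∑ : ∀ {a} {A : Set a} (σ : Fin m → Poly n) (xs : List A) (f : A → Poly m) →
                   substitute σ (SumLemmas.∑ (polyRing m) xs f) ≈ ∑ xs (λ x → substitute σ (f x))
    substitute-∑ σ []       f = refl
    substitute-∑ σ (x ∷ xs) f = trans (substitute-+ σ (f x) _) (+-congˡ (substitute-∑ σ xs f))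

    substitute-∏ : ∀ {a} {A : Set a} (σ : Fin m → Poly n) (xs : List A) (f : A → Poly m) →
                   substitute σ (SumLemmas.∏ (polyRing m) xs f) ≈ ∏ xs (λ x → substitute σ (f x))
    substitute-∏ σ []       f = substitute-const σ F.1#
    substitute-∏ σ (x ∷ xs) f = trans (substitute-* σ (f x) _) (*-congˡ {substitute σ (f x)} (substitute-∏ σ xs f))

-- Homogeneous components

module HomogeneousComponents {c ℓ} (K : Field c ℓ) where

  open Field K hiding (zero)
  open Valiant K renaming (const to constₚ; ∑ to ∑ₚ) hiding (∏)
  open PolynomialRing K
  open Relation.Binary.Reasoning.Setoid setoid
  private module S = SumLemmas commutativeRing

  component : ∀ {n} → ℕ → Poly n → Poly n
  component e = List.filter λ (_ , m) → Vec.sum m ℕ.≟ e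

  ⟨,⟩-component : ∀ {n} e (f : Poly n) φ →
                  ⟨ component e f , φ ⟩ ≈ ⟨ f , (λ m → [ does (Vec.sum m ℕ.≟ e) ]· φ m) ⟩
  ⟨,⟩-component e f φ = trans (S.∑-filter (λ (_ , m) → Vec.sum m ℕ.≟ e) f _)
    (S.∑-cong f λ (a , m) → sym (*-[]· (does (Vec.sum m ℕ.≟ e)) a (φ m)))

  component-+ : ∀ {n} e (f g : Poly n) → component e (f +ₚ g) ≡ component e f +ₚ component e g
  component-+ e f g = List.filter-++ _ f g

  private
    ∑-indicator : ∀ s n (X : ℕ → Carrier) →
                  S.∑ (upTo n) (λ a → [ does (s ℕ.≟ a) ]· X a) ≈ [ does (s ℕ.<? n) ]· X s
    ∑-indicator s       zero    X = refl
    ∑-indicator zero    (suc n) X = begin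
      S.∑ (upTo (suc n)) (λ a → [ does (0 ℕ.≟ a) ]· X a) ≡⟨ S.∑-upTo-suc n _ ⟩
      X 0 + S.∑ (upTo n) (λ _ → 0#)                      ≈⟨ +-congˡ (S.∑-0 (upTo n)) ⟩
      X 0 + 0#                                           ≈⟨ +-identityʳ _ ⟩
      X 0                                                ∎
    ∑-indicator (suc s) (suc n) X = begin
      S.∑ (upTo (suc n)) (λ a → [ does (suc s ℕ.≟ a) ]· X a)   ≡⟨ S.∑-upTo-suc n _ ⟩
      0# + S.∑ (upTo n) (λ a → [ does (s ℕ.≟ a) ]· X (suc a))  ≈⟨ +-identityˡ _ ⟩
      S.∑ (upTo n) (λ a → [ does (s ℕ.≟ a) ]· X (suc a))       ≈⟨ ∑-indicator s n (X ∘ suc) ⟩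
      [ does (s ℕ.<? n) ]· X (suc s)                           ∎

    []·-∧ : ∀ a b x → [ a ]· [ b ]· x ≡ [ a ∧ b ]· x
    []·-∧ true  b x = ≡.refl
    []·-∧ false b x = ≡.refl

    ⟨,⟩-[]· : ∀ {n} b (f : Poly n) φ → [ b ]· ⟨ f , φ ⟩ ≈ ⟨ f , (λ m → [ b ]· φ m) ⟩
    ⟨,⟩-[]· true  f φ = refl
    ⟨,⟩-[]· false f φ = sym (trans (S.∑-cong f λ (a , m) → zeroʳ a) (S.∑-0 f))

    -- The bound on `s₁` guards the truncated subtraction: without it, `s₁ > e` and `s₂ = 0` would
    -- be accepted.
    split⇔ : ∀ s₁ s₂ e → (s₁ < suc e × s₂ ≡ e ∸ s₁) ⇔ (s₁ ℕ.+ s₂ ≡ e)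
    split⇔ s₁ s₂ e = mk⇔ (λ { (s≤s s₁≤e , ≡.refl) → ℕ.m+[n∸m]≡n s₁≤e })
                         (λ { ≡.refl → s≤s (ℕ.m≤m+n s₁ s₂) , ≡.sym (ℕ.m+n∸m≡n s₁ s₂) })

  -- Terms of `f` and `g` contribute to degree `e` exactly when their degrees add up to `e`; for a
  -- given monomial of `f` a single summand `a` on the right sees it.
  component-* : ∀ {n} e (f g : Poly n) →
                component e (f *ₚ g) ≋ ∑ₚ (upTo (suc e)) λ a → component a f *ₚ component (e ∸ a) g
  component-* e f g = separate λ φ → begin
    ⟨ component e (f *ₚ g) , φ ⟩
      ≈⟨ trans (⟨,⟩-component e (f *ₚ g) φ) (⟨,⟩-*ₚ f g (λ m → [ does (Vec.sum m ℕ.≟ e) ]· φ m)) ⟩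
    ⟨ f , (λ m₁ → ⟨ g , (λ m₂ → [ does (Vec.sum (m₁ ⊕ m₂) ℕ.≟ e) ]· φ (m₁ ⊕ m₂)) ⟩) ⟩
      ≈⟨ ⟨,⟩-congʳ f (λ m₁ → inner φ m₁) ⟩
    ⟨ f , (λ m₁ → S.∑ (upTo (suc e)) λ a → [ does (Vec.sum m₁ ℕ.≟ a) ]· right φ m₁ (e ∸ a)) ⟩
      ≈⟨ ⟨,⟩-∑ f (upTo (suc e)) (λ a m₁ → [ does (Vec.sum m₁ ℕ.≟ a) ]· right φ m₁ (e ∸ a)) ⟩
    S.∑ (upTo (suc e)) (λ a → ⟨ f , (λ m₁ → [ does (Vec.sum m₁ ℕ.≟ a) ]· right φ m₁ (e ∸ a)) ⟩)
      ≈⟨ S.∑-cong (upTo (suc e)) (λ a → trans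
           (⟨,⟩-*ₚ (component a f) (component (e ∸ a) g) φ)
           (⟨,⟩-component a f (λ m₁ → right φ m₁ (e ∸ a)))) ⟨
    S.∑ (upTo (suc e)) (λ a → ⟨ component a f *ₚ component (e ∸ a) g , φ ⟩)
      ≈⟨ pull φ (upTo (suc e)) ⟨
    ⟨ ∑ₚ (upTo (suc e)) (λ a → component a f *ₚ component (e ∸ a) g) , φ ⟩ ∎
    where
    right : ∀ φ m₁ e → Carrier
    right φ m₁ e = ⟨ component e g , (λ m₂ → φ (m₁ ⊕ m₂)) ⟩
    pull : ∀ φ xs → ⟨ ∑ₚ xs (λ a → component a f *ₚ component (e ∸ a) g) , φ ⟩
                  ≈ S.∑ xs (λ a → ⟨ component a f *ₚ component (e ∸ a) g , φ ⟩)
    pull φ []       = refl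
    pull φ (a ∷ xs) = trans (⟨,⟩-++ (component a f *ₚ component (e ∸ a) g) _ φ) (+-congˡ (pull φ xs))
    inner : ∀ φ m₁ → ⟨ g , (λ m₂ → [ does (Vec.sum (m₁ ⊕ m₂) ℕ.≟ e) ]· φ (m₁ ⊕ m₂)) ⟩
                   ≈ S.∑ (upTo (suc e)) (λ a → [ does (Vec.sum m₁ ℕ.≟ a) ]· right φ m₁ (e ∸ a))
    inner φ m₁ = begin
      ⟨ g , (λ m₂ → [ does (Vec.sum (m₁ ⊕ m₂) ℕ.≟ e) ]· φ (m₁ ⊕ m₂)) ⟩
        ≈⟨ ⟨,⟩-congʳ g (λ m₂ → reflexive (≡.trans
             (≡.cong ([_]· φ (m₁ ⊕ m₂)) (≡.trans
               (≡.cong (λ s → does (s ℕ.≟ e)) (sum-⊕ m₁ m₂))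
               (≡.sym (does-⇔ (split⇔ s₁ (Vec.sum m₂) e)
                 ((s₁ ℕ.<? suc e) ×-dec (Vec.sum m₂ ℕ.≟ e ∸ s₁)) (s₁ ℕ.+ Vec.sum m₂ ℕ.≟ e)))))
             (≡.sym ([]·-∧ (does (s₁ ℕ.<? suc e)) _ _)))) ⟩
      ⟨ g , (λ m₂ → [ does (s₁ ℕ.<? suc e) ]· [ does (Vec.sum m₂ ℕ.≟ e ∸ s₁) ]· φ (m₁ ⊕ m₂)) ⟩
        ≈⟨ ⟨,⟩-[]· (does (s₁ ℕ.<? suc e)) g (λ m₂ → [ does (Vec.sum m₂ ℕ.≟ e ∸ s₁) ]· φ (m₁ ⊕ m₂)) ⟨
      [ does (s₁ ℕ.<? suc e) ]· ⟨ g , (λ m₂ → [ does (Vec.sum m₂ ℕ.≟ e ∸ s₁) ]· φ (m₁ ⊕ m₂)) ⟩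
        ≈⟨ []·-cong (does (s₁ ℕ.<? suc e)) (⟨,⟩-component (e ∸ s₁) g (λ m₂ → φ (m₁ ⊕ m₂))) ⟨
      [ does (s₁ ℕ.<? suc e) ]· right φ m₁ (e ∸ s₁)
        ≈⟨ ∑-indicator s₁ (suc e) (λ a → right φ m₁ (e ∸ a)) ⟨
      S.∑ (upTo (suc e)) (λ a → [ does (s₁ ℕ.≟ a) ]· right φ m₁ (e ∸ a)) ∎
      where s₁ = Vec.sum m₁

  -- The only monomial of degree 0 is `𝟘`. This turns the degree 0 part of a gate into a constant
  -- that can be used as a weight.
  component-0 : ∀ {n} (f : Poly n) → component 0 f ≋ constₚ (coeff 𝟘 f)
  component-0 {n} f = separate λ φ → begin
    ⟨ component 0 f , φ ⟩
      ≈⟨ ⟨,⟩-component 0 f φ ⟩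
    ⟨ f , (λ m → [ does (Vec.sum m ℕ.≟ 0) ]· φ m) ⟩
      ≈⟨ ⟨,⟩-congʳ f (λ m → pointwise φ m) ⟩
    ⟨ f , (λ m → φ 𝟘 * δ 𝟘 m) ⟩
      ≈⟨ ⟨,⟩-*ˡ f (φ 𝟘) (δ 𝟘) ⟨
    φ 𝟘 * ⟨ f , δ 𝟘 ⟩
      ≈⟨ trans (*-comm _ _) (*-congʳ (sym (coeff≈⟨,δ⟩ 𝟘 f))) ⟩
    coeff 𝟘 f * φ 𝟘
      ≈⟨ ⟨,⟩-const (coeff 𝟘 f) φ ⟨
    ⟨ constₚ (coeff 𝟘 f) , φ ⟩ ∎
    where
    pointwise : ∀ φ m → [ does (Vec.sum m ℕ.≟ 0) ]· φ m ≈ φ 𝟘 * δ 𝟘 m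
    pointwise φ m with 𝟘 ≟ₘ m
    ... | yes ≡.refl = trans
      (reflexive (≡.cong ([_]· φ 𝟘) (dec-true (Vec.sum m ℕ.≟ 0) (sum-𝟘 n)))) (sym (*-identityʳ _))
    ... | no 𝟘≢m = trans
      (reflexive (≡.cong ([_]· φ m) (dec-false (Vec.sum m ℕ.≟ 0) (𝟘≢m ∘ sum≡0 m)))) (sym (zeroʳ _))

  component-var-1 : ∀ {n} (i : Fin n) → component 1 (var i) ≡ var i
  component-var-1 i = List.filter-accept (λ (_ , m) → Vec.sum m ℕ.≟ 1) (sum-unit i)

  component-var : ∀ {n} e (i : Fin n) → component (suc (suc e)) (var i) ≡ []
  component-var e i = List.filter-reject (λ (_ , m) → Vec.sum m ℕ.≟ suc (suc e)) {x = 1# , 𝟘 Vec.[ i ]≔ 1} {xs = []}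
    λ eq → ℕ.1+n≢0 (ℕ.suc-injective (≡.trans (≡.sym eq) (sum-unit i)))

  component-const : ∀ {n} e a → component {n} (suc e) (constₚ a) ≡ []
  component-const {n} e a = List.filter-reject (λ (_ , m) → Vec.sum m ℕ.≟ suc e) {x = a , 𝟘} {xs = []}
    λ eq → ℕ.1+n≢0 (≡.trans (≡.sym eq) (sum-𝟘 n))

  -- `DegreeAtMost` constrains coefficients and not the listed terms: terms of high degree may be
  -- present as long as they cancel. Hence the comparison is made coefficient by coefficient.
  decompose : ∀ {n} d (f : Poly n) → DegreeAtMost d f → f ≋ ∑ₚ (upTo (suc d)) λ e → component e f
  decompose d f deg = mk≋ λ m → sym $ begin
    coeff m (∑ₚ (upTo (suc d)) λ e → component e f)
      ≈⟨ pull m (upTo (suc d)) ⟩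
    S.∑ (upTo (suc d)) (λ e → coeff m (component e f))
      ≈⟨ S.∑-cong (upTo (suc d)) (λ e → at m e) ⟩
    S.∑ (upTo (suc d)) (λ e → [ does (Vec.sum m ℕ.≟ e) ]· coeff m f)
      ≈⟨ ∑-indicator (Vec.sum m) (suc d) (λ _ → coeff m f) ⟩
    [ does (Vec.sum m ℕ.<? suc d) ]· coeff m f
      ≈⟨ below m ⟩
    coeff m f ∎
    where
    coeff-++ : ∀ m g h → coeff m (g ++ h) ≈ coeff m g + coeff m h
    coeff-++ m g h = trans (coeff≈⟨,δ⟩ m (g ++ h)) (trans (⟨,⟩-++ g h (δ m))
      (sym (+-cong (coeff≈⟨,δ⟩ m g) (coeff≈⟨,δ⟩ m h))))
    pull : ∀ m xs → coeff m (∑ₚ xs λ e → component e f) ≈ S.∑ xs (λ e → coeff m (component e f))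
    pull m []       = refl
    pull m (e ∷ xs) = trans (coeff-++ m (component e f) _) (+-congˡ (pull m xs))
    move : ∀ m e m′ → [ does (Vec.sum m′ ℕ.≟ e) ]· δ m m′ ≈ [ does (Vec.sum m ℕ.≟ e) ]· δ m m′
    move m e m′ with m ≟ₘ m′
    ... | yes ≡.refl = refl
    ... | no  _      = trans (zeros (does (Vec.sum m′ ℕ.≟ e))) (sym (zeros (does (Vec.sum m ℕ.≟ e))))
      where
      zeros : ∀ b → [ b ]· 0# ≈ 0#
      zeros true  = refl
      zeros false = refl
    at : ∀ m e → coeff m (component e f) ≈ [ does (Vec.sum m ℕ.≟ e) ]· coeff m f
    at m e = begin
      coeff m (component e f)
        ≈⟨ coeff≈⟨,δ⟩ m (component e f) ⟩
      ⟨ component e f , δ m ⟩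
        ≈⟨ ⟨,⟩-component e f (δ m) ⟩
      ⟨ f , (λ m′ → [ does (Vec.sum m′ ℕ.≟ e) ]· δ m m′) ⟩
        ≈⟨ ⟨,⟩-congʳ f (λ m′ → move m e m′) ⟩
      ⟨ f , (λ m′ → [ does (Vec.sum m ℕ.≟ e) ]· δ m m′) ⟩
        ≈⟨ ⟨,⟩-[]· (does (Vec.sum m ℕ.≟ e)) f (δ m) ⟨
      [ does (Vec.sum m ℕ.≟ e) ]· ⟨ f , δ m ⟩
        ≈⟨ []·-cong (does (Vec.sum m ℕ.≟ e)) (coeff≈⟨,δ⟩ m f) ⟨
      [ does (Vec.sum m ℕ.≟ e) ]· coeff m f ∎
    below : ∀ m → [ does (Vec.sum m ℕ.<? suc d) ]· coeff m f ≈ coeff m f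
    below m with does (Vec.sum m ℕ.<? suc d) in eq
    ... | true  = refl
    ... | false = sym (deg m (ℕ.≰⇒> (does-false (Vec.sum m ℕ.<? suc d) eq ∘ s≤s)))
      where
      does-false : ∀ {A : Set} (A? : Dec A) → does A? ≡ false → A → ⊥
      does-false (no ¬a) _ = ¬a

-- Nodes, markings and chains of intervals

-- The node (l , i , e) stands for a parse tree of the degree e component of
-- gate l whose leaves are numbered i, …, i + e − 1. The nodes occurring in a
-- single parse tree are then automatically distinct.
Node : Set
Node = ℕ × ℕ × ℕ

first span last : Node → ℕ
first (_ , i , _) = i
span (_ , _ , e) = e
last  (_ , i , e) = i ℕ.+ e

_≟ₙ_ : DecidableEquality Node
_≟ₙ_ = Product.≡-dec ℕ._≟_ (Product.≡-dec ℕ._≟_ ℕ._≟_)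

-- `inn t` is covered when a parent has selected t as a child, `out t` when t
-- has been expanded; an independent set describes a parse tree iff it covers
-- both or neither, for every t.
data Point : Set where
  lit     : ℕ → Point
  inn out : Node → Point

lit-injective : ∀ {k l} → lit k ≡ lit l → k ≡ l
lit-injective ≡.refl = ≡.refl

inn-injective : ∀ {s t} → inn s ≡ inn t → s ≡ t
inn-injective ≡.refl = ≡.refl

out-injective : ∀ {s t} → out s ≡ out t → s ≡ t
out-injective ≡.refl = ≡.refl

_≟ₚ_ : DecidableEquality Point
lit k ≟ₚ lit l = map′ (≡.cong lit) lit-injective (k ℕ.≟ l)
inn s ≟ₚ inn t = map′ (≡.cong inn) inn-injective (s ≟ₙ t)
out s ≟ₚ out t = map′ (≡.cong out) out-injective (s ≟ₙ t)
lit _ ≟ₚ inn _ = no λ ()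
lit _ ≟ₚ out _ = no λ ()
inn _ ≟ₚ lit _ = no λ ()
inn _ ≟ₚ out _ = no λ ()
out _ ≟ₚ lit _ = no λ ()
out _ ≟ₚ inn _ = no λ ()

open DecMembership _≟ₙ_ public using () renaming (_∈?_ to _∈ₙ?_)
open DecMembership _≟ₚ_ public using () renaming (_∈?_ to _∈ₚ?_)

-- A vertex may be chosen unless one of its `checks` is marked; choosing it
-- marks its `covers`.
record Vertex {w} (W : Set w) : Set w where
  constructor vertex
  field
    weight : W
    checks covers : List Point
open Vertex public

record Production {w} (W : Set w) : Set w where
  constructor production
  field
    weight   : W
    literals : List ℕ
    children : List Node

Marking : Set
Marking = Point → Bool

mark : List Point → Marking → Marking
mark ps S p = does (p ∈ₚ? ps) ∨ S p

mark-∉ : ∀ {p} ps S → p ∉ ps → mark ps S p ≡ S p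
mark-∉ {p} ps S p∉ps = ≡.cong (_∨ S p) (dec-false (p ∈ₚ? ps) p∉ps)

mark-∈ : ∀ {p} ps S → p ∈ ps → mark ps S p ≡ true
mark-∈ {p} ps S p∈ps = ≡.cong (_∨ S p) (dec-true (p ∈ₚ? ps) p∈ps)

mark-marked : ∀ {p} ps S → S p ≡ true → mark ps S p ≡ true
mark-marked {p} ps S eq = ≡.trans (≡.cong (does (p ∈ₚ? ps) ∨_) eq) (Bool.∨-zeroʳ _)

-- Gaps are allowed, because a leaf uses up a number without leaving a node behind and the root may
-- expand to a tree with fewer leaves than its span. Empty intervals are excluded, because repeated
-- nodes could not be ruled out otherwise.
data Chain : ℕ → List Node → ℕ → Set where
  nil  : ∀ {a b} → a ≤ b → Chain a [] b
  cons : ∀ {a b t A} → a ≤ first t → 1 ≤ span t → Chain (last t) A b → Chain a (t ∷ A) b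

chain-≤ : ∀ {a A b} → Chain a A b → a ≤ b
chain-≤ (nil a≤b) = a≤b
chain-≤ (cons {t = t} a≤t _ c) = ℕ.≤-trans a≤t (ℕ.≤-trans (ℕ.m≤m+n (first t) (span t)) (chain-≤ c))

chain-weaken : ∀ {a a′ A b} → a′ ≤ a → Chain a A b → Chain a′ A b
chain-weaken a′≤a (nil a≤b)      = nil (ℕ.≤-trans a′≤a a≤b)
chain-weaken a′≤a (cons a≤t p c) = cons (ℕ.≤-trans a′≤a a≤t) p c

chain-++ : ∀ {a A b B c} → Chain a A b → Chain b B c → Chain a (A ++ B) c
chain-++ (nil a≤b)      d = chain-weaken a≤b d
chain-++ (cons a≤t p c) d = cons a≤t p (chain-++ c d)

-- The children of a node stay within its interval, so the list of unexpanded nodes remains ordered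
-- when one of them is expanded.
chain-replace : ∀ {a b t} A {B} → Chain a (A ++ t ∷ B) b →
                ∀ {C} → Chain (first t) C (last t) → Chain a (A ++ C ++ B) b
chain-replace []      (cons a≤t _ c) d = chain-weaken a≤t (chain-++ d c)
chain-replace (_ ∷ A) (cons a≤s p c) d = cons a≤s p (chain-replace A c d)

chain-after : ∀ {a A b} → Chain a A b → All (λ t → a ≤ first t) A
chain-after (nil _) = []
chain-after (cons {t = t} a≤t _ c) =
  a≤t ∷ All.map (ℕ.≤-trans (ℕ.≤-trans a≤t (ℕ.m≤m+n (first t) (span t)))) (chain-after c)

Fits : ℕ → Node → Set
Fits D t = 1 ≤ span t × last t ≤ D

chain-fits : ∀ {a A b} → Chain a A b → All (Fits b) A
chain-fits (nil _)      = []
chain-fits (cons _ p c) = (p , chain-≤ c) ∷ chain-fits c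

last≰first : ∀ t → 1 ≤ span t → ¬ (last t ≤ first t)
last≰first t p q = ℕ.<-irrefl ≡.refl (ℕ.≤-trans (ℕ.m<m+n (first t) p) q)

chain-∉ʳ : ∀ {a b t} A {B} → Chain a (A ++ t ∷ B) b → t ∉ B
chain-∉ʳ {t = t} []      (cons _ p c) t∈B = last≰first t p (All.lookup (chain-after c) t∈B)
chain-∉ʳ (_ ∷ A) (cons _ _ c) t∈B = chain-∉ʳ A c t∈B

chain-∉ˡ : ∀ {a b t} A {B} → Chain a (A ++ t ∷ B) b → t ∉ A
chain-∉ˡ (s ∷ A) (cons _ p c) (here ≡.refl) =
  last≰first s p (All.lookup (chain-after c) (∈-++⁺ʳ A (here ≡.refl)))
chain-∉ˡ (s ∷ A) (cons _ _ c) (there t∈A) = chain-∉ˡ A c t∈A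

-- Derivations of a grammar as independent sets

module Grammar {r ℓ w} (R : CommutativeRing r ℓ) {W : Set w}
               (ι : W → CommutativeRing.Carrier R) where

  open CommutativeRing R hiding (zero)
  open SumLemmas R
  open Algebra.Properties.Ring ring using (-1*x≈-x)
  open Algebra.Properties.CommutativeSemigroup *-commutativeSemigroup using (x∙yz≈y∙xz)
  open Relation.Binary.Reasoning.Setoid setoid

  -- The independence polynomial of the conflict graph.
  Z : List (Vertex W) → Marking → Carrier
  Z []      S = 1#
  Z (v ∷ L) S =
    Z L S + (if any S (checks v) then 0# else ι (weight v) * Z L (mark (covers v) S))

  module Blocks (one -one : W) (ι-one : ι one ≈ 1#) (ι--one : ι -one ≈ - 1#) where

    -- The point `out t` is both checked and covered, which makes the productions of `t` mutually
    -- exclusive.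
    productionVertex : Node → Production W → Vertex W
    productionVertex t (production w ls ch) =
      vertex w (out t ∷ List.map lit ls) (out t ∷ List.map inn ch)

    -- The two vertices of weight -1 cover nothing, so wherever one of them is free, choosing it or
    -- not gives opposite terms and the sum vanishes. If both points of `t` are unmarked, only the
    -- choice of `idle⁰` survives: it marks both points and so blocks the other two.
    idle⁰ out⁻ inn⁻ : Node → Vertex W
    idle⁰ t = vertex one  (inn t ∷ out t ∷ []) (inn t ∷ out t ∷ [])
    out⁻  t = vertex -one (out t ∷ []) []
    inn⁻  t = vertex -one (inn t ∷ []) []

    -- The vertices of weight −1 cancel all independent sets in which exactly
    -- one of `inn t` and `out t` is covered.
    switch : Node → List (Vertex W) → List (Vertex W)
    switch t L = idle⁰ t ∷ out⁻ t ∷ inn⁻ t ∷ L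

    blocks : List (Node × List (Production W)) → List (Vertex W)
    blocks []             = []
    blocks ((t , ps) ∷ T) = List.map (productionVertex t) ps ++ switch t (blocks T)

    private
      cancel : ∀ p L S → S p ≡ false → Z (vertex -one (p ∷ []) [] ∷ L) S ≈ 0#
      cancel p L S eq rewrite eq =
        trans (+-congˡ (trans (*-congʳ ι--one) (-1*x≈-x _))) (-‿inverseʳ _)

      absent : ∀ v L S → any S (checks v) ≡ true → Z (v ∷ L) S ≈ Z L S
      absent v L S eq rewrite eq = +-identityʳ _

      any-∷ : ∀ (S : Marking) p ps → S p ≡ true → any S (p ∷ ps) ≡ true
      any-∷ S p ps eq = ≡.cong (_∨ any S ps) eq

      annihilate : ∀ t L S → S (out t) ≡ false → Z (out⁻ t ∷ inn⁻ t ∷ L) S ≈ 0#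
      annihilate t L S = cancel (out t) (inn⁻ t ∷ L) S

    switch-pending : ∀ t L S → S (inn t) ≡ true → S (out t) ≡ false → Z (switch t L) S ≈ 0#
    switch-pending t L S i o = trans
      (absent (idle⁰ t) (out⁻ t ∷ inn⁻ t ∷ L) S (any-∷ S (inn t) (out t ∷ []) i)) (annihilate t L S o)

    switch-done : ∀ t L S → S (inn t) ≡ true → S (out t) ≡ true → Z (switch t L) S ≈ Z L S
    switch-done t L S i o = trans (absent (idle⁰ t) (out⁻ t ∷ inn⁻ t ∷ L) S (any-∷ S (inn t) (out t ∷ []) i))
      (trans (absent (out⁻ t) (inn⁻ t ∷ L) S (any-∷ S (out t) [] o)) (absent (inn⁻ t) L S (any-∷ S (inn t) [] i)))

    switch-spurious : ∀ t L S → S (inn t) ≡ false → S (out t) ≡ true → Z (switch t L) S ≈ 0#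
    switch-spurious t L S i o = trans (absent (idle⁰ t) (out⁻ t ∷ inn⁻ t ∷ L) S
      (≡.trans (≡.cong (S (inn t) ∨_) (any-∷ S (out t) [] o)) (Bool.∨-zeroʳ _)))
      (trans (absent (out⁻ t) (inn⁻ t ∷ L) S (any-∷ S (out t) [] o)) (cancel (inn t) L S i))

    switch-idle : ∀ t L S → S (inn t) ≡ false → S (out t) ≡ false →
                  Z (switch t L) S ≈ Z L (mark (inn t ∷ out t ∷ []) S)
    switch-idle t L S i o = begin
      Z (switch t L) S
        ≡⟨ ≡.cong₂ (λ a b → Z (out⁻ t ∷ inn⁻ t ∷ L) S +
             (if a ∨ b ∨ false then 0# else ι one * Z (out⁻ t ∷ inn⁻ t ∷ L) S′)) i o ⟩
      Z (out⁻ t ∷ inn⁻ t ∷ L) S + ι one * Z (out⁻ t ∷ inn⁻ t ∷ L) S′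
        ≈⟨ +-cong (annihilate t L S o) (trans (*-congʳ ι-one) (*-identityˡ _)) ⟩
      0# + Z (out⁻ t ∷ inn⁻ t ∷ L) S′
        ≈⟨ +-identityˡ _ ⟩
      Z (out⁻ t ∷ inn⁻ t ∷ L) S′
        ≈⟨ absent (out⁻ t) (inn⁻ t ∷ L) S′
             (any-∷ S′ (out t) [] (mark-∈ (inn t ∷ out t ∷ []) S (there (here ≡.refl)))) ⟩
      Z (inn⁻ t ∷ L) S′
        ≈⟨ absent (inn⁻ t) L S′ (any-∷ S′ (inn t) [] (mark-∈ (inn t ∷ out t ∷ []) S (here ≡.refl))) ⟩
      Z L S′ ∎
      where S′ = mark (inn t ∷ out t ∷ []) S

    productions-blocked : ∀ t ps L S → S (out t) ≡ true →
                          Z (List.map (productionVertex t) ps ++ L) S ≈ Z L S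
    productions-blocked t []       L S o = refl
    productions-blocked t (p ∷ ps) L S o =
      trans
        (absent (productionVertex t p) (List.map (productionVertex t) ps ++ L) S
          (any-∷ S (out t) (List.map lit (Production.literals p)) o))
        (productions-blocked t ps L S o)

    effective : Marking → Production W → Carrier
    effective S (production w ls _) = if any S (List.map lit ls) then 0# else ι w

    expand : Node → Production W → Marking → Marking
    expand t (production _ _ ch) = mark (out t ∷ List.map inn ch)

    productions-free : ∀ t ps L S → S (out t) ≡ false →
      Z (List.map (productionVertex t) ps ++ L) S
        ≈ Z L S + ∑ ps (λ π → effective S π * Z L (expand t π S))
    productions-free t []       L S o = sym (+-identityʳ _)
    productions-free t (π@(production w ls ch) ∷ ps) L S o = begin
      Z Lps S + (if S (out t) ∨ b then 0# else ι w * Z Lps S′)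
        ≡⟨ ≡.cong (λ a → Z Lps S + (if a ∨ b then 0# else ι w * Z Lps S′)) o ⟩
      Z Lps S + (if b then 0# else ι w * Z Lps S′)
        ≈⟨ +-cong (productions-free t ps L S o) (choose b) ⟩
      Z L S + ∑ ps (λ π → effective S π * Z L (expand t π S)) + effective S π * Z L S′
        ≈⟨ trans (+-assoc _ _ _) (+-congˡ (+-comm _ _)) ⟩
      Z L S + (effective S π * Z L S′ + ∑ ps (λ π → effective S π * Z L (expand t π S))) ∎
      where
      b   = any S (List.map lit ls)
      S′  = expand t π S
      Lps = List.map (productionVertex t) ps ++ L
      choose : ∀ b → (if b then 0# else ι w * Z Lps S′) ≈ (if b then 0# else ι w) * Z L S′
      choose true  = sym (zeroˡ _)
      choose false = *-congˡ (productions-blocked t ps L S′ (mark-∈ (out t ∷ List.map inn ch) S (here ≡.refl)))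

    module Derivation (D : ℕ) (Λ : ℕ → Bool) (V : Node → Carrier) where

      value : Production W → Carrier
      value (production w ls ch) = (if any Λ ls then 0# else ι w) * ∏ ch V

      Nodes : List (Node × List (Production W)) → List Node
      Nodes = List.map proj₁

      -- The table has a row for every interval in a square, including empty ones, where the
      -- equation can fail for lack of productions, and ones reaching beyond `D`, whose children may
      -- be missing from the table. No chain inside [0, `D`] contains such a node, so tiling,
      -- closure and the equation are asked only of nodes that fit. The first two fields are needed
      -- for idle nodes as well.
      record SoundRow (t : Node) (ps : List (Production W)) (later : List Node) : Set (ℓ Level.⊔ w) where
        field
          fresh : t ∉ later
          irreflexive : All (λ π → t ∉ Production.children π) ps
          tiling : Fits D t → All (λ π → Chain (first t) (Production.children π) (last t)) ps
          closed : Fits D t → All (λ π → All (_∈ later) (Production.children π)) ps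
          equation : Fits D t → V t ≈ ∑ ps value

      data Sound : List (Node × List (Production W)) → Set (ℓ Level.⊔ w) where
        []  : Sound []
        _∷_ : ∀ {t ps T} → SoundRow t ps (Nodes T) → Sound T → Sound ((t , ps) ∷ T)

      -- The invariant of the derivation: `A` is the frontier of a partial parse tree, that is, the
      -- nodes produced but not yet expanded, from left to right.
      record Pending (T : List (Node × List (Production W))) (S : Marking) (A : List Node) : Set where
        field
          chain : Chain 0 A D
          known : All (_∈ Nodes T) A
          inns  : ∀ {t} → t ∈ Nodes T → S (inn t) ≡ does (t ∈ₙ? A)
          outs  : ∀ {t} → t ∈ Nodes T → S (out t) ≡ false
          lits  : ∀ k → S (lit k) ≡ Λ k
      open Pending

      private
        other : ∀ {s t : Node} {later} → t ∉ later → s ∈ later → s ≢ t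
        other t∉ s∈ ≡.refl = t∉ s∈

        shrink : ∀ {t : Node} {T A} → All (_∈ t ∷ T) A → t ∉ A → All (_∈ T) A
        shrink []                  t∉ = []
        shrink (here ≡.refl ∷ _)   t∉ = ⊥-elim (t∉ (here ≡.refl))
        shrink (there x∈T ∷ xs∈T)  t∉ = x∈T ∷ shrink xs∈T (t∉ ∘ there)

        any-lits : ∀ {S} → (∀ k → S (lit k) ≡ Λ k) → ∀ ls → any S (List.map lit ls) ≡ any Λ ls
        any-lits eq []       = ≡.refl
        any-lits eq (l ∷ ls) = ≡.cong₂ _∨_ (eq l) (any-lits eq ls)

        idle : ∀ {t ps T S A} → t ∉ Nodes T → Pending ((t , ps) ∷ T) S A → t ∉ A →
               Pending T (mark (inn t ∷ out t ∷ []) S) A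
        idle {t} {S = S} t∉T pend t∉A = record
          { chain = chain pend
          ; known = shrink (known pend) t∉A
          ; inns  = λ s∈T → ≡.trans
              (mark-∉ (inn t ∷ out t ∷ []) S
                λ { (here eq) → other t∉T s∈T (inn-injective eq) ; (there (here ())) ; (there (there ())) })
              (inns pend (there s∈T))
          ; outs  = λ s∈T → ≡.trans
              (mark-∉ (inn t ∷ out t ∷ []) S
                λ { (here ()) ; (there (here eq)) → other t∉T s∈T (out-injective eq) ; (there (there ())) })
              (outs pend (there s∈T))
          ; lits  = λ k → ≡.trans
              (mark-∉ (inn t ∷ out t ∷ []) S λ { (here ()) ; (there (here ())) ; (there (there ())) })
              (lits pend k)
          }

        -- The point `inn t` stays marked although `t` leaves the frontier. The invariant speaks
        -- only of later rows, among which `t` does not recur, so this is harmless.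
        step : ∀ {t ps T S} A {B} → t ∉ Nodes T → Pending ((t , ps) ∷ T) S (A ++ t ∷ B) →
               ∀ {w ls} ch → Chain (first t) ch (last t) → All (_∈ Nodes T) ch →
               Pending T (expand t (production w ls ch) S) (A ++ ch ++ B)
        step {t} {T = T} {S = S} A {B} t∉T pend ch tiles ch∈T = record
          { chain = chain-replace A (chain pend) tiles
          ; known = All.++⁺ (shrink (All.++⁻ˡ A (known pend)) (chain-∉ˡ A (chain pend)))
              (All.++⁺ ch∈T (shrink (All.tail (All.++⁻ʳ A (known pend))) (chain-∉ʳ A (chain pend))))
          ; inns  = λ {s} s∈T → ≡.trans
              (≡.cong (does (inn s ∈ₚ? (out t ∷ List.map inn ch)) ∨_) (inns pend (there s∈T)))
              (does-⇔ (iff s (other t∉T s∈T))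
                ((inn s ∈ₚ? (out t ∷ List.map inn ch)) ⊎-dec (s ∈ₙ? (A ++ t ∷ B)))
                (s ∈ₙ? (A ++ ch ++ B)))
          ; outs  = λ s∈T → ≡.trans (mark-∉ (out t ∷ List.map inn ch) S (∉out (other t∉T s∈T) ch)) (outs pend (there s∈T))
          ; lits  = λ k → ≡.trans (mark-∉ (out t ∷ List.map inn ch) S (∉lit k ch)) (lits pend k)
          }
          where
          ∉out : ∀ {s} → s ≢ t → ∀ ch → out s ∉ out t ∷ List.map inn ch
          ∉out s≢t ch (here eq) = s≢t (out-injective eq)
          ∉out s≢t ch (there p) with ∈-map⁻ inn p
          ... | _ , _ , ()
          ∉lit : ∀ k ch → lit k ∉ out t ∷ List.map inn ch
          ∉lit k ch (there p) with ∈-map⁻ inn p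
          ... | _ , _ , ()
          to : ∀ s → s ≢ t → (inn s ∈ out t ∷ List.map inn ch) ⊎ (s ∈ A ++ t ∷ B) → s ∈ A ++ ch ++ B
          to s s≢t (inj₁ (there p)) with ∈-map⁻ inn p
          ... | _ , s∈ch , ≡.refl = ∈-++⁺ʳ A (∈-++⁺ˡ s∈ch)
          to s s≢t (inj₂ p) with ∈-++⁻ A p
          ... | inj₁ s∈A          = ∈-++⁺ˡ s∈A
          ... | inj₂ (here s≡t)   = ⊥-elim (s≢t s≡t)
          ... | inj₂ (there s∈B)  = ∈-++⁺ʳ A (∈-++⁺ʳ ch s∈B)
          from : ∀ s → s ∈ A ++ ch ++ B → (inn s ∈ out t ∷ List.map inn ch) ⊎ (s ∈ A ++ t ∷ B)
          from s p with ∈-++⁻ A p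
          ... | inj₁ s∈A = inj₂ (∈-++⁺ˡ s∈A)
          ... | inj₂ q with ∈-++⁻ ch q
          ... | inj₁ s∈ch = inj₁ (there (∈-map⁺ inn s∈ch))
          ... | inj₂ s∈B  = inj₂ (∈-++⁺ʳ A (there s∈B))
          iff : ∀ s → s ≢ t → ((inn s ∈ out t ∷ List.map inn ch) ⊎ (s ∈ A ++ t ∷ B)) ⇔ (s ∈ A ++ ch ++ B)
          iff s s≢t = mk⇔ (to s s≢t) (from s)

      -- Induction over the rows, parents before children. For `t` outside the frontier every
      -- production is cancelled, as it sets `out t` without `inn t`, and `t` becomes idle. For `t`
      -- in the frontier the term without a production is cancelled, while each production replaces
      -- `t` by its children in the chain; summing over the productions gives back `V t` by the
      -- equation of the row. At the end of the table no node can be left in the frontier.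
      derive : ∀ T S A → Sound T → Pending T S A → Z (blocks T) S ≈ ∏ A V
      derive []             S []      []            pend = refl
      derive []             S (_ ∷ _) []            pend with known pend
      ... | () ∷ _
      derive ((t , ps) ∷ T) S A       (row ∷ sound) pend with t ∈ₙ? A | inns pend (here ≡.refl)
      ... | no t∉A | i = begin
        Z (List.map (productionVertex t) ps ++ switch t (blocks T)) S
          ≈⟨ productions-free t ps _ S o ⟩
        Z (switch t (blocks T)) S + ∑ ps (λ π → effective S π * Z (switch t (blocks T)) (expand t π S))
          ≈⟨ +-cong (switch-idle t (blocks T) S i o)
               (∑-cong-All (All.map (λ {π} → vanish π) (SoundRow.irreflexive row))) ⟩
        Z (blocks T) (mark (inn t ∷ out t ∷ []) S) + ∑ ps (λ _ → 0#)
          ≈⟨ trans (+-congˡ (∑-0 ps)) (+-identityʳ _) ⟩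
        Z (blocks T) (mark (inn t ∷ out t ∷ []) S)
          ≈⟨ derive T _ A sound (idle (SoundRow.fresh row) pend t∉A) ⟩
        ∏ A V ∎
        where
        o = outs pend (here ≡.refl)
        ∉inn : ∀ ch → t ∉ ch → inn t ∉ out t ∷ List.map inn ch
        ∉inn ch t∉ch (there p) with ∈-map⁻ inn p
        ... | _ , t∈ch , ≡.refl = t∉ch t∈ch
        vanish : ∀ π → t ∉ Production.children π →
                 effective S π * Z (switch t (blocks T)) (expand t π S) ≈ 0#
        -- Since no production of `t` produces `t` itself, `inn t` is still unmarked when the switch
        -- is reached.
        vanish π t∉ch = trans
          (*-congˡ (switch-spurious t (blocks T) (expand t π S)
            (≡.trans (mark-∉ (out t ∷ List.map inn (Production.children π)) S (∉inn (Production.children π) t∉ch)) i)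
            (mark-∈ (out t ∷ List.map inn (Production.children π)) S (here ≡.refl))))
          (zeroʳ _)
      ... | yes t∈A | i with ∈-∃++ t∈A
      ... | B , C , ≡.refl = begin
        Z (List.map (productionVertex t) ps ++ switch t (blocks T)) S
          ≈⟨ productions-free t ps _ S o ⟩
        Z (switch t (blocks T)) S + ∑ ps (λ π → effective S π * Z (switch t (blocks T)) (expand t π S))
          ≈⟨ +-cong (switch-pending t (blocks T) S i o)
               (∑-cong-All (All.zipWith (λ {π} (tiles , ch∈T) → recurse π tiles ch∈T)
                 (SoundRow.tiling row fits , SoundRow.closed row fits))) ⟩
        0# + ∑ ps (λ π → ∏ B V * (value π * ∏ C V))
          ≈⟨ +-identityˡ _ ⟩
        ∑ ps (λ π → ∏ B V * (value π * ∏ C V))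
          ≈⟨ *-distribˡ-∑ (∏ B V) ps _ ⟨
        ∏ B V * ∑ ps (λ π → value π * ∏ C V)
          ≈⟨ *-congˡ (*-distribʳ-∑ (∏ C V) ps value) ⟨
        ∏ B V * (∑ ps value * ∏ C V)
          ≈⟨ *-congˡ (*-congʳ (SoundRow.equation row fits)) ⟨
        ∏ B V * (V t * ∏ C V)
          ≈⟨ ∏-++ B (t ∷ C) V ⟨
        ∏ (B ++ t ∷ C) V ∎
        where
        o = outs pend (here ≡.refl)
        fits = All.lookup (chain-fits (chain pend)) t∈A
        recurse : ∀ π → Chain (first t) (Production.children π) (last t) →
                  All (_∈ Nodes T) (Production.children π) →
                  effective S π * Z (switch t (blocks T)) (expand t π S) ≈ ∏ B V * (value π * ∏ C V)
        recurse π@(production w ls ch) tiles ch∈T = begin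
          effective S π * Z (switch t (blocks T)) (expand t π S)
            ≈⟨ *-cong (reflexive (≡.cong (if_then 0# else ι w) (any-lits (lits pend) ls)))
                 (switch-done t (blocks T) (expand t π S)
                   (mark-marked (out t ∷ List.map inn ch) S i) (mark-∈ (out t ∷ List.map inn ch) S (here ≡.refl))) ⟩
          ω * Z (blocks T) (expand t π S)
            ≈⟨ *-congˡ (derive T _ (B ++ ch ++ C) sound (step B (SoundRow.fresh row) pend {w} {ls} ch tiles ch∈T)) ⟩
          ω * ∏ (B ++ ch ++ C) V
            ≈⟨ *-congˡ (trans (∏-++ B (ch ++ C) V) (*-congˡ (∏-++ ch C V))) ⟩
          ω * (∏ B V * (∏ ch V * ∏ C V))
            ≈⟨ trans (x∙yz≈y∙xz _ _ _) (*-congˡ (sym (*-assoc _ _ _))) ⟩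
          ∏ B V * (ω * ∏ ch V * ∏ C V) ∎
          where ω = if any Λ ls then 0# else ι w

-- Parse trees of the homogeneous components of a circuit

module Convolution {c ℓ} (R : CommutativeRing c ℓ) where

  open CommutativeRing R hiding (zero)
  open SumLemmas R
  open Relation.Binary.Reasoning.Setoid setoid

  ∑-upTo-last : ∀ n (h : ℕ → Carrier) → ∑ (upTo (suc n)) h ≈ ∑ (upTo n) h + h n
  ∑-upTo-last n h = begin
    ∑ (upTo (suc n)) h           ≡⟨ ≡.cong (λ xs → ∑ xs h) (List.upTo-∷ʳ n) ⟨
    ∑ (upTo n List.∷ʳ n) h       ≈⟨ ∑-++ (upTo n) (n ∷ []) h ⟩
    ∑ (upTo n) h + (h n + 0#)    ≈⟨ +-congˡ (+-identityʳ _) ⟩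
    ∑ (upTo n) h + h n           ∎

  -- The right-hand side is what `value` unfolds to for a production of weight one with a single
  -- child.
  unit : ∀ x → x ≈ 1# * (x * 1#)
  unit x = sym (trans (*-identityˡ _) (*-identityʳ x))

  sum-of-two : ∀ a b → a + b ≈ 1# * (a * 1#) + (1# * (b * 1#) + 0#)
  sum-of-two a b = +-cong (unit a) (trans (unit b) (sym (+-identityʳ _)))

  -- The two extreme summands are split off because one of their factors has degree 0: it becomes
  -- the weight of a production with a single child. In the others both degrees are positive. The
  -- trailing factors `1#` reproduce the shape of `value`.
  convolution : ∀ (α β : ℕ → Carrier) e →
    ∑ (upTo (suc (suc e))) (λ a → α a * β (suc e ∸ a))
      ≈ α 0 * (β (suc e) * 1#) + (β 0 * (α (suc e) * 1#)
          + ∑ (upTo e) (λ a → 1# * (α (suc a) * (β (e ∸ a) * 1#))))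
  convolution α β e = begin
    ∑ (upTo (suc (suc e))) h
      ≡⟨ ∑-upTo-suc (suc e) h ⟩
    α 0 * β (suc e) + ∑ (upTo (suc e)) (h ∘ suc)
      ≈⟨ +-cong (*-congˡ (sym (*-identityʳ _))) (∑-upTo-last e (h ∘ suc)) ⟩
    α 0 * (β (suc e) * 1#) + (∑ (upTo e) (h ∘ suc) + α (suc e) * β (e ∸ e))
      ≈⟨ +-congˡ (+-cong (∑-cong (upTo e) λ a → sym (trans (*-identityˡ _) (*-congˡ (*-identityʳ _))))
           (trans (*-congˡ (reflexive (≡.cong β (ℕ.n∸n≡0 e)))) (*-comm _ _))) ⟩
    α 0 * (β (suc e) * 1#)
      + (∑ (upTo e) (λ a → 1# * (α (suc a) * (β (e ∸ a) * 1#))) + β 0 * α (suc e))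
      ≈⟨ +-congˡ (trans (+-comm _ _) (+-congʳ (*-congˡ (sym (*-identityʳ _))))) ⟩
    α 0 * (β (suc e) * 1#) + (β 0 * (α (suc e) * 1#)
      + ∑ (upTo e) (λ a → 1# * (α (suc a) * (β (e ∸ a) * 1#)))) ∎
    where
    h : ℕ → Carrier
    h a = α a * β (suc e ∸ a)

-- Number of a gate counted from the input side, so that it does not change
-- when the circuit is extended.
level : ∀ {k} → Fin k → ℕ
level {suc k} zero    = k
level {suc k} (suc i) = level i

level< : ∀ {k} (i : Fin k) → level i < k
level< zero    = ℕ.≤-refl
level< (suc i) = ℕ.m<n⇒m<1+n (level< i)

module ParseTrees {c ℓ} (K : Field c ℓ) (v q D : ℕ) where

  open Field K using (Carrier; 1#; -_)
  open Valiant K renaming (const to constₚ; ∑ to ∑ₚ) hiding (∏)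
  open PolynomialRing K
  open Substitution K
  open HomogeneousComponents K
  private module R = CommutativeRing (polyRing v)

  Weight : Set c
  Weight = Fin v ⊎ Carrier

  ⟦_⟧ʷ : Weight → Poly v
  ⟦_⟧ʷ = [ var , constₚ ]′

  one -one : Weight
  one  = inj₂ 1#
  -one = inj₂ (- 1#)

  open Grammar (polyRing v) ⟦_⟧ʷ public
  open Blocks one -one R.refl R.refl public

  leaf : Fin v ⊎ Fin q → Production Weight
  leaf (inj₁ i) = production (inj₁ i) [] []
  leaf (inj₂ j) = production one [ toℕ j ] []

  -- The parent has span `suc e`. For `a < e` the spans `suc a` and `e ∸ a` are both positive and
  -- add up to it.
  split : ∀ {k} → Fin k → Fin k → ℕ → ℕ → ℕ → Production Weight
  split i j o e a = production one [] ((level i , o , suc a) ∷ (level j , o ℕ.+ suc a , e ∸ a) ∷ [])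

  -- Degree 0 has no productions, since constant terms enter only through `c₀`, as weights. For a
  -- product this gives two productions with one child, one for each factor that may contribute its
  -- constant term.
  gateProductions : ∀ {k} → (Fin k → Carrier) → Gate (v ℕ.+ q) k → ℕ → ℕ → List (Production Weight)
  gateProductions c₀ g            o zero    = []
  gateProductions c₀ (input x)    o (suc zero)    = leaf (splitAt v x) ∷ []
  gateProductions c₀ (input x)    o (suc (suc e)) = []
  gateProductions c₀ (constant a) o (suc e) = []
  gateProductions c₀ (plus i j)   o (suc e) =
    production one [] [ level i , o , suc e ] ∷ production one [] [ level j , o , suc e ] ∷ []
  gateProductions c₀ (mult i j)   o (suc e) =
    production (inj₂ (c₀ i)) [] [ level j , o , suc e ] ∷
    production (inj₂ (c₀ j)) [] [ level i , o , suc e ] ∷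
    List.map (split i j o e) (upTo e)

  constantTerm : ∀ {k} → Circuit (v ℕ.+ q) k → Fin k → Carrier
  constantTerm C i = coeff 𝟘 (Vec.lookup (values C) i)

  intervals : List (ℕ × ℕ)
  intervals = cartesianProduct (upTo (suc D)) (upTo (suc D))

  Rows : Set c
  Rows = List (Node × List (Production Weight))

  gateRow : ∀ {k} → Circuit (v ℕ.+ q) k → Gate (v ℕ.+ q) k → ℕ × ℕ → Node × List (Production Weight)
  gateRow {k} C g (o , e) = (k , o , e) , gateProductions (constantTerm C) g o e

  rows : ∀ {k} → Circuit (v ℕ.+ q) k → Rows
  rows ε       = []
  rows (C ▸ g) = List.map (gateRow C g) intervals ++ rows C

  root : ℕ → Node
  root k = k , 0 , D

  -- The output need not be homogeneous, so a node one level above the last gate chooses the degree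
  -- of the tree. Degree 0 contributes the constant term and leaves no child.
  rootProductions : ∀ {k} → Circuit (v ℕ.+ q) (suc k) → List (Production Weight)
  rootProductions {k} C =
    production (inj₂ (constantTerm C zero)) [] [] ∷
    List.map (λ e → production one [] [ k , 0 , suc e ]) (upTo D)

  allRows : ∀ {k} → Circuit (v ℕ.+ q) (suc k) → Rows
  allRows {k} C = (root (suc k) , rootProductions C) ∷ rows C

  nodes : Rows → List Node
  nodes = List.map proj₁

  ∈-gateRows : ∀ {k} (C : Circuit (v ℕ.+ q) k) g is {o e} → (o , e) ∈ is →
               (k , o , e) ∈ nodes (List.map (gateRow C g) is ++ rows C)
  ∈-gateRows C g (_ ∷ is) (here ≡.refl) = here ≡.refl
  ∈-gateRows C g (_ ∷ is) (there p)     = there (∈-gateRows C g is p)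

  ∈-later : ∀ {k} (C : Circuit (v ℕ.+ q) k) g is {t} → t ∈ nodes (rows C) →
            t ∈ nodes (List.map (gateRow C g) is ++ rows C)
  ∈-later C g []       p = p
  ∈-later C g (_ ∷ is) p = there (∈-later C g is p)

  ∈-rows : ∀ {k} (C : Circuit (v ℕ.+ q) k) {l o e} → l < k → o ≤ D → e ≤ D → (l , o , e) ∈ nodes (rows C)
  ∈-rows {suc k} (C ▸ g) {l} l<k o≤D e≤D with l ℕ.≟ k
  ... | yes ≡.refl = ∈-gateRows C g intervals (∈-cartesianProduct⁺ (∈-upTo⁺ (s≤s o≤D)) (∈-upTo⁺ (s≤s e≤D)))
  ... | no  l≢k    = ∈-later C g intervals (∈-rows C (ℕ.≤∧≢⇒< (ℕ.≤-pred l<k) l≢k) o≤D e≤D)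

  ∈-gateRows⁻ : ∀ {k} (C : Circuit (v ℕ.+ q) k) g is {t} →
                t ∈ nodes (List.map (gateRow C g) is ++ rows C) →
                (proj₁ t ≡ k × proj₂ t ∈ is) ⊎ t ∈ nodes (rows C)
  ∈-gateRows⁻ C g []       p             = inj₂ p
  ∈-gateRows⁻ C g (_ ∷ is) (here ≡.refl) = inj₁ (≡.refl , here ≡.refl)
  ∈-gateRows⁻ C g (_ ∷ is) (there p) with ∈-gateRows⁻ C g is p
  ... | inj₁ (eq , p′) = inj₁ (eq , there p′)
  ... | inj₂ p′        = inj₂ p′

  rows-< : ∀ {k} (C : Circuit (v ℕ.+ q) k) {t} → t ∈ nodes (rows C) → proj₁ t < k
  rows-< (C ▸ g) p with ∈-gateRows⁻ C g intervals p
  ... | inj₁ (≡.refl , _) = ℕ.≤-refl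
  ... | inj₂ p′           = ℕ.m<n⇒m<1+n (rows-< C p′)

  Lower : ℕ → Production Weight → Set
  Lower k π = All (λ s → proj₁ s < k) (Production.children π)

  lower : ∀ {k} c₀ (g : Gate (v ℕ.+ q) k) o e → All (Lower k) (gateProductions c₀ g o e)
  lower c₀ g            o zero          = []
  lower c₀ (input x)    o (suc zero) with splitAt v x
  ... | inj₁ i = [] ∷ []
  ... | inj₂ j = [] ∷ []
  lower c₀ (input x)    o (suc (suc e)) = []
  lower c₀ (constant a) o (suc e)       = []
  lower c₀ (plus i j)   o (suc e)       = (level< i ∷ []) ∷ (level< j ∷ []) ∷ []
  lower c₀ (mult i j)   o (suc e)       = (level< j ∷ []) ∷ (level< i ∷ []) ∷
    All.map⁺ (All.universal (λ a → level< i ∷ level< j ∷ []) (upTo e))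

  Tiles : Node → Production Weight → Set
  Tiles t π = Chain (first t) (Production.children π) (last t)

  private
    whole : ∀ l o e → Chain o [ l , o , suc e ] (o ℕ.+ suc e)
    whole l o e = cons ℕ.≤-refl (s≤s z≤n) (nil ℕ.≤-refl)

  tiles : ∀ {k} l c₀ (g : Gate (v ℕ.+ q) k) o e → All (Tiles (l , o , e)) (gateProductions c₀ g o e)
  tiles l c₀ g            o zero          = []
  tiles l c₀ (input x)    o (suc zero) with splitAt v x
  ... | inj₁ i = nil (ℕ.m≤m+n o 1) ∷ []
  ... | inj₂ j = nil (ℕ.m≤m+n o 1) ∷ []
  tiles l c₀ (input x)    o (suc (suc e)) = []
  tiles l c₀ (constant a) o (suc e)       = []
  tiles l c₀ (plus i j)   o (suc e)       = whole (level i) o e ∷ whole (level j) o e ∷ []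
  tiles l c₀ (mult i j)   o (suc e)       = whole (level j) o e ∷ whole (level i) o e ∷
    All.map⁺ (All.map (λ {a} a<e → cons ℕ.≤-refl (s≤s z≤n) (cons ℕ.≤-refl (ℕ.m<n⇒0<n∸m a<e)
      (nil (ℕ.≤-reflexive (≡.trans (ℕ.+-assoc o (suc a) (e ∸ a))
        (≡.cong (o ℕ.+_) (≡.cong suc (ℕ.m+[n∸m]≡n (ℕ.<⇒≤ a<e)))))))))
      (All.all-upTo e))

  -- Beyond the last gate, the value G of the root.
  gateValue : ∀ {k} → (Fin (v ℕ.+ q) → Poly v) → Poly v → Circuit (v ℕ.+ q) k → ℕ → ℕ → Poly v
  gateValue σ G ε             l e = G
  gateValue σ G (_▸_ {k} C g) l e =
    if does (l ℕ.≟ k) then substitute σ (component e (evalGate (values C) g)) else gateValue σ G C l e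

  gateValue-level : ∀ {k} σ G (C : Circuit (v ℕ.+ q) k) i e →
                    gateValue σ G C (level i) e ≡ substitute σ (component e (Vec.lookup (values C) i))
  gateValue-level {suc k} σ G (C ▸ g) zero    e rewrite dec-true (k ℕ.≟ k) ≡.refl = ≡.refl
  gateValue-level {suc k} σ G (C ▸ g) (suc i) e
    rewrite dec-false (level i ℕ.≟ k) (ℕ.<⇒≢ (level< i)) = gateValue-level σ G C i e

  gateValue-root : ∀ {k} σ G (C : Circuit (v ℕ.+ q) k) l e → k ≤ l → gateValue σ G C l e ≡ G
  gateValue-root σ G ε             l e k≤l = ≡.refl
  gateValue-root σ G (_▸_ {k} C g) l e k<l
    rewrite dec-false (l ℕ.≟ k) (ℕ.>⇒≢ k<l) = gateValue-root σ G C l e (ℕ.<⇒≤ k<l)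

  module _ (Λ : ℕ → Bool) (σ : Fin (v ℕ.+ q) → Poly v)
           (σ-leaf : ∀ x → σ x ≋ ([ var , (λ j → if Λ (toℕ j) then [] else constₚ 1#) ]′ (splitAt v x)))
    where

    module _ (u : ℕ → ℕ → Poly v) where

      -- The value of a node ignores where its leaves start: shifting the numbers does not change
      -- what a tree computes.
      open Derivation D Λ (λ (l , _ , e) → u l e) public
      open SumLemmas (polyRing v)
      open Convolution (polyRing v)
      open Relation.Binary.Reasoning.Setoid R.setoid

      -- These are the recurrences for homogeneous components, additive at a sum and a Cauchy
      -- product at a product, after applying `σ`. The offset `o` affects only the labels of the
      -- children.
      gate-equation : ∀ {k} (C : Circuit (v ℕ.+ q) k) g →
        (∀ i e → u (level i) e ≡ substitute σ (component e (Vec.lookup (values C) i))) →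
        ∀ o e → 1 ≤ e →
        substitute σ (component e (evalGate (values C) g))
          ≋ ∑ (gateProductions (constantTerm C) g o e) value
      gate-equation C (input x) u-level o (suc zero) _ = begin
        substitute σ (component 1 (var x))   ≡⟨ ≡.cong (substitute σ) (component-var-1 x) ⟩
        substitute σ (var x)                 ≈⟨ substitute-var σ x ⟩
        σ x                                  ≈⟨ σ-leaf x ⟩
        [ var , _ ]′ (splitAt v x)           ≈⟨ leaf-value (splitAt v x) ⟩
        value (leaf (splitAt v x)) R.+ R.0#  ∎
        where
        leaf-value : ∀ y → [ var , (λ j → if Λ (toℕ j) then [] else constₚ 1#) ]′ y ≋ value (leaf y) R.+ R.0#
        leaf-value (inj₁ i) = R.sym (R.trans (R.+-identityʳ _) (R.*-identityʳ (var i)))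
        leaf-value (inj₂ j) with Λ (toℕ j)
        ... | true  = R.refl
        ... | false = R.sym (R.trans (R.+-identityʳ _) (R.*-identityʳ R.1#))
      gate-equation C (input x) u-level o (suc (suc e)) _ = R.reflexive (≡.cong (substitute σ) (component-var e x))
      gate-equation C (constant a) u-level o (suc e) _ = R.reflexive (≡.cong (substitute σ) (component-const e a))
      gate-equation C (plus i j) u-level o (suc e) _ = begin
        substitute σ (component (suc e) (f +ₚ g))
          ≡⟨ ≡.cong (substitute σ) (component-+ (suc e) f g) ⟩
        substitute σ (component (suc e) f +ₚ component (suc e) g)
          ≈⟨ substitute-+ σ (component (suc e) f) (component (suc e) g) ⟩
        substitute σ (component (suc e) f) R.+ substitute σ (component (suc e) g)
          ≡⟨ ≡.cong₂ R._+_ (u-level i (suc e)) (u-level j (suc e)) ⟨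
        u (level i) (suc e) R.+ u (level j) (suc e)
          ≈⟨ sum-of-two (u (level i) (suc e)) (u (level j) (suc e)) ⟩
        ∑ (gateProductions (constantTerm C) (plus i j) o (suc e)) value ∎
        where
        f = Vec.lookup (values C) i
        g = Vec.lookup (values C) j
      gate-equation C (mult i j) u-level o (suc e) _ = begin
        substitute σ (component (suc e) (f *ₚ g))
          ≈⟨ substitute-cong σ (component-* (suc e) f g) ⟩
        substitute σ (∑ₚ (upTo (suc (suc e))) (λ a → component a f *ₚ component (suc e ∸ a) g))
          ≈⟨ substitute-∑ σ (upTo (suc (suc e))) (λ a → component a f *ₚ component (suc e ∸ a) g) ⟩
        ∑ (upTo (suc (suc e))) (λ a → substitute σ (component a f *ₚ component (suc e ∸ a) g))
          ≈⟨ ∑-cong (upTo (suc (suc e))) (λ a → R.trans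
               (substitute-* σ (component a f) (component (suc e ∸ a) g))
               (R.reflexive (≡.sym (≡.cong₂ R._*_ (u-level i a) (u-level j (suc e ∸ a)))))) ⟩
        ∑ (upTo (suc (suc e))) (λ a → u (level i) a R.* u (level j) (suc e ∸ a))
          ≈⟨ convolution (u (level i)) (u (level j)) e ⟩
        u (level i) 0 R.* (u (level j) (suc e) R.* R.1#) R.+
        (u (level j) 0 R.* (u (level i) (suc e) R.* R.1#) R.+ ∑ (upTo e) (value ∘ split i j o e))
          ≈⟨ R.+-cong (R.*-congʳ {u (level j) (suc e) R.* R.1#} (u-0 i))
               (R.+-cong (R.*-congʳ {u (level i) (suc e) R.* R.1#} (u-0 j))
                 (R.reflexive (≡.sym (∑-map (split i j o e) (upTo e) value)))) ⟩
        ∑ (gateProductions (constantTerm C) (mult i j) o (suc e)) value ∎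
        where
        f = Vec.lookup (values C) i
        g = Vec.lookup (values C) j
        u-0 : ∀ i → u (level i) 0 ≋ constₚ (constantTerm C i)
        u-0 i = R.trans (R.reflexive (u-level i 0)) (R.trans
          (substitute-cong σ (component-0 (Vec.lookup (values C) i)))
          (substitute-const σ (constantTerm C i)))

      private
        closed : ∀ {k} {t : Node} {ps : List (Production Weight)} {later : List Node} →
                 (∀ {l o e} → l < k → o ≤ D → e ≤ D → (l , o , e) ∈ later) → Fits D t →
                 All (Lower k) ps → All (Tiles t) ps →
                 All (λ π → All (_∈ later) (Production.children π)) ps
        closed known (_ , t≤D) low tile = All.zipWith (λ (ls , c) → All.zipWith
          (λ { {_ , o , e} (l< , _ , oe≤t) → known l<
                 (ℕ.≤-trans (ℕ.m≤m+n o e) (ℕ.≤-trans oe≤t t≤D))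
                 (ℕ.≤-trans (ℕ.m≤n+m e o) (ℕ.≤-trans oe≤t t≤D)) })
          (ls , chain-fits c)) (low , tile)

        irreflexive : ∀ {k o e} {ps : List (Production Weight)} → All (Lower k) ps →
                      All (λ π → (k , o , e) ∉ Production.children π) ps
        irreflexive = All.map λ low t∈ → ℕ.<-irrefl ≡.refl (All.lookup low t∈)

      sound-gate : ∀ {k} (C : Circuit (v ℕ.+ q) k) g →
        (∀ i e → u (level i) e ≡ substitute σ (component e (Vec.lookup (values C) i))) →
        (∀ e → u k e ≡ substitute σ (component e (evalGate (values C) g))) →
        Sound (rows C) → ∀ is → Unique is → Sound (List.map (gateRow C g) is ++ rows C)
      sound-gate C g u-level u-k sound []             _            = sound
      sound-gate {k} C g u-level u-k sound ((o , e) ∷ is) (is∌ ∷ uniq) = record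
        -- Nodes of the same gate differ in their intervals, each listed once; the remaining rows
        -- have a smaller level.
        { fresh       = λ p → [ (λ (_ , p′) → All.lookup is∌ p′ ≡.refl)
                              , (λ p′ → ℕ.<-irrefl ≡.refl (rows-< C p′)) ]′ (∈-gateRows⁻ C g is p)
        ; irreflexive = irreflexive low
        ; tiling      = λ _ → tile
        ; closed      = λ fits → closed {t = k , o , e} (λ l<k o≤D e≤D → ∈-later C g is (∈-rows C l<k o≤D e≤D)) fits low tile
        ; equation    = λ (1≤e , _) → R.trans (R.reflexive (u-k e)) (gate-equation C g u-level o e 1≤e)
        } ∷ sound-gate C g u-level u-k sound is uniq
        where
        low  = lower (constantTerm C) g o e
        tile = tiles k (constantTerm C) g o e

      sound-rows : ∀ {k} (C : Circuit (v ℕ.+ q) k) →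
        (∀ i e → u (level i) e ≡ substitute σ (component e (Vec.lookup (values C) i))) →
        Sound (rows C)
      sound-rows ε       u-level = []
      sound-rows (C ▸ g) u-level =
        sound-gate C g (u-level ∘ suc) (u-level zero) (sound-rows C (u-level ∘ suc)) intervals
          (Unique.cartesianProduct⁺ (Unique.upTo⁺ (suc D)) (Unique.upTo⁺ (suc D)))

      sound-allRows : ∀ {k} (C : Circuit (v ℕ.+ q) (suc k)) →
        (∀ i e → u (level i) e ≡ substitute σ (component e (Vec.lookup (values C) i))) →
        (∀ e → u (suc k) e ≡ substitute σ (output C)) →
        DegreeAtMost D (output C) → Sound (allRows C)
      sound-allRows {k} C u-level u-root deg = record
        { fresh       = λ p → ℕ.<-irrefl ≡.refl (rows-< C p)
        ; irreflexive = irreflexive low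
        ; tiling      = λ _ → tile
        ; closed      = λ fits → closed {t = root (suc k)} (∈-rows C) fits low tile
        ; equation    = λ _ → equation
        } ∷ sound-rows C u-level
        where
        low : All (Lower (suc k)) (rootProductions C)
        low = [] ∷ All.map⁺ (All.universal (λ _ → ℕ.≤-refl ∷ []) (upTo D))
        tile : All (Tiles (root (suc k))) (rootProductions C)
        tile = nil z≤n ∷ All.map⁺ (All.map (λ e<D → cons z≤n (s≤s z≤n) (nil e<D)) (All.all-upTo D))
        lookup-zero : Vec.lookup (values C) zero ≡ output C
        lookup-zero with values C
        ... | _ ∷ _ = ≡.refl
        f = output C
        level-zero : ∀ e → u k e ≡ substitute σ (component e f)
        level-zero e = ≡.trans (u-level zero e) (≡.cong (substitute σ ∘ component e) lookup-zero)
        equation : u (suc k) D ≋ ∑ (rootProductions C) value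
        equation = begin
          u (suc k) D
            ≡⟨ u-root D ⟩
          substitute σ f
            ≈⟨ substitute-cong σ (decompose D f deg) ⟩
          substitute σ (∑ₚ (upTo (suc D)) λ e → component e f)
            ≈⟨ substitute-∑ σ (upTo (suc D)) (λ e → component e f) ⟩
          ∑ (upTo (suc D)) (λ e → substitute σ (component e f))
            ≡⟨ ∑-upTo-suc D (λ e → substitute σ (component e f)) ⟩
          substitute σ (component 0 f) R.+ ∑ (upTo D) (λ e → substitute σ (component (suc e) f))
            ≈⟨ R.+-cong
                 (R.trans (substitute-cong σ (component-0 f)) (R.trans (substitute-const σ (coeff 𝟘 f))
                   (R.trans (R.reflexive (≡.cong (constₚ ∘ coeff 𝟘) (≡.sym lookup-zero)))
                     (R.sym (R.*-identityʳ (constₚ (constantTerm C zero)))))))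
                 (∑-cong (upTo D) (λ e → R.trans (R.reflexive (≡.sym (level-zero (suc e))))
                   (unit (u k (suc e))))) ⟩
          constₚ (constantTerm C zero) R.* R.1# R.+ ∑ (upTo D) (λ e → R.1# R.* (u k (suc e) R.* R.1#))
            ≡⟨ ≡.cong (constₚ (constantTerm C zero) R.* R.1# R.+_)
                 (∑-map (λ e → production one [] [ k , 0 , suc e ]) (upTo D) value) ⟨
          ∑ (rootProductions C) value ∎

    -- The derivation starts with the root as the whole frontier; `1 ≤ D` gives it a positive span,
    -- as a chain demands.
    derive-circuit : ∀ {k} (C : Circuit (v ℕ.+ q) (suc k)) → 1 ≤ D → DegreeAtMost D (output C) →
      ∀ S → (∀ t → S (inn t) ≡ does (t ≟ₙ root (suc k))) → (∀ t → S (out t) ≡ false) → (∀ l → S (lit l) ≡ Λ l) →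
      Z (blocks (allRows C)) S ≋ substitute σ (output C)
    derive-circuit {k} C 1≤D deg S S-inn S-out S-lit = begin
      Z (blocks (allRows C)) S
        ≈⟨ derive u (allRows C) S [ root (suc k) ] (sound-allRows u C (gateValue-level σ G C) u-root deg) (record
             { chain = cons z≤n 1≤D (nil ℕ.≤-refl)
             ; known = here ≡.refl ∷ []
             ; inns  = λ {t} _ → ≡.trans (S-inn t) (≡.sym (Bool.∨-identityʳ _))
             ; outs  = λ {t} _ → S-out t
             ; lits  = S-lit
             }) ⟩
      u (suc k) D R.* R.1#
        ≈⟨ R.*-identityʳ (u (suc k) D) ⟩
      u (suc k) D
        ≡⟨ u-root D ⟩
      substitute σ (output C) ∎
      where
      open Relation.Binary.Reasoning.Setoid R.setoid
      G = substitute σ (output C)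
      u = gateValue σ G C
      u-root : ∀ e → u (suc k) e ≡ G
      u-root e = gateValue-root σ G C (suc k) e ℕ.≤-refl

-- The boolean sum and the number of conflict vertices

module BooleanSum {c ℓ} (K : Field c ℓ) (v q D : ℕ) where

  open Field K using (1#)
  open Valiant K renaming (const to constₚ) hiding (∑; ∏)
  open PolynomialRing K
  open ParseTrees K v q D
  private module R = CommutativeRing (polyRing v)
  open SumLemmas (polyRing v)

  -- Choosing the vertex of the k-th boolean variable sets it to 0: that blocks
  -- the leaves labelled by it.
  literalVertices : ℕ → ℕ → List (Vertex Weight)
  literalVertices s zero    = []
  literalVertices s (suc n) = vertex one [] [ lit s ] ∷ literalVertices (suc s) n

  assign : ∀ {n} → ℕ → Vec Bool n → Marking → Marking
  assign s []      S = S
  assign s (b ∷ x) S = assign (suc s) x (if b then S else mark [ lit s ] S)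

  Z-literals : ∀ n s L S → Z (literalVertices s n ++ L) S ≋ ∑ (cube n) (λ x → Z L (assign s x S))
  Z-literals zero    s L S = R.sym (R.+-identityʳ _)
  Z-literals (suc n) s L S = begin
    Z rest S R.+ R.1# R.* Z rest S′
      ≈⟨ R.+-cong (Z-literals n (suc s) L S)
           (R.trans (R.*-identityˡ (Z rest S′)) (Z-literals n (suc s) L S′)) ⟩
    ∑ (cube n) (λ x → Z L (assign s (true ∷ x) S)) R.+ ∑ (cube n) (λ x → Z L (assign s (false ∷ x) S))
      -- `Z` puts the unchosen vertex first, which means the value true, whereas `cube` starts with
      -- false.
      ≈⟨ R.+-comm (∑ (cube n) (λ x → Z L (assign s (true ∷ x) S)))
                  (∑ (cube n) (λ x → Z L (assign s (false ∷ x) S))) ⟩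
    ∑ (cube n) (λ x → Z L (assign s (false ∷ x) S)) R.+ ∑ (cube n) (λ x → Z L (assign s (true ∷ x) S))
      ≈⟨ ∑-cube-suc n (λ x → Z L (assign s x S)) ⟨
    ∑ (cube (suc n)) (λ x → Z L (assign s x S)) ∎
    where
    open Relation.Binary.Reasoning.Setoid R.setoid
    rest = literalVertices (suc s) n ++ L
    S′   = mark [ lit s ] S

  assign-other : ∀ {n} s (x : Vec Bool n) S p → (∀ l → p ≡ lit l → l < s) → assign s x S p ≡ S p
  assign-other s []          S p other = ≡.refl
  assign-other s (true  ∷ x) S p other = assign-other (suc s) x S p λ l eq → ℕ.m<n⇒m<1+n (other l eq)
  assign-other s (false ∷ x) S p other = ≡.trans
    (assign-other (suc s) x _ p λ l eq → ℕ.m<n⇒m<1+n (other l eq))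
    (mark-∉ [ lit s ] S λ { (here eq) → ℕ.<-irrefl ≡.refl (other s eq) })

  assign-lit : ∀ {n} s (x : Vec Bool n) S → (∀ l → s ≤ l → S (lit l) ≡ false) →
               ∀ j → assign s x S (lit (s ℕ.+ toℕ j)) ≡ not (Vec.lookup x j)
  assign-lit s (b ∷ x) S unset zero rewrite ℕ.+-identityʳ s = ≡.trans
    (assign-other (suc s) x _ (lit s) λ { l ≡.refl → ℕ.≤-refl }) (here-value b)
    where
    here-value : ∀ b → (if b then S else mark [ lit s ] S) (lit s) ≡ not b
    here-value true  = unset s ℕ.≤-refl
    here-value false = mark-∈ [ lit s ] S (here ≡.refl)
  assign-lit s (b ∷ x) S unset (suc j) rewrite ℕ.+-suc s (toℕ j) = assign-lit (suc s) x _ (unset′ b) j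
    where
    unset′ : ∀ b l → s < l → (if b then S else mark [ lit s ] S) (lit l) ≡ false
    unset′ true  l s<l = unset l (ℕ.<⇒≤ s<l)
    unset′ false l s<l = ≡.trans
      (mark-∉ [ lit s ] S λ { (here eq) → ℕ.<-irrefl (≡.sym (lit-injective eq)) s<l })
      (unset l (ℕ.<⇒≤ s<l))

  rootMarking : ℕ → Marking
  rootMarking k = mark [ inn (root k) ] (λ _ → false)

  conflictList : ∀ {k} → Circuit (v ℕ.+ q) (suc k) → List (Vertex Weight)
  conflictList C = literalVertices 0 q ++ blocks (allRows C)

  instantiate : Vec Bool q → Fin (v ℕ.+ q) → Poly v
  instantiate x = Vec.lookup (Vec.map var (Vec.allFin v) Vec.++ Vec.map (constₚ ∘ fromBool) x)

  -- After the literal vertices, exactly the literals of the variables set to 0 are marked. Their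
  -- leaves are blocked and those of the other variables keep weight one, so what remains is the
  -- output evaluated at that boolean point.
  Z-booleanSum : ∀ {k} (C : Circuit (v ℕ.+ q) (suc k)) → 1 ≤ D → DegreeAtMost D (output C) →
                 Z (conflictList C) (rootMarking (suc k)) ≋ booleanSum q (output C)
  Z-booleanSum {k} C 1≤D deg = R.trans
    (Z-literals q 0 (blocks (allRows C)) (rootMarking (suc k)))
    (∑-cong (cube q) λ x → derive-circuit (λ l → S x (lit l)) (instantiate x) (leaves x) C 1≤D deg
      (S x)
      (λ t → ≡.trans (assign-other 0 x S₀ (inn t) λ _ ()) (root-inn t))
      (λ t → ≡.trans (assign-other 0 x S₀ (out t) λ _ ())
        (mark-∉ {out t} [ inn (root (suc k)) ] (λ _ → false) λ { (here ()) }))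
      (λ l → ≡.refl))
    where
    S₀ = rootMarking (suc k)
    S : Vec Bool q → Marking
    S x = assign 0 x S₀
    root-inn : ∀ t → S₀ (inn t) ≡ does (t ≟ₙ root (suc k))
    root-inn t = ≡.trans (Bool.∨-identityʳ _) (Bool.∨-identityʳ _)
    leaves : ∀ x y → instantiate x y ≋
      ([ var , (λ j → if S x (lit (toℕ j)) then [] else constₚ 1#) ]′ (splitAt v y))
    leaves x y = R.trans (R.reflexive (Vec.lookup-splitAt v (Vec.map var (Vec.allFin v)) _ y)) (cases (splitAt v y))
      where
      zero-or-one : ∀ b → constₚ (fromBool b) ≋ (if not b then [] else constₚ 1#)
      zero-or-one true  = R.refl
      zero-or-one false = const-0
      cases : ∀ y → [ Vec.lookup (Vec.map var (Vec.allFin v)) , Vec.lookup (Vec.map (constₚ ∘ fromBool) x) ]′ y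
                    ≋ ([ var , (λ j → if S x (lit (toℕ j)) then [] else constₚ 1#) ]′ y)
      cases (inj₁ i) = R.reflexive (≡.trans (Vec.lookup-map i var (Vec.allFin v)) (≡.cong var (Vec.lookup-allFin i)))
      cases (inj₂ j) = R.trans (R.reflexive (Vec.lookup-map j (constₚ ∘ fromBool) x))
        (R.trans (zero-or-one (Vec.lookup x j)) (R.reflexive (≡.cong (if_then [] else constₚ 1#)
          (≡.sym (assign-lit 0 x S₀ (λ l _ →
            mark-∉ {lit l} [ inn (root (suc k)) ] (λ _ → false) λ { (here ()) }) j)))))

  private
    length-gateProductions : ∀ {k} c₀ (g : Gate (v ℕ.+ q) k) o e → length (gateProductions c₀ g o e) ≤ suc e
    length-gateProductions c₀ g            o zero          = z≤n
    length-gateProductions c₀ (input x)    o (suc zero)    = s≤s z≤n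
    length-gateProductions c₀ (input x)    o (suc (suc e)) = z≤n
    length-gateProductions c₀ (constant a) o (suc e)       = z≤n
    length-gateProductions c₀ (plus i j)   o (suc e)       = s≤s (s≤s z≤n)
    length-gateProductions c₀ (mult i j)   o (suc e)       =
      s≤s (s≤s (ℕ.≤-reflexive (≡.trans (List.length-map (split i j o e) (upTo e)) (List.length-upTo e))))

    length-block : ∀ t ps T b → length ps ≤ b →
                   length (blocks ((t , ps) ∷ T)) ≤ b ℕ.+ 3 ℕ.+ length (blocks T)
    length-block t ps T b ps≤b = begin
      length (List.map (productionVertex t) ps ++ switch t (blocks T))
        ≡⟨ List.length-++ (List.map (productionVertex t) ps) ⟩
      length (List.map (productionVertex t) ps) ℕ.+ (3 ℕ.+ length (blocks T))
        ≡⟨ ≡.cong (ℕ._+ (3 ℕ.+ length (blocks T))) (List.length-map (productionVertex t) ps) ⟩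
      length ps ℕ.+ (3 ℕ.+ length (blocks T))
        ≤⟨ ℕ.+-monoˡ-≤ _ ps≤b ⟩
      b ℕ.+ (3 ℕ.+ length (blocks T))
        ≡⟨ ℕ.+-assoc b 3 _ ⟨
      b ℕ.+ 3 ℕ.+ length (blocks T) ∎
      where open ℕ.≤-Reasoning

    length-gateRows : ∀ {k} (C : Circuit (v ℕ.+ q) k) g is → All (λ (_ , e) → e ≤ D) is →
      length (blocks (List.map (gateRow C g) is ++ rows C)) ≤ length is ℕ.* (suc D ℕ.+ 3) ℕ.+ length (blocks (rows C))
    length-gateRows C g []             []          = ℕ.≤-refl
    length-gateRows {k} C g ((o , e) ∷ is) (e≤D ∷ bnd) = begin
      length (blocks (List.map (gateRow C g) ((o , e) ∷ is) ++ rows C))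
        ≤⟨ length-block (k , o , e) (gateProductions (constantTerm C) g o e) (List.map (gateRow C g) is ++ rows C) (suc D)
             (ℕ.≤-trans (length-gateProductions (constantTerm C) g o e) (s≤s e≤D)) ⟩
      suc D ℕ.+ 3 ℕ.+ length (blocks (List.map (gateRow C g) is ++ rows C))
        ≤⟨ ℕ.+-monoʳ-≤ (suc D ℕ.+ 3) (length-gateRows C g is bnd) ⟩
      suc D ℕ.+ 3 ℕ.+ (length is ℕ.* (suc D ℕ.+ 3) ℕ.+ length (blocks (rows C)))
        ≡⟨ ℕ.+-assoc (suc D ℕ.+ 3) (length is ℕ.* (suc D ℕ.+ 3)) _ ⟨
      suc (length is) ℕ.* (suc D ℕ.+ 3) ℕ.+ length (blocks (rows C)) ∎
      where open ℕ.≤-Reasoning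

    intervals-bounded : All (λ (_ , e) → e ≤ D) intervals
    intervals-bounded = All.cartesianProduct⁺ (≡.setoid ℕ) (≡.setoid ℕ) (upTo (suc D)) (upTo (suc D))
      λ _ e∈ → ℕ.≤-pred (∈-upTo⁻ e∈)

    length-intervals : length intervals ≡ suc D ℕ.* suc D
    length-intervals = ≡.trans (length-cartesianProduct (upTo (suc D)) (upTo (suc D)))
      (≡.cong₂ ℕ._*_ (List.length-upTo (suc D)) (List.length-upTo (suc D)))

    length-rows : ∀ {k} (C : Circuit (v ℕ.+ q) k) →
                  length (blocks (rows C)) ≤ k ℕ.* (suc D ℕ.* suc D ℕ.* (suc D ℕ.+ 3))
    length-rows ε               = z≤n
    length-rows (_▸_ {k} C g) = begin
      length (blocks (List.map (gateRow C g) intervals ++ rows C))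
        ≤⟨ length-gateRows C g intervals intervals-bounded ⟩
      length intervals ℕ.* (suc D ℕ.+ 3) ℕ.+ length (blocks (rows C))
        ≤⟨ ℕ.+-mono-≤ (ℕ.≤-reflexive (≡.cong (ℕ._* (suc D ℕ.+ 3)) length-intervals)) (length-rows C) ⟩
      suc k ℕ.* (suc D ℕ.* suc D ℕ.* (suc D ℕ.+ 3)) ∎
      where open ℕ.≤-Reasoning

    length-literals : ∀ s n → length (literalVertices s n) ≡ n
    length-literals s zero    = ≡.refl
    length-literals s (suc n) = ≡.cong suc (length-literals (suc s) n)

  -- There are `q` literal vertices, the block of the root, and for each gate `suc D * suc D`
  -- blocks; a block has at most `suc D` productions and the 3 vertices of its switch.
  length-conflictList : ∀ {k} (C : Circuit (v ℕ.+ q) (suc k)) →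
    length (conflictList C) ≤ q ℕ.+ (suc D ℕ.+ 3 ℕ.+ suc k ℕ.* (suc D ℕ.* suc D ℕ.* (suc D ℕ.+ 3)))
  length-conflictList {k} C = begin
    length (literalVertices 0 q ++ blocks (allRows C))
      ≡⟨ List.length-++ (literalVertices 0 q) ⟩
    length (literalVertices 0 q) ℕ.+ length (blocks (allRows C))
      ≤⟨ ℕ.+-mono-≤ (ℕ.≤-reflexive (length-literals 0 q)) (ℕ.≤-trans
           (length-block (root (suc k)) (rootProductions C) (rows C) (suc D)
             (s≤s (ℕ.≤-reflexive (≡.trans
               (List.length-map (λ e → production one [] [ k , 0 , suc e ]) (upTo D)) (List.length-upTo D)))))
           (ℕ.+-monoʳ-≤ (suc D ℕ.+ 3) (length-rows C))) ⟩
    q ℕ.+ (suc D ℕ.+ 3 ℕ.+ suc k ℕ.* (suc D ℕ.* suc D ℕ.* (suc D ℕ.+ 3))) ∎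
    where open ℕ.≤-Reasoning

-- The independence polynomial as a sum over subsets

module Expansion {r ℓ w} (R : CommutativeRing r ℓ) {W : Set w} (ι : W → CommutativeRing.Carrier R) where

  open CommutativeRing R hiding (zero)
  open SumLemmas R
  open Grammar R ι using (Z)
  open Relation.Binary.Reasoning.Setoid setoid

  conflict : Vertex W → Vertex W → Bool
  conflict v u = any (λ p → does (p ∈ₚ? covers v)) (checks u)

  -- Strictly upper triangular: only an earlier vertex can mark what a later one checks, and every
  -- conflict is recorded once.
  conflicts : ∀ (L : List (Vertex W)) → Fin (length L) → Fin (length L) → Bool
  conflicts (v ∷ L) zero    zero    = false
  conflicts (v ∷ L) zero    (suc j) = conflict v (List.lookup L j)
  conflicts (v ∷ L) (suc i) zero    = false
  conflicts (v ∷ L) (suc i) (suc j) = conflicts L i j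

  unmarkedWeight : Marking → Vertex W → Carrier
  unmarkedWeight S u = if any S (checks u) then 0# else ι (weight u)

  vertexFactor : ∀ L → Marking → Vec Bool (length L) → Carrier
  vertexFactor L S x = ∏ (allFin (length L)) λ h →
    if Vec.lookup x h then unmarkedWeight S (List.lookup L h) else 1#

  pairFactor : ∀ L → Vec Bool (length L) → Carrier
  pairFactor L x = ∏ (allFin (length L)) λ i → ∏ (allFin (length L)) λ j →
    if conflicts L i j ∧ (Vec.lookup x i ∧ Vec.lookup x j) then 0# else 1#

  private
    firstRow : ∀ v L → Bool → Vec Bool (length L) → Carrier
    firstRow v L b x = ∏ (allFin (length L)) λ j →
      if conflict v (List.lookup L j) ∧ (b ∧ Vec.lookup x j) then 0# else 1#

    pairFactor-∷ : ∀ v L b x → pairFactor (v ∷ L) (b ∷ x) ≈ firstRow v L b x * pairFactor L x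
    pairFactor-∷ v L b x = begin
      pairFactor (v ∷ L) (b ∷ x)
        ≡⟨ ∏-allFin-suc n (λ i → ∏ (allFin (suc n)) (f i)) ⟩
      ∏ (allFin (suc n)) (f zero) * ∏ (allFin n) (λ i → ∏ (allFin (suc n)) (f (suc i)))
        ≈⟨ *-cong (drop zero) (∏-cong (allFin n) λ i → drop (suc i)) ⟩
      firstRow v L b x * pairFactor L x ∎
      where
      n = length L
      f : Fin (suc n) → Fin (suc n) → Carrier
      f i j = if conflicts (v ∷ L) i j ∧ (Vec.lookup (b ∷ x) i ∧ Vec.lookup (b ∷ x) j) then 0# else 1#
      f-zero : ∀ i → f i zero ≡ 1#
      f-zero zero    = ≡.refl
      f-zero (suc i) = ≡.refl
      drop : ∀ i → ∏ (allFin (suc n)) (f i) ≈ ∏ (allFin n) (f i ∘ suc)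
      drop i = trans (reflexive (∏-allFin-suc n (f i)))
        (trans (*-congʳ (reflexive (f-zero i))) (*-identityˡ _))

    any-∨ : ∀ (A B : Point → Bool) ps → any (λ p → A p ∨ B p) ps ≡ any A ps ∨ any B ps
    any-∨ A B []       = ≡.refl
    any-∨ A B (p ∷ ps) rewrite any-∨ A B ps with A p | B p | any A ps
    ... | true  | _     | _     = ≡.refl
    ... | false | true  | true  = ≡.refl
    ... | false | true  | false = ≡.refl
    ... | false | false | _     = ≡.refl

    -- A later vertex is blocked by the enlarged marking iff it was blocked already or conflicts
    -- with `v`. The second alternative is what the pair factors of `v` express.
    absorb : ∀ v L S x → vertexFactor L S x * firstRow v L true x ≈ vertexFactor L (mark (covers v) S) x
    absorb v L S x = trans (sym (∏-* (allFin (length L)) _ _))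
      (∏-cong (allFin (length L)) λ h → pointwise (List.lookup L h) (Vec.lookup x h))
      where
      pointwise : ∀ u b → (if b then unmarkedWeight S u else 1#) * (if conflict v u ∧ b then 0# else 1#)
                        ≈ (if b then unmarkedWeight (mark (covers v) S) u else 1#)
      pointwise u false rewrite Bool.∧-zeroʳ (conflict v u) = *-identityˡ 1#
      pointwise u true
        rewrite any-∨ (λ p → does (p ∈ₚ? covers v)) S (checks u) | Bool.∧-identityʳ (conflict v u)
        with conflict v u
      ... | true  = zeroʳ _
      ... | false = *-identityʳ _

    firstRow-false : ∀ v L x → firstRow v L false x ≈ 1#
    firstRow-false v L x = trans
      (∏-cong (allFin (length L)) λ j →
        reflexive (≡.cong (if_then 0# else 1#) (Bool.∧-zeroʳ (conflict v (List.lookup L j)))))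
      (∏-1 (allFin (length L)))

  -- The recursion of `Z` accumulates marks; here their effect is resolved into independent factors
  -- for single vertices and for pairs, the form in which pair gadgets can simulate it.
  Z-expansion : ∀ L S → Z L S ≈ ∑ (cube (length L)) (λ x → vertexFactor L S x * pairFactor L x)
  Z-expansion []      S = sym (trans (+-identityʳ _) (*-identityʳ 1#))
  Z-expansion (v ∷ L) S = begin
    Z L S + (if any S (checks v) then 0# else ι (weight v) * Z L S′)
      ≈⟨ +-cong (Z-expansion L S) (choose (any S (checks v))) ⟩
    ∑ (cube n) (term L S) + w₀ * Z L S′
      ≈⟨ +-congˡ (trans (*-congˡ (Z-expansion L S′)) (*-distribˡ-∑ w₀ (cube n) (term L S′))) ⟩
    ∑ (cube n) (term L S) + ∑ (cube n) (λ x → w₀ * term L S′ x)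
      ≈⟨ +-cong (∑-cong (cube n) λ x → sym (skip x)) (∑-cong (cube n) λ x → sym (take x)) ⟩
    ∑ (cube n) (term (v ∷ L) S ∘ (false ∷_)) + ∑ (cube n) (term (v ∷ L) S ∘ (true ∷_))
      ≈⟨ ∑-cube-suc n (term (v ∷ L) S) ⟨
    ∑ (cube (suc n)) (term (v ∷ L) S) ∎
    where
    n  = length L
    S′ = mark (covers v) S
    w₀ = unmarkedWeight S v
    term : ∀ L → Marking → Vec Bool (length L) → Carrier
    term L S x = vertexFactor L S x * pairFactor L x
    choose : ∀ b → (if b then 0# else ι (weight v) * Z L S′) ≈ (if b then 0# else ι (weight v)) * Z L S′
    choose true  = sym (zeroˡ _)
    choose false = refl
    skip : ∀ x → term (v ∷ L) S (false ∷ x) ≈ term L S x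
    skip x = *-cong
      (trans (reflexive (∏-allFin-suc n _)) (*-identityˡ _))
      (trans (pairFactor-∷ v L false x) (trans (*-congʳ (firstRow-false v L x)) (*-identityˡ _)))
    take : ∀ x → term (v ∷ L) S (true ∷ x) ≈ w₀ * term L S′ x
    take x = begin
      term (v ∷ L) S (true ∷ x)
        ≈⟨ *-cong (reflexive (∏-allFin-suc n _)) (pairFactor-∷ v L true x) ⟩
      w₀ * vertexFactor L S x * (firstRow v L true x * pairFactor L x)
        ≈⟨ trans (*-assoc _ _ _) (*-congˡ (sym (*-assoc _ _ _))) ⟩
      w₀ * (vertexFactor L S x * firstRow v L true x * pairFactor L x)
        ≈⟨ *-congˡ (*-congʳ (absorb v L S x)) ⟩
      w₀ * term L S′ x ∎

-- The gadget of a pair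

-- The covering condition for the edges from `b` to the two ends of the pair and to `y`, and from
-- `b′` to `y`, with `x` the conjunction of the two ends.
covered : Bool → Bool → Bool → Bool → Bool
covered x y b b′ = (b ∨ (y ∧ x)) ∧ (b′ ∨ y)

module Gadget {r ℓ} (R : CommutativeRing r ℓ) where

  open CommutativeRing R hiding (zero)
  open SumLemmas R
  open Algebra.Properties.Ring ring using (-0#≈0#; -1*x≈-x; -‿involutive)
  open Relation.Binary.Reasoning.Setoid setoid

  indicator : Bool → Carrier
  indicator b = if b then 1# else 0#

  pow : Carrier → Bool → Carrier
  pow w b = if b then w else 1#

  restrict : ∀ b x → (if b then x else 0#) ≈ indicator b * x
  restrict true  x = sym (*-identityˡ x)
  restrict false x = sym (zeroˡ x)

  ∏-indicator : ∀ {a} {A : Set a} (f : A → Bool) xs → ∏ xs (indicator ∘ f) ≈ indicator (all f xs)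
  ∏-indicator f []       = refl
  ∏-indicator f (x ∷ xs) with f x
  ... | true  = trans (*-identityˡ _) (∏-indicator f xs)
  ... | false = zeroˡ _

  gadget : (w y y′ : Carrier) → Bool → Bool → Bool → Bool → Carrier
  gadget w y y′ x z b b′ = indicator (covered x z b b′) * (pow w z * (pow y b * pow y′ b′))

  -- Equal to y y′ + w (1 + y′) (y + x), where x tells whether the cover
  -- contains both endpoints of the pair. The weights (−1, −1, 0) forbid this,
  -- and the weights (0, 1, 1) disable the pair.
  gadgetSum : (w y y′ : Carrier) → Bool → Carrier
  gadgetSum w y y′ x =
    ((g false false false + g false false true) + (g false true false + g false true true)) +
    ((g true false false + g true false true) + (g true true false + g true true true))
    where g = gadget w y y′ x

  private
    evaluate : ∀ w y y′ x → gadgetSum w y y′ x ≈ y * y′ + w * ((indicator x + y) * (1# + y′))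
    evaluate w y y′ x = +-cong
      (begin
        (0# * (1# * (1# * 1#)) + 0# * (1# * (1# * y′))) + (0# * (1# * (y * 1#)) + 1# * (1# * (y * y′)))
          ≈⟨ +-cong (+-cong (zeroˡ _) (zeroˡ _))
               (+-cong (zeroˡ _) (trans (*-identityˡ _) (*-identityˡ _))) ⟩
        (0# + 0#) + (0# + y * y′)
          ≈⟨ trans (+-congʳ (+-identityˡ 0#)) (trans (+-identityˡ _) (+-identityˡ _)) ⟩
        y * y′ ∎)
      (begin
        (gadget w y y′ x true false false + gadget w y y′ x true false true) +
        (gadget w y y′ x true true false + gadget w y y′ x true true true)
          ≈⟨ +-cong (+-cong (low x 1#) (low x y′)) (+-cong (high 1#) (high y′)) ⟩
        (w * (indicator x * 1#) + w * (indicator x * y′)) + (w * (y * 1#) + w * (y * y′))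
          ≈⟨ +-cong (collect (indicator x)) (collect y) ⟩
        w * (indicator x * (1# + y′)) + w * (y * (1# + y′))
          ≈⟨ trans (sym (distribˡ w _ _)) (*-congˡ (sym (distribʳ (1# + y′) _ _))) ⟩
        w * ((indicator x + y) * (1# + y′)) ∎)
      where
      low : ∀ x a → indicator (x ∧ true) * (w * (1# * a)) ≈ w * (indicator x * a)
      low true  a = *-identityˡ _
      low false a = trans (zeroˡ _) (sym (trans (*-congˡ (zeroˡ _)) (zeroʳ _)))
      high : ∀ a → 1# * (w * (y * a)) ≈ w * (y * a)
      high a = *-identityˡ _
      collect : ∀ c → w * (c * 1#) + w * (c * y′) ≈ w * (c * (1# + y′))
      collect c = trans (sym (distribˡ w _ _)) (*-congˡ (sym (distribˡ c _ _)))

  -- Weight 0 keeps the second neighbour `b′` out of the cover and thereby forces the middle vertex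
  -- in. What remains is `w (x + y)`, which is `1 − x` for `w = y = −1`.
  gadget-on : ∀ {w y y′} → w ≈ - 1# → y ≈ - 1# → y′ ≈ 0# → ∀ x →
              gadgetSum w y y′ x ≈ (if x then 0# else 1#)
  gadget-on {w} {y} {y′} w≈-1 y≈-1 y′≈0 x = begin
    gadgetSum w y y′ x
      ≈⟨ evaluate w y y′ x ⟩
    y * y′ + w * ((indicator x + y) * (1# + y′))
      ≈⟨ +-cong (trans (*-congˡ y′≈0) (zeroʳ y)) (*-cong w≈-1 (*-cong (+-congˡ y≈-1)
           (trans (+-congˡ y′≈0) (+-identityʳ 1#)))) ⟩
    0# + - 1# * ((indicator x + - 1#) * 1#)
      ≈⟨ trans (+-identityˡ _) (trans (*-congˡ (*-identityʳ _)) (-1*x≈-x _)) ⟩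
    - (indicator x + - 1#)
      ≈⟨ finish x ⟩
    (if x then 0# else 1#) ∎
    where
    finish : ∀ x → - (indicator x + - 1#) ≈ (if x then 0# else 1#)
    finish true  = trans (-‿cong (-‿inverseʳ 1#)) -0#≈0#
    finish false = trans (-‿cong (+-identityˡ _)) (-‿involutive 1#)

  -- Weight 0 keeps the middle vertex out, so both of its neighbours are forced in, with weight 1
  -- each.
  gadget-off : ∀ {w y y′} → w ≈ 0# → y ≈ 1# → y′ ≈ 1# → ∀ x → gadgetSum w y y′ x ≈ 1#
  gadget-off {w} {y} {y′} w≈0 y≈1 y′≈1 x = begin
    gadgetSum w y y′ x                            ≈⟨ evaluate w y y′ x ⟩
    y * y′ + w * ((indicator x + y) * (1# + y′))  ≈⟨ +-cong (*-cong y≈1 y′≈1) (trans (*-congʳ w≈0) (zeroˡ _)) ⟩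
    1# * 1# + 0#                                  ≈⟨ trans (+-identityʳ _) (*-identityʳ 1#) ⟩
    1#                                            ∎

  ∑-gadgets : ∀ m (w y y′ : Fin m → Carrier) (x : Fin m → Bool) →
    ∑ (cube m) (λ z → ∑ (cube m) λ b → ∑ (cube m) λ b′ →
      indicator (all (λ p → covered (x p) (Vec.lookup z p) (Vec.lookup b p) (Vec.lookup b′ p)) (allFin m)) *
      (∏ (allFin m) (λ p → pow (w p) (Vec.lookup z p)) *
       (∏ (allFin m) (λ p → pow (y p) (Vec.lookup b p)) * ∏ (allFin m) (λ p → pow (y′ p) (Vec.lookup b′ p)))))
      ≈ ∏ (allFin m) (λ p → gadgetSum (w p) (y p) (y′ p) (x p))
  ∑-gadgets m w y y′ x = begin
    ∑ (cube m) (λ z → ∑ (cube m) λ b → ∑ (cube m) λ b′ → _)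
      ≈⟨ ∑-cong (cube m) (λ z → ∑-cong (cube m) λ b → ∑-cong (cube m) λ b′ → merge z b b′) ⟩
    ∑ (cube m) (λ z → ∑ (cube m) λ b → ∑ (cube m) λ b′ →
      ∏ (allFin m) λ p → g p (Vec.lookup z p) (Vec.lookup b p) (Vec.lookup b′ p))
      ≈⟨ ∑-cong (cube m) (λ z → ∑-cong (cube m) λ b → ∑-cube-∏ m (λ p → g p (Vec.lookup z p) (Vec.lookup b p))) ⟩
    ∑ (cube m) (λ z → ∑ (cube m) λ b →
      ∏ (allFin m) λ p → g₂ p (Vec.lookup z p) (Vec.lookup b p))
      ≈⟨ ∑-cong (cube m) (λ z → ∑-cube-∏ m (λ p → g₂ p (Vec.lookup z p))) ⟩
    ∑ (cube m) (λ z → ∏ (allFin m) λ p → g₂ p (Vec.lookup z p) false + g₂ p (Vec.lookup z p) true)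
      ≈⟨ ∑-cube-∏ m (λ p β → g₂ p β false + g₂ p β true) ⟩
    ∏ (allFin m) (λ p → gadgetSum (w p) (y p) (y′ p) (x p)) ∎
    where
    g : Fin m → Bool → Bool → Bool → Carrier
    g p = gadget (w p) (y p) (y′ p) (x p)
    g₂ : Fin m → Bool → Bool → Carrier
    g₂ p z b = g p z b false + g p z b true
    merge : ∀ z b b′ →
      indicator (all (λ p → covered (x p) (Vec.lookup z p) (Vec.lookup b p) (Vec.lookup b′ p)) (allFin m)) *
      (∏ (allFin m) (λ p → pow (w p) (Vec.lookup z p)) *
       (∏ (allFin m) (λ p → pow (y p) (Vec.lookup b p)) * ∏ (allFin m) (λ p → pow (y′ p) (Vec.lookup b′ p))))
      ≈ ∏ (allFin m) (λ p → g p (Vec.lookup z p) (Vec.lookup b p) (Vec.lookup b′ p))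
    merge z b b′ = sym (trans (∏-* (allFin m) _ _) (*-cong (∏-indicator _ (allFin m))
      (trans (∏-* (allFin m) _ _) (*-congˡ (∏-* (allFin m) _ _)))))

-- The universal bipartite graph

module UniversalGraph (m : ℕ) where

  pairs vertices : ℕ
  pairs = m ℕ.* m
  vertices = m ℕ.+ (pairs ℕ.+ (pairs ℕ.+ pairs))

  data Label : Set where
    X       : Fin m → Label
    Y B B′  : Fin pairs → Label

  decode : Fin vertices → Label
  decode = [ X , [ Y , [ B , B′ ]′ ∘ splitAt pairs ]′ ∘ splitAt pairs ]′ ∘ splitAt m

  encode : Label → Fin vertices
  encode (X h)  = h ↑ˡ _
  encode (Y p)  = m ↑ʳ (p ↑ˡ _)
  encode (B p)  = m ↑ʳ (pairs ↑ʳ (p ↑ˡ pairs))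
  encode (B′ p) = m ↑ʳ (pairs ↑ʳ (pairs ↑ʳ p))

  decode-encode : ∀ u → decode (encode u) ≡ u
  decode-encode (X h)  rewrite Fin.splitAt-↑ˡ m h (pairs ℕ.+ (pairs ℕ.+ pairs)) = ≡.refl
  decode-encode (Y p)
    rewrite Fin.splitAt-↑ʳ m (pairs ℕ.+ (pairs ℕ.+ pairs)) (p ↑ˡ (pairs ℕ.+ pairs))
          | Fin.splitAt-↑ˡ pairs p (pairs ℕ.+ pairs) = ≡.refl
  decode-encode (B p)
    rewrite Fin.splitAt-↑ʳ m (pairs ℕ.+ (pairs ℕ.+ pairs)) (pairs ↑ʳ (p ↑ˡ pairs))
          | Fin.splitAt-↑ʳ pairs (pairs ℕ.+ pairs) (p ↑ˡ pairs)
          | Fin.splitAt-↑ˡ pairs p pairs = ≡.refl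
  decode-encode (B′ p)
    rewrite Fin.splitAt-↑ʳ m (pairs ℕ.+ (pairs ℕ.+ pairs)) (pairs ↑ʳ (pairs ↑ʳ p))
          | Fin.splitAt-↑ʳ pairs (pairs ℕ.+ pairs) (pairs ↑ʳ p)
          | Fin.splitAt-↑ʳ pairs pairs p = ≡.refl

  fst snd : Fin pairs → Fin m
  fst p = proj₁ (remQuot {m} m p)
  snd p = proj₂ (remQuot {m} m p)

  joins : Label → Label → Bool
  joins (B p)  (X h) = does (h Fin.≟ fst p) ∨ does (h Fin.≟ snd p)
  joins (B p)  (Y r) = does (r Fin.≟ p)
  joins (B′ p) (Y r) = does (r Fin.≟ p)
  joins _      _     = false

  right : Label → Bool
  right (X _)  = false
  right (Y _)  = false
  right (B _)  = true
  right (B′ _) = true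

  joins-right : ∀ u w → T (joins u w) → right u ≡ true × right w ≡ false
  joins-right (B p)  (X h) _ = ≡.refl , ≡.refl
  joins-right (B p)  (Y r) _ = ≡.refl , ≡.refl
  joins-right (B′ p) (Y r) _ = ≡.refl , ≡.refl

  graph : Graph
  graph = record
    { order    = vertices
    ; _~_      = λ i j → T (joins (decode i) (decode j)) ⊎ T (joins (decode j) (decode i))
    ; _~?_     = λ i j → T? (joins (decode i) (decode j)) ⊎-dec T? (joins (decode j) (decode i))
    ; ~-sym    = Sum.swap
    ; ~-irrefl = λ {i} → [ loopless (decode i) , loopless (decode i) ]′
    }
    where
    loopless : ∀ u → ¬ T (joins u u)
    loopless u uu with joins-right u u uu
    ... | eq , eq′ with () ← ≡.trans (≡.sym eq) eq′

  bipartite : Bipartite graph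
  bipartite = right ∘ decode , λ {i} {j} →
    [ (λ uw eq → differ (decode i) (decode j) uw eq)
    , (λ wu eq → differ (decode j) (decode i) wu (≡.sym eq)) ]′
    where
    differ : ∀ u w → T (joins u w) → right u ≢ right w
    differ u w uw eq with joins-right u w uw
    ... | u≡ , w≡ with () ← ≡.trans (≡.sym u≡) (≡.trans eq w≡)

  module _ (x : Vec Bool m) (y b b′ : Vec Bool pairs) where

    chosen : Label → Bool
    chosen (X h)  = Vec.lookup x h
    chosen (Y p)  = Vec.lookup y p
    chosen (B p)  = Vec.lookup b p
    chosen (B′ p) = Vec.lookup b′ p

    subset : Vec Bool vertices
    subset = x Vec.++ (y Vec.++ (b Vec.++ b′))

    lookup-subset : ∀ i → Vec.lookup subset i ≡ chosen (decode i)
    lookup-subset i rewrite Vec.lookup-splitAt m x (y Vec.++ (b Vec.++ b′)) i with splitAt m i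
    ... | inj₁ h = ≡.refl
    ... | inj₂ j rewrite Vec.lookup-splitAt pairs y (b Vec.++ b′) j with splitAt pairs j
    ... | inj₁ p = ≡.refl
    ... | inj₂ l rewrite Vec.lookup-splitAt pairs b b′ l with splitAt pairs l
    ... | inj₁ p = ≡.refl
    ... | inj₂ p = ≡.refl

    coveredPair : Fin pairs → Bool
    coveredPair p = covered (Vec.lookup x (fst p) ∧ Vec.lookup x (snd p))
                             (Vec.lookup y p) (Vec.lookup b p) (Vec.lookup b′ p)

    private
      to : ∀ x₁ x₂ y b b′ → T (b ∨ x₁) → T (b ∨ x₂) → T (b ∨ y) → T (b′ ∨ y) → T (covered (x₁ ∧ x₂) y b b′)
      to x₁   x₂   true  true  true  _ _ _ _ = _
      to x₁   x₂   true  true  false _ _ _ _ = _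
      to x₁   x₂   false true  true  _ _ _ _ = _
      to true true true  false true  _ _ _ _ = _
      to true true true  false false _ _ _ _ = _

      from-X₁ : ∀ x₁ x₂ y b b′ → T (covered (x₁ ∧ x₂) y b b′) → T (b ∨ x₁)
      from-X₁ x₁   x₂ y    true  b′ _ = _
      from-X₁ true x₂ y    false b′ _ = _
      from-X₁ false x₂ true false b′ ()

      from-X₂ : ∀ x₁ x₂ y b b′ → T (covered (x₁ ∧ x₂) y b b′) → T (b ∨ x₂)
      from-X₂ x₁    x₂    y    true  b′ _ = _
      from-X₂ x₁    true  y    false b′ _ = _
      from-X₂ true  false true false b′ ()
      from-X₂ false false true false b′ ()

      from-Y : ∀ x y b b′ → T (covered x y b b′) → T (b ∨ y)
      from-Y x y    true  b′ _ = _
      from-Y x true false b′ _ = _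

      from-Y′ : ∀ x y b b′ → T (covered x y b b′) → T (b′ ∨ y)
      from-Y′ x y     b     true  _ = _
      from-Y′ x true  b     false _ = _
      from-Y′ x false true  false ()
      from-Y′ x false false false ()

      cover-edge : (∀ p → T (coveredPair p)) → ∀ u w → T (joins u w) → T (chosen u ∨ chosen w)
      cover-edge ok (B p)  (X h) uw with h Fin.≟ fst p | h Fin.≟ snd p
      ... | yes ≡.refl | _          = from-X₁ (Vec.lookup x h) (Vec.lookup x (snd p))
          (Vec.lookup y p) (Vec.lookup b p) (Vec.lookup b′ p) (ok p)
      ... | no _       | yes ≡.refl = from-X₂ (Vec.lookup x (fst p)) (Vec.lookup x h)
          (Vec.lookup y p) (Vec.lookup b p) (Vec.lookup b′ p) (ok p)
      cover-edge ok (B p)  (Y r) uw with r Fin.≟ p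
      ... | yes ≡.refl = from-Y (Vec.lookup x (fst p) ∧ Vec.lookup x (snd p))
          (Vec.lookup y p) (Vec.lookup b p) (Vec.lookup b′ p) (ok p)
      cover-edge ok (B′ p) (Y r) uw with r Fin.≟ p
      ... | yes ≡.refl = from-Y′ (Vec.lookup x (fst p) ∧ Vec.lookup x (snd p))
          (Vec.lookup y p) (Vec.lookup b p) (Vec.lookup b′ p) (ok p)

      T-∨⁺ : ∀ a b → T a ⊎ T b → T (a ∨ b)
      T-∨⁺ a b = Equivalence.from Bool.T-∨

      T-∨⁻ : ∀ a b → T (a ∨ b) → T a ⊎ T b
      T-∨⁻ a b = Equivalence.to Bool.T-∨

      ∈⁺ : ∀ i → T (chosen (decode i)) → i ∈ₛ subset
      ∈⁺ i t = Vec.lookup⇒[]= i subset (≡.trans (lookup-subset i) (Equivalence.to Bool.T-≡ t))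

      ∈⁻ : ∀ i → i ∈ₛ subset → T (chosen (decode i))
      ∈⁻ i i∈ = Equivalence.from Bool.T-≡ (≡.trans (≡.sym (lookup-subset i)) (Vec.[]=⇒lookup i∈))

    cover⇒ : Graph.IsVertexCover graph subset → ∀ p → T (coveredPair p)
    cover⇒ cover p = to (Vec.lookup x (fst p)) _ _ _ _
      (edge (B p) (X (fst p)) (T-∨⁺ _ _ (inj₁ (self (fst p)))))
      (edge (B p) (X (snd p)) (T-∨⁺ (does (snd p Fin.≟ fst p)) _ (inj₂ (self (snd p)))))
      (edge (B p) (Y p) (self p)) (edge (B′ p) (Y p) (self p))
      where
      self : ∀ {k} (i : Fin k) → T (does (i Fin.≟ i))
      self i = Equivalence.from Bool.T-≡ (dec-true (i Fin.≟ i) ≡.refl)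
      edge : ∀ u w → T (joins u w) → T (chosen u ∨ chosen w)
      edge u w uw = T-∨⁺ _ _ (Sum.map (≡.subst (T ∘ chosen) (decode-encode u) ∘ ∈⁻ (encode u))
                                      (≡.subst (T ∘ chosen) (decode-encode w) ∘ ∈⁻ (encode w))
        (cover (encode u) (encode w) (inj₁ (≡.subst₂ (λ u w → T (joins u w))
          (≡.sym (decode-encode u)) (≡.sym (decode-encode w)) uw))))

    cover⇐ : (∀ p → T (coveredPair p)) → Graph.IsVertexCover graph subset
    cover⇐ ok i j (inj₁ ij) = Sum.map (∈⁺ i) (∈⁺ j) (T-∨⁻ _ _ (cover-edge ok (decode i) (decode j) ij))
    cover⇐ ok i j (inj₂ ji) = Sum.map (∈⁺ i) (∈⁺ j) (Sum.swap (T-∨⁻ _ _ (cover-edge ok (decode j) (decode i) ji)))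

    -- Every edge belongs to the gadget of exactly one pair, so the covering condition splits into
    -- one condition per pair.
    does-cover : does (Graph.isVertexCover? graph subset) ≡ all coveredPair (allFin pairs)
    does-cover = does-⇔ (mk⇔
      (λ cover → All.all⁻ coveredPair (All.tabulate⁺ (cover⇒ cover)))
      (λ ok → cover⇐ λ p → All.lookup (All.all⁺ coveredPair (allFin pairs) ok) (∈-allFin p)))
      (Graph.isVertexCover? graph subset) (T? (all coveredPair (allFin pairs)))

-- Independence polynomials as weighted sums over covers

module ConflictEmbedding {r ℓ w} (R : CommutativeRing r ℓ) {W : Set w} (ι : W → CommutativeRing.Carrier R) where

  open CommutativeRing R hiding (zero)
  open SumLemmas R
  open Gadget R
  open Grammar R ι using (Z)
  open Expansion R ι
  open Relation.Binary.Reasoning.Setoid setoid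

  module _ (m : ℕ) (τ : UniversalGraph.Label m → Carrier) where

    open UniversalGraph m

    coverSum : Carrier
    coverSum = ∑ (cube vertices) λ C →
      indicator (does (Graph.isVertexCover? graph C)) *
      ∏ (allFin vertices) (λ i → pow (τ (decode i)) (Vec.lookup C i))

    private
      both : Vec Bool m → Fin pairs → Bool
      both x p = Vec.lookup x (fst p) ∧ Vec.lookup x (snd p)

      summand : Vec Bool vertices → Carrier
      summand C = indicator (does (Graph.isVertexCover? graph C)) *
                  ∏ (allFin vertices) (λ i → pow (τ (decode i)) (Vec.lookup C i))

      gadgets : Vec Bool m → Vec Bool pairs → Vec Bool pairs → Vec Bool pairs → Carrier
      gadgets x y b b′ =
        indicator (all (λ p → covered (both x p) (Vec.lookup y p) (Vec.lookup b p) (Vec.lookup b′ p)) (allFin pairs)) *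
        (∏ (allFin pairs) (λ p → pow (τ (Y p)) (Vec.lookup y p)) *
         (∏ (allFin pairs) (λ p → pow (τ (B p)) (Vec.lookup b p)) *
          ∏ (allFin pairs) (λ p → pow (τ (B′ p)) (Vec.lookup b′ p))))

      xFactor : Vec Bool m → Carrier
      xFactor x = ∏ (allFin m) (λ h → pow (τ (X h)) (Vec.lookup x h))

      factor : ∀ x y b b′ → summand (subset x y b b′) ≈ xFactor x * gadgets x y b b′
      factor x y b b′ = begin
        summand (subset x y b b′)
          ≈⟨ *-cong (reflexive (≡.cong indicator (does-cover x y b b′)))
               (trans (∏-allFin-+ m _ f) (*-congˡ (trans (∏-allFin-+ pairs _ (f ∘ (m ↑ʳ_)))
                 (*-congˡ (∏-allFin-+ pairs pairs (f ∘ (m ↑ʳ_) ∘ (pairs ↑ʳ_))))))) ⟩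
        ind * (∏ (allFin m) (f ∘ encode ∘ X) * (∏ (allFin pairs) (f ∘ encode ∘ Y) *
          (∏ (allFin pairs) (f ∘ encode ∘ B) * ∏ (allFin pairs) (f ∘ encode ∘ B′))))
          ≈⟨ *-congˡ (*-cong (at X (allFin m)) (*-cong (at Y (allFin pairs))
               (*-cong (at B (allFin pairs)) (at B′ (allFin pairs))))) ⟩
        ind * (xFactor x * (∏ (allFin pairs) (λ p → pow (τ (Y p)) (Vec.lookup y p)) *
          (∏ (allFin pairs) (λ p → pow (τ (B p)) (Vec.lookup b p)) *
           ∏ (allFin pairs) (λ p → pow (τ (B′ p)) (Vec.lookup b′ p)))))
          ≈⟨ x∙yz≈y∙xz _ _ _ ⟩
        xFactor x * gadgets x y b b′ ∎
        where
        open Algebra.Properties.CommutativeSemigroup *-commutativeSemigroup using (x∙yz≈y∙xz)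
        ind = indicator (all (coveredPair x y b b′) (allFin pairs))
        f : Fin vertices → Carrier
        f i = pow (τ (decode i)) (Vec.lookup (subset x y b b′) i)
        at : ∀ {a} {A : Set a} (l : A → Label) xs →
             ∏ xs (f ∘ encode ∘ l) ≈ ∏ xs (λ h → pow (τ (l h)) (chosen x y b b′ (l h)))
        at l xs = ∏-cong xs λ h → reflexive (≡.trans
          (≡.cong (pow (τ (decode (encode (l h))))) (lookup-subset x y b b′ (encode (l h))))
          (≡.cong (λ u → pow (τ u) (chosen x y b b′ u)) (decode-encode (l h))))

    -- Once the choice `x` on the original vertices is fixed, different gadgets have nothing in
    -- common, and the sum over their states is a product over the pairs.
    coverSum-gadgets : coverSum ≈ ∑ (cube m) (λ x →
      xFactor x * ∏ (allFin pairs) (λ p → gadgetSum (τ (Y p)) (τ (B p)) (τ (B′ p)) (both x p)))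
    coverSum-gadgets = begin
      ∑ (cube vertices) summand
        ≈⟨ trans (∑-cube-+ m _ summand) (∑-cong (cube m) λ x →
             trans (∑-cube-+ pairs _ (λ c → summand (x Vec.++ c))) (∑-cong (cube pairs) λ y →
               ∑-cube-+ pairs pairs (λ c → summand (x Vec.++ (y Vec.++ c))))) ⟩
      ∑ (cube m) (λ x → ∑ (cube pairs) λ y → ∑ (cube pairs) λ b → ∑ (cube pairs) λ b′ →
        summand (subset x y b b′))
        ≈⟨ ∑-cong (cube m) (λ x → ∑-cong (cube pairs) λ y → ∑-cong (cube pairs) λ b →
             ∑-cong (cube pairs) λ b′ → factor x y b b′) ⟩
      ∑ (cube m) (λ x → ∑ (cube pairs) λ y → ∑ (cube pairs) λ b → ∑ (cube pairs) λ b′ →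
        xFactor x * gadgets x y b b′)
        ≈⟨ ∑-cong (cube m) (λ x → trans
             (∑-cong (cube pairs) λ y → trans
               (∑-cong (cube pairs) λ b → sym (*-distribˡ-∑ (xFactor x) (cube pairs) _))
               (sym (*-distribˡ-∑ (xFactor x) (cube pairs) _)))
             (sym (*-distribˡ-∑ (xFactor x) (cube pairs) _))) ⟩
      ∑ (cube m) (λ x → xFactor x *
        ∑ (cube pairs) (λ y → ∑ (cube pairs) λ b → ∑ (cube pairs) λ b′ → gadgets x y b b′))
        ≈⟨ ∑-cong (cube m) (λ x → *-congˡ (∑-gadgets pairs (τ ∘ Y) (τ ∘ B) (τ ∘ B′) (both x))) ⟩
      ∑ (cube m) (λ x →
        xFactor x * ∏ (allFin pairs) (λ p → gadgetSum (τ (Y p)) (τ (B p)) (τ (B′ p)) (both x p))) ∎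

  module _ (L : List (Vertex W)) (S : Marking) where

    open UniversalGraph (length L)

    conflicting : Fin pairs → Bool
    conflicting p = conflicts L (fst p) (snd p)

    -- The original vertices supply `vertexFactor`, and the enabled gadgets supply `pairFactor`,
    -- since `1 − x` is the indicator that the two ends are not both chosen.
    coverSum≈Z : ∀ τ →
      (∀ h → τ (X h) ≈ unmarkedWeight S (List.lookup L h)) →
      (∀ p → τ (Y p)  ≈ (if conflicting p then - 1# else 0#)) →
      (∀ p → τ (B p)  ≈ (if conflicting p then - 1# else 1#)) →
      (∀ p → τ (B′ p) ≈ (if conflicting p then 0# else 1#)) →
      coverSum (length L) τ ≈ Z L S
    coverSum≈Z τ τX τY τB τB′ = begin
      coverSum (length L) τ
        ≈⟨ coverSum-gadgets (length L) τ ⟩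
      ∑ (cube (length L)) (λ x → ∏ (allFin (length L)) (λ h → pow (τ (X h)) (Vec.lookup x h)) *
        ∏ (allFin pairs) (λ p → gadgetSum (τ (Y p)) (τ (B p)) (τ (B′ p))
          (Vec.lookup x (fst p) ∧ Vec.lookup x (snd p))))
        ≈⟨ ∑-cong (cube (length L)) (λ x → *-cong
             (∏-cong (allFin (length L)) λ h → pow-cong (τX h) (Vec.lookup x h))
             (pairsFactor x)) ⟩
      ∑ (cube (length L)) (λ x → vertexFactor L S x * pairFactor L x)
        ≈⟨ Z-expansion L S ⟨
      Z L S ∎
      where
      pow-cong : ∀ {w w′} → w ≈ w′ → ∀ b → pow w b ≈ pow w′ b
      pow-cong eq true  = eq
      pow-cong eq false = refl
      switched : ∀ c b {w y y′} → w ≈ (if c then - 1# else 0#) → y ≈ (if c then - 1# else 1#) →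
                 y′ ≈ (if c then 0# else 1#) → gadgetSum w y y′ b ≈ (if c ∧ b then 0# else 1#)
      switched true  b w≈ y≈ y′≈ = gadget-on  w≈ y≈ y′≈ b
      switched false b w≈ y≈ y′≈ = gadget-off w≈ y≈ y′≈ b
      pairsFactor : ∀ x → ∏ (allFin pairs) (λ p → gadgetSum (τ (Y p)) (τ (B p)) (τ (B′ p))
                            (Vec.lookup x (fst p) ∧ Vec.lookup x (snd p))) ≈ pairFactor L x
      pairsFactor x = begin
        ∏ (allFin pairs) (λ p → gadgetSum (τ (Y p)) (τ (B p)) (τ (B′ p))
          (Vec.lookup x (fst p) ∧ Vec.lookup x (snd p)))
          ≈⟨ ∏-cong (allFin pairs) (λ p → switched (conflicting p) _ (τY p) (τB p) (τB′ p)) ⟩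
        ∏ (allFin pairs) (λ p → entry (fst p , snd p))
          ≈⟨ ∏-allFin-* (length L) (length L) (λ p → entry (fst p , snd p)) ⟩
        ∏ (allFin (length L)) (λ i → ∏ (allFin (length L)) λ j →
          entry (remQuot {length L} (length L) (combine i j)))
          ≈⟨ ∏-cong (allFin (length L)) (λ i → ∏-cong (allFin (length L)) λ j →
               reflexive (≡.cong entry (Fin.remQuot-combine i j))) ⟩
        pairFactor L x ∎
        where
        entry : Fin (length L) × Fin (length L) → Carrier
        entry (i , j) = if conflicts L i j ∧ (Vec.lookup x i ∧ Vec.lookup x j) then 0# else 1#

-- Projections of the vertex cover polynomial

module VertexCoverPolynomial {c ℓ} (K : Field c ℓ) where

  open Field K using (Carrier; 0#; 1#; -_)
  open Valiant K renaming (const to constₚ; ∑ to ∑ₚ; ∏ to ∏ₚ)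
  open PolynomialRing K
  open Substitution K

  -- Summing over all subsets with a 0/1 factor makes the polynomial comparable, term by term, with
  -- `P`, with boolean sums and with the gadget sums.
  VCP-sum : ∀ G → let open Gadget (polyRing (order G)) in
    VCP G ≋ ∑ₚ (cube (order G)) λ C →
      indicator (does (Graph.isVertexCover? G C)) *ₚ
      ∏ₚ (allFin (order G)) (λ i → pow (var i) (Vec.lookup C i))
  VCP-sum G = R.trans
    (∑-filter (Graph.isVertexCover? G) (cube (order G)) _)
    (∑-cong (cube (order G)) λ C → R.trans
      (Gadget.restrict (polyRing (order G)) (does (Graph.isVertexCover? G C)) _)
      (R.*-congˡ {indicator (does (Graph.isVertexCover? G C))} (R.trans
        (∏-filter (_∈ₛ? C) (allFin (order G)) var)
        (∏-cong (allFin (order G)) λ i → R.reflexive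
          (≡.cong (pow (var i)) (does-∈? i C))))))
    where
    open Gadget (polyRing (order G))
    open SumLemmas (polyRing (order G))
    module R = CommutativeRing (polyRing (order G))
    does-∈? : ∀ {n} (i : Fin n) C → does (i ∈ₛ? C) ≡ Vec.lookup C i
    does-∈? i C = does-⇔ (mk⇔
      (λ i∈ → Equivalence.from Bool.T-≡ (Vec.[]=⇒lookup i∈))
      (λ t → Vec.lookup⇒[]= i C (Equivalence.to Bool.T-≡ t))) (i ∈ₛ? C) (T? (Vec.lookup C i))

  substitute-VCP : ∀ {n} G (τ : Fin (order G) → Poly n) → let open Gadget (polyRing n) in
    substitute τ (VCP G) ≋ ∑ₚ (cube (order G)) λ C →
      indicator (does (Graph.isVertexCover? G C)) *ₚ
      ∏ₚ (allFin (order G)) (λ i → pow (τ i) (Vec.lookup C i))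
  substitute-VCP {n} G τ = R.trans (substitute-cong τ (VCP-sum G)) (R.trans
    (substitute-∑ τ (cube (order G)) _)
    (∑-cong (cube (order G)) λ C → R.trans
      (substitute-* τ (indicator₀ (does (Graph.isVertexCover? G C))) _)
      (R.*-cong {substitute τ (indicator₀ (does (Graph.isVertexCover? G C)))}
        (on-indicator (does (Graph.isVertexCover? G C)))
        (R.trans (substitute-∏ τ (allFin (order G)) (λ i → pow₀ (var i) (Vec.lookup C i)))
          (∏-cong (allFin (order G)) λ i → on-pow i (Vec.lookup C i))))))
    where
    open Gadget (polyRing n)
    open Gadget (polyRing (order G)) using () renaming (indicator to indicator₀; pow to pow₀)
    open SumLemmas (polyRing n)
    module R = CommutativeRing (polyRing n)
    on-indicator : ∀ b → substitute τ (indicator₀ b) ≋ indicator b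
    on-indicator true  = substitute-const τ 1#
    on-indicator false = R.refl
    on-pow : ∀ i b → substitute τ (pow₀ (var i) b) ≋ pow (τ i) b
    on-pow i true  = substitute-var τ i
    on-pow i false = substitute-const τ 1#

  module _ {v : ℕ} where

    ⟦_⟧ʷ : Fin v ⊎ Carrier → Poly v
    ⟦_⟧ʷ = [ var , constₚ ]′

    open Grammar (polyRing v) ⟦_⟧ʷ using (Z)
    open Expansion (polyRing v) ⟦_⟧ʷ
    open ConflictEmbedding (polyRing v) ⟦_⟧ʷ
    private module R = CommutativeRing (polyRing v)

    -- A vertex blocked from the start, such as `idle⁰` of the root, is deleted by giving it weight
    -- 0. The remaining weights are the two settings of the gadget.
    labelWeight : (L : List (Vertex (Fin v ⊎ Carrier))) → Marking →
                  UniversalGraph.Label (length L) → Fin v ⊎ Carrier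
    labelWeight L S (UniversalGraph.X h) =
      if any S (checks (List.lookup L h)) then inj₂ 0# else weight (List.lookup L h)
    labelWeight L S (UniversalGraph.Y p)  = inj₂ (if conflicting L S p then - 1# else 0#)
    labelWeight L S (UniversalGraph.B p)  = inj₂ (if conflicting L S p then - 1# else 1#)
    labelWeight L S (UniversalGraph.B′ p) = inj₂ (if conflicting L S p then 0# else 1#)

    Z-projection : ∀ L S → Z L S ≋
      substitute (⟦_⟧ʷ ∘ labelWeight L S ∘ UniversalGraph.decode (length L)) (VCP (UniversalGraph.graph (length L)))
    Z-projection L S = R.sym (R.trans
      (substitute-VCP (graph (length L)) (⟦_⟧ʷ ∘ labelWeight L S ∘ decode (length L)))
      (coverSum≈Z L S (⟦_⟧ʷ ∘ labelWeight L S)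
        (λ h → vertexWeight (List.lookup L h))
        (λ p → switchWeight (conflicting L S p) R.refl const-0)
        (λ p → switchWeight (conflicting L S p) R.refl R.refl)
        (λ p → switchWeight (conflicting L S p) const-0 R.refl)))
      where
      open UniversalGraph
      vertexWeight : ∀ u → ⟦ if any S (checks u) then inj₂ 0# else weight u ⟧ʷ ≋ unmarkedWeight S u
      vertexWeight u with any S (checks u)
      ... | true  = const-0
      ... | false = R.refl
      switchWeight : ∀ b {a a′ f f′} → constₚ a ≋ f → constₚ a′ ≋ f′ →
                 constₚ (if b then a else a′) ≋ (if b then f else f′)
      switchWeight true  eq eq′ = eq
      switchWeight false eq eq′ = eq′

-- The covering formula

-- Both orientations of an edge give a clause. `IsVertexCover` also ranges over ordered pairs, so
-- the two conditions match without an appeal to symmetry.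
coveringFormula : ∀ G → OR₀Formula (order G)
coveringFormula G = List.filter (λ (i , j) → Graph._~?_ G i j) (cartesianProduct (allFin (order G)) (allFin (order G)))

⟦coveringFormula⟧ : ∀ G C → does (Graph.isVertexCover? G C) ≡ ⟦ coveringFormula G ⟧ C
⟦coveringFormula⟧ G C = does-⇔ (mk⇔ to from) (Graph.isVertexCover? G C) (T? (⟦ coveringFormula G ⟧ C))
  where
  clause : Fin (order G) × Fin (order G) → Bool
  clause (i , j) = OR₀ (Vec.lookup C i) (Vec.lookup C j)
  to : Graph.IsVertexCover G C → T (⟦ coveringFormula G ⟧ C)
  to cover = All.all⁻ clause (All.map
    (λ {(i , j)} ij → Equivalence.from Bool.T-∨ (Sum.map ∈⇒T ∈⇒T (cover i j ij)))
    (All.all-filter (λ (i , j) → Graph._~?_ G i j) (cartesianProduct (allFin (order G)) (allFin (order G)))))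
    where
    ∈⇒T : ∀ {i} → i ∈ₛ C → T (Vec.lookup C i)
    ∈⇒T i∈ = Equivalence.from Bool.T-≡ (Vec.[]=⇒lookup i∈)
  from : T (⟦ coveringFormula G ⟧ C) → Graph.IsVertexCover G C
  from ok i j ij = Sum.map (T⇒∈ i) (T⇒∈ j) (Equivalence.to Bool.T-∨
    (All.lookup (All.all⁺ clause (coveringFormula G) ok)
      (∈-filter⁺ (λ (i , j) → Graph._~?_ G i j) (∈-cartesianProduct⁺ (∈-allFin i) (∈-allFin j)) ij)))
    where
    T⇒∈ : ∀ i → T (Vec.lookup C i) → i ∈ₛ C
    T⇒∈ i t = Vec.lookup⇒[]= i C (Equivalence.to Bool.T-≡ t)

length-coveringFormula : ∀ G → length (coveringFormula G) ≤ order G ℕ.* order G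
length-coveringFormula G = ℕ.≤-trans
  (List.length-filter (λ (i , j) → Graph._~?_ G i j) (cartesianProduct (allFin (order G)) (allFin (order G))))
  (ℕ.≤-reflexive (≡.trans
  (length-cartesianProduct (allFin (order G)) (allFin (order G)))
    (≡.cong₂ ℕ._*_ (List.length-tabulate {n = order G} id) (List.length-tabulate {n = order G} id))))

-- Arithmetization, complexity and degree

module Booleans {r ℓ} (R : CommutativeRing r ℓ) where

  open CommutativeRing R hiding (zero)
  open Gadget R using (indicator; pow)
  open Algebra.Properties.Ring ring using (-1*x≈-x)

  -1*1+1≈0 : 1# + - 1# * 1# ≈ 0#
  -1*1+1≈0 = trans (+-congˡ (-1*x≈-x 1#)) (-‿inverseʳ 1#)

  -- The polynomial `a + b − ab` interpolates disjunction; it is the clause of the kernel that puts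
  -- the family into VNP.
  indicator-∨ : ∀ a b → indicator a + indicator b + - 1# * (indicator a * indicator b) ≈ indicator (a ∨ b)
  indicator-∨ true b = trans (+-assoc _ _ _) (trans
    (+-congˡ (trans (+-congˡ (trans (*-congˡ (*-identityˡ _)) (-1*x≈-x _))) (-‿inverseʳ _)))
    (+-identityʳ 1#))
  indicator-∨ false b = trans
    (+-cong (+-identityˡ _) (trans (*-congˡ (zeroˡ _)) (zeroʳ _))) (+-identityʳ _)

  -- Interpolates the power of `x` with exponent 0 or 1 by a polynomial that is affine in the
  -- exponent.
  pow-affine : ∀ b x → indicator b * x + (1# + - 1# * indicator b) ≈ pow x b
  pow-affine true  x = trans (+-cong (*-identityˡ x) -1*1+1≈0) (+-identityʳ x)
  pow-affine false x = trans
    (+-cong (zeroˡ x) (trans (+-congˡ (zeroʳ _)) (+-identityʳ 1#))) (+-identityˡ 1#)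

module Complexity {c ℓ} (K : Field c ℓ) where

  open Field K using (1#)
  open Valiant K renaming (const to constₚ; ∑ to ∑ₚ; ∏ to ∏ₚ)
  open PolynomialRing K

  module _ {n : ℕ} where

    private module R = CommutativeRing (polyRing n)

    -- Arguments count back from the gate, so placing another circuit underneath changes only the
    -- type of the indices.
    raise : ∀ {k} l → Gate n k → Gate n (k ℕ.+ l)
    raise l (input x)    = input x
    raise l (constant a) = constant a
    raise l (plus i j)   = plus (i ↑ˡ l) (j ↑ˡ l)
    raise l (mult i j)   = mult (i ↑ˡ l) (j ↑ˡ l)

    infixl 5 _⧺_
    _⧺_ : ∀ {k l} → Circuit n l → Circuit n k → Circuit n (k ℕ.+ l)
    C ⧺ ε       = C
    _⧺_ {l = l} C (D ▸ g) = (C ⧺ D) ▸ raise l g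

    evalGate-raise : ∀ {k l} (xs : Vec (Poly n) k) (ys : Vec (Poly n) l) g →
                     evalGate (xs Vec.++ ys) (raise l g) ≡ evalGate xs g
    evalGate-raise xs ys (input x)    = ≡.refl
    evalGate-raise xs ys (constant a) = ≡.refl
    evalGate-raise xs ys (plus i j)   = ≡.cong₂ _+ₚ_ (Vec.lookup-++ˡ xs ys i) (Vec.lookup-++ˡ xs ys j)
    evalGate-raise xs ys (mult i j)   = ≡.cong₂ _*ₚ_ (Vec.lookup-++ˡ xs ys i) (Vec.lookup-++ˡ xs ys j)

    values-⧺ : ∀ {k l} (C : Circuit n l) (D : Circuit n k) → values (C ⧺ D) ≡ values D Vec.++ values C
    values-⧺ C ε       = ≡.refl
    values-⧺ C (D ▸ g) rewrite values-⧺ C D = ≡.cong (_∷ _) (evalGate-raise (values D) (values C) g)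

    private
      lookup-head : ∀ {k} (xs : Vec (Poly n) (suc k)) → Vec.lookup xs zero ≡ Vec.head xs
      lookup-head (_ ∷ _) = ≡.refl

      left : ∀ {k l} (C : Circuit n (suc l)) (D : Circuit n (suc k)) →
             Vec.lookup (values (C ⧺ D)) (suc k ↑ʳ zero) ≡ output C
      left C D rewrite values-⧺ C D =
        ≡.trans (Vec.lookup-++ʳ (values D) (values C) zero) (lookup-head (values C))

      right : ∀ {k l} (C : Circuit n (suc l)) (D : Circuit n (suc k)) →
              Vec.lookup (values (C ⧺ D)) (zero ↑ˡ suc l) ≡ output D
      right C D rewrite values-⧺ C D =
        ≡.trans (Vec.lookup-++ˡ (values D) (values C) zero) (lookup-head (values D))

      bound : ∀ {k l s t} → suc l ≤ s → suc k ≤ t → suc (suc k ℕ.+ suc l) ≤ suc (s ℕ.+ t)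
      bound {k} {l} l<s k<t = s≤s (ℕ.≤-trans (ℕ.≤-reflexive (ℕ.+-comm (suc k) (suc l))) (ℕ.+-mono-≤ l<s k<t))

    complexity-var : ∀ i → ComplexityAtMost 1 (var {n} i)
    complexity-var i = 0 , s≤s z≤n , ε ▸ input i , λ m → Field.refl K

    complexity-const : ∀ a → ComplexityAtMost 1 (constₚ {n} a)
    complexity-const a = 0 , s≤s z≤n , ε ▸ constant a , λ m → Field.refl K

    complexity-+ : ∀ {s t} (f g : Poly n) → ComplexityAtMost s f → ComplexityAtMost t g →
                   ComplexityAtMost (suc (s ℕ.+ t)) (f +ₚ g)
    complexity-+ f g (l , l<s , C , C≈f) (k , k<t , D , D≈g) =
      suc k ℕ.+ suc l , bound l<s k<t , (C ⧺ D) ▸ plus (suc k ↑ʳ zero) (zero ↑ˡ suc l) ,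
      coeffs (R.trans (R.reflexive (≡.cong₂ _+ₚ_ (left C D) (right C D)))
        (R.+-cong {output C} {f} {output D} {g} (mk≋ C≈f) (mk≋ D≈g)))

    complexity-* : ∀ {s t} (f g : Poly n) → ComplexityAtMost s f → ComplexityAtMost t g →
                   ComplexityAtMost (suc (s ℕ.+ t)) (f *ₚ g)
    complexity-* f g (l , l<s , C , C≈f) (k , k<t , D , D≈g) =
      suc k ℕ.+ suc l , bound l<s k<t , (C ⧺ D) ▸ mult (suc k ↑ʳ zero) (zero ↑ˡ suc l) ,
      coeffs (R.trans (R.reflexive (≡.cong₂ _*ₚ_ (left C D) (right C D)))
        (R.*-cong {output C} {f} {output D} {g} (mk≋ C≈f) (mk≋ D≈g)))

    complexity-∏ : ∀ {a} {A : Set a} {s} (xs : List A) (f : A → Poly n) →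
                   (∀ x → ComplexityAtMost s (f x)) → ComplexityAtMost (suc (length xs ℕ.* suc s)) (∏ₚ xs f)
    complexity-∏ []       f cx = complexity-const 1#
    complexity-∏ {s = s} (x ∷ xs) f cx = ≡.subst (λ b → ComplexityAtMost b (f x *ₚ ∏ₚ xs f))
      (≡.cong suc (ℕ.+-suc s (length xs ℕ.* suc s))) (complexity-* (f x) (∏ₚ xs f) (cx x) (complexity-∏ xs f cx))

    complexity-mono : ∀ {s t} (f : Poly n) → s ≤ t → ComplexityAtMost s f → ComplexityAtMost t f
    complexity-mono f s≤t (k , k<s , C , C≈f) = k , ℕ.≤-trans k<s s≤t , C , C≈f

    -- A bound on the listed terms, cancelling or not. Unlike `DegreeAtMost` it passes through
    -- products and sums by inspection of the lists.
    Terms≤ : ℕ → Poly n → Set c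
    Terms≤ d = All (λ (_ , m) → Vec.sum m ≤ d)

    Terms≤⇒DegreeAtMost : ∀ {d} f → Terms≤ d f → DegreeAtMost d f
    Terms≤⇒DegreeAtMost []             []           m d<m = Field.refl K
    Terms≤⇒DegreeAtMost ((a , m′) ∷ f) (m′≤d ∷ f≤d) m d<m with m ≟ₘ m′
    ... | yes ≡.refl = ⊥-elim (ℕ.<⇒≱ d<m m′≤d)
    ... | no _       = Field.trans K (Field.+-identityˡ K _) (Terms≤⇒DegreeAtMost f f≤d m d<m)

    terms-mono : ∀ {d e f} → d ≤ e → Terms≤ d f → Terms≤ e f
    terms-mono d≤e = All.map λ m≤d → ℕ.≤-trans m≤d d≤e

    terms-const : ∀ d a → Terms≤ d (constₚ a)
    terms-const d a = ℕ.≤-trans (ℕ.≤-reflexive (sum-𝟘 n)) z≤n ∷ []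

    terms-var : ∀ i → Terms≤ 1 (var i)
    terms-var i = ℕ.≤-reflexive (sum-unit i) ∷ []

    terms-* : ∀ {d e} f g → Terms≤ d f → Terms≤ e g → Terms≤ (d ℕ.+ e) (f *ₚ g)
    terms-* []             g []        g≤ = []
    terms-* ((a , m) ∷ f) g (m≤ ∷ f≤) g≤ = All.++⁺
      (All.map⁺ (All.map (λ {(b , m′)} m′≤ → ℕ.≤-trans (ℕ.≤-reflexive (sum-⊕ m m′)) (ℕ.+-mono-≤ m≤ m′≤)) g≤))
      (terms-* f g f≤ g≤)

    terms-∑ : ∀ {a} {A : Set a} {d} (xs : List A) (f : A → Poly n) →
              (∀ x → Terms≤ d (f x)) → Terms≤ d (∑ₚ xs f)
    terms-∑ []       f f≤ = []
    terms-∑ (x ∷ xs) f f≤ = All.++⁺ (f≤ x) (terms-∑ xs f f≤)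

    terms-∏ : ∀ {a} {A : Set a} {d} (xs : List A) (f : A → Poly n) →
              (∀ x → Terms≤ d (f x)) → Terms≤ (length xs ℕ.* d) (∏ₚ xs f)
    terms-∏ []       f f≤ = terms-const 0 1#
    terms-∏ (x ∷ xs) f f≤ = terms-* (f x) (∏ₚ xs f) (f≤ x) (terms-∏ xs f f≤)

-- The vertex cover polynomial as `P` of a formula and as a boolean sum

module CoverPolynomials {c ℓ} (K : Field c ℓ) where

  open Field K using (1#; -_)
  open Valiant K renaming (const to constₚ; ∏ to ∏ₚ) hiding (∑)
  open PolynomialRing K
  open Substitution K
  open Complexity K
  open VertexCoverPolynomial K

  fromBool≋ : ∀ {n} b → constₚ {n} (fromBool b) ≋ Gadget.indicator (polyRing n) b
  fromBool≋ {n} true  = CommutativeRing.refl (polyRing n)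
  fromBool≋     false = const-0

  VCP≋P : ∀ G → VCP G ≋ P ⟦ coveringFormula G ⟧
  VCP≋P G = R.trans (VCP-sum G) (∑-cong (cube (order G)) λ C →
    R.*-cong {indicator (does (Graph.isVertexCover? G C))}
      (R.trans (R.reflexive (≡.cong indicator (⟦coveringFormula⟧ G C))) (R.sym (fromBool≋ _)))
      (∏-cong (allFin (order G)) λ i → power i (Vec.lookup C i)))
    where
    open Gadget (polyRing (order G))
    open SumLemmas (polyRing (order G))
    module R = CommutativeRing (polyRing (order G))
    power : ∀ i b → pow (var i) b ≋ var i ^ₚ (if b then 1 else 0)
    power i true  = R.sym (R.*-identityʳ (var i))
    power i false = R.refl

  module _ (G : Graph) where

    private
      N = order G
      module R  = CommutativeRing (polyRing N)

      X E : Fin N → Poly (N ℕ.+ N)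
      X i = var (i ↑ˡ N)
      E i = var (N ↑ʳ i)

      -1ₚ : ∀ {n} → Poly n
      -1ₚ = constₚ (- 1#)

      clause : Fin N × Fin N → Poly (N ℕ.+ N)
      clause (i , j) = E i +ₚ E j +ₚ -1ₚ *ₚ (E i *ₚ E j)

      factor : Fin N → Poly (N ℕ.+ N)
      factor i = E i *ₚ X i +ₚ (constₚ 1# +ₚ -1ₚ *ₚ E i)

    -- At a boolean point the clauses evaluate to the truth value of the formula and the remaining
    -- factors to the monomial of the subset. The product form is what keeps the circuit small.
    coverKernel : Poly (N ℕ.+ N)
    coverKernel = ∏ₚ (coveringFormula G) clause *ₚ ∏ₚ (allFin N) factor

    -- Each clause and each factor is computed with 9 nodes, and one more multiplies it to the rest
    -- of its product.
    coverKernel-complexity :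
      ComplexityAtMost (suc (suc (length (coveringFormula G) ℕ.* 10) ℕ.+ suc (length (allFin N) ℕ.* 10))) coverKernel
    coverKernel-complexity = complexity-* (∏ₚ (coveringFormula G) clause) (∏ₚ (allFin N) factor)
      (complexity-∏ (coveringFormula G) clause λ (i , j) → complexity-+ (E i +ₚ E j) (-1ₚ *ₚ (E i *ₚ E j))
        (complexity-+ (E i) (E j) (E-complexity i) (E-complexity j))
        (complexity-* -1ₚ (E i *ₚ E j) (complexity-const (- 1#))
          (complexity-* (E i) (E j) (E-complexity i) (E-complexity j))))
      (complexity-∏ (allFin N) factor λ i → complexity-+ (E i *ₚ X i) (constₚ 1# +ₚ -1ₚ *ₚ E i)
        (complexity-* (E i) (X i) (E-complexity i) (complexity-var (i ↑ˡ N)))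
        (complexity-+ (constₚ 1#) (-1ₚ *ₚ E i) (complexity-const 1#)
          (complexity-* -1ₚ (E i) (complexity-const (- 1#)) (E-complexity i))))
      where
      E-complexity : ∀ i → ComplexityAtMost 1 (E i)
      E-complexity i = complexity-var (N ↑ʳ i)

    coverKernel-terms : Terms≤ (length (coveringFormula G) ℕ.* 2 ℕ.+ length (allFin N) ℕ.* 2) coverKernel
    coverKernel-terms = terms-* (∏ₚ (coveringFormula G) clause) (∏ₚ (allFin N) factor)
      (terms-∏ (coveringFormula G) clause λ (i , j) → All.++⁺
        (terms-mono {f = E i +ₚ E j} (s≤s z≤n) (All.++⁺ (terms-var (N ↑ʳ i)) (terms-var (N ↑ʳ j))))
        (terms-* -1ₚ (E i *ₚ E j) (terms-const 0 (- 1#))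
          (terms-* (E i) (E j) (terms-var (N ↑ʳ i)) (terms-var (N ↑ʳ j)))))
      (terms-∏ (allFin N) factor λ i → All.++⁺
        (terms-* (E i) (X i) (terms-var (N ↑ʳ i)) (terms-var (i ↑ˡ N)))
        (All.++⁺ (terms-const 2 1#) (terms-mono {f = -1ₚ *ₚ E i} (s≤s z≤n)
          (terms-* -1ₚ (E i) (terms-const 0 (- 1#)) (terms-var (N ↑ʳ i))))))

    VCP-terms : Terms≤ N (VCP G)
    VCP-terms = terms-∑ (List.filter (Graph.isVertexCover? G) (cube N)) (λ C → ∏ₚ (members C) var) λ C →
      terms-mono {f = ∏ₚ (members C) var}
        (ℕ.≤-trans (ℕ.≤-reflexive (ℕ.*-identityʳ (length (members C)))) (ℕ.≤-trans
          (List.length-filter (_∈ₛ? C) (allFin N)) (ℕ.≤-reflexive (List.length-tabulate id))))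
        (terms-∏ (members C) var terms-var)
      where
      members : Vec Bool N → List (Fin N)
      members C = List.filter (_∈ₛ? C) (allFin N)

    VCP≋booleanSum : VCP G ≋ booleanSum N coverKernel
    VCP≋booleanSum = R.trans (VCP-sum G) (∑-cong (cube N) λ C → R.sym (R.trans
      (substitute-* (σ C) (∏ₚ (coveringFormula G) clause) (∏ₚ (allFin N) factor))
      (R.*-cong {substitute (σ C) (∏ₚ (coveringFormula G) clause)}
        (R.trans (substitute-∏ (σ C) (coveringFormula G) clause)
          (R.trans (∏-cong (coveringFormula G) (clause-value C))
            (R.trans (∏-indicator (λ (i , j) → OR₀ (Vec.lookup C i) (Vec.lookup C j)) (coveringFormula G))
              (R.reflexive (≡.cong indicator (≡.sym (⟦coveringFormula⟧ G C)))))))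
        (R.trans (substitute-∏ (σ C) (allFin N) factor) (∏-cong (allFin N) (factor-value C))))))
      where
      open Gadget (polyRing N)
      open SumLemmas (polyRing N)
      σ : Vec Bool N → Fin (N ℕ.+ N) → Poly N
      σ C = Vec.lookup (Vec.map var (Vec.allFin N) Vec.++ Vec.map (constₚ ∘ fromBool) C)
      X-value : ∀ C i → substitute (σ C) (X i) ≋ var i
      X-value C i = R.trans (substitute-var (σ C) (i ↑ˡ N)) (R.reflexive (≡.trans
        (Vec.lookup-++ˡ (Vec.map var (Vec.allFin N)) _ i)
        (≡.trans (Vec.lookup-map i var (Vec.allFin N)) (≡.cong var (Vec.lookup-allFin i)))))
      E-value : ∀ C i → substitute (σ C) (E i) ≋ indicator (Vec.lookup C i)
      E-value C i = R.trans (substitute-var (σ C) (N ↑ʳ i)) (R.trans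
        (R.reflexive (≡.trans (Vec.lookup-++ʳ (Vec.map var (Vec.allFin N)) _ i)
          (Vec.lookup-map i (constₚ ∘ fromBool) C)))
        (fromBool≋ (Vec.lookup C i)))
      times : ∀ C f g {f′ g′} → substitute (σ C) f ≋ f′ → substitute (σ C) g ≋ g′ →
              substitute (σ C) (f *ₚ g) ≋ f′ *ₚ g′
      times C f g {f′} {g′} f≋ g≋ = R.trans (substitute-* (σ C) f g)
        (R.*-cong {substitute (σ C) f} {f′} {substitute (σ C) g} {g′} f≋ g≋)
      sum : ∀ C f g {f′ g′} → substitute (σ C) f ≋ f′ → substitute (σ C) g ≋ g′ →
            substitute (σ C) (f +ₚ g) ≋ f′ +ₚ g′
      sum C f g {f′} {g′} f≋ g≋ = R.trans (substitute-+ (σ C) f g)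
        (R.+-cong {substitute (σ C) f} {f′} {substitute (σ C) g} {g′} f≋ g≋)
      clause-value : ∀ C ij → substitute (σ C) (clause ij) ≋
                     indicator (OR₀ (Vec.lookup C (proj₁ ij)) (Vec.lookup C (proj₂ ij)))
      clause-value C (i , j) = R.trans
        (sum C (E i +ₚ E j) (-1ₚ *ₚ (E i *ₚ E j)) (sum C (E i) (E j) (E-value C i) (E-value C j))
          (times C -1ₚ (E i *ₚ E j) (substitute-const (σ C) (- 1#))
            (times C (E i) (E j) (E-value C i) (E-value C j))))
        (Booleans.indicator-∨ (polyRing N) (Vec.lookup C i) (Vec.lookup C j))
      factor-value : ∀ C i → substitute (σ C) (factor i) ≋ pow (var i) (Vec.lookup C i)
      factor-value C i = R.trans
        (sum C (E i *ₚ X i) (constₚ 1# +ₚ -1ₚ *ₚ E i) (times C (E i) (X i) (E-value C i) (X-value C i))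
          (sum C (constₚ 1#) (-1ₚ *ₚ E i) (substitute-const (σ C) 1#)
            (times C -1ₚ (E i) (substitute-const (σ C) (- 1#)) (E-value C i))))
        (Booleans.pow-affine (polyRing N) (Vec.lookup C i) (var i))

-- Closure properties of polynomial bounds

module PolynomialGrowth where

  open import Data.Nat.Base using (_+_; _*_)
  open import Data.Nat.Tactic.RingSolver using (solve-∀)

  infixl 6 _⊞_
  infixl 7 _⊠_
  _⊞_ _⊠_ : List ℕ → List ℕ → List ℕ
  []      ⊞ q       = q
  (a ∷ p) ⊞ []      = a ∷ p
  (a ∷ p) ⊞ (b ∷ q) = a + b ∷ p ⊞ q
  []      ⊠ q = []
  (a ∷ p) ⊠ q = List.map (a *_) q ⊞ (0 ∷ p ⊠ q)

  evalℕ-⊞ : ∀ p q n → evalℕ (p ⊞ q) n ≡ evalℕ p n + evalℕ q n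
  evalℕ-⊞ []      q       n = ≡.refl
  evalℕ-⊞ (a ∷ p) []      n = ≡.sym (ℕ.+-identityʳ _)
  evalℕ-⊞ (a ∷ p) (b ∷ q) n rewrite evalℕ-⊞ p q n = lemma a b n (evalℕ p n) (evalℕ q n)
    where
    lemma : ∀ a b n x y → a + b + n * (x + y) ≡ a + n * x + (b + n * y)
    lemma = solve-∀

  evalℕ-scale : ∀ a q n → evalℕ (List.map (a *_) q) n ≡ a * evalℕ q n
  evalℕ-scale a []      n = ≡.sym (ℕ.*-zeroʳ a)
  evalℕ-scale a (b ∷ q) n rewrite evalℕ-scale a q n = lemma a b n (evalℕ q n)
    where
    lemma : ∀ a b n x → a * b + n * (a * x) ≡ a * (b + n * x)
    lemma = solve-∀

  evalℕ-⊠ : ∀ p q n → evalℕ (p ⊠ q) n ≡ evalℕ p n * evalℕ q n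
  evalℕ-⊠ []      q n = ≡.refl
  evalℕ-⊠ (a ∷ p) q n
    rewrite evalℕ-⊞ (List.map (a *_) q) (0 ∷ p ⊠ q) n | evalℕ-scale a q n | evalℕ-⊠ p q n =
    lemma a n (evalℕ p n) (evalℕ q n)
    where
    lemma : ∀ a n x y → a * y + n * (x * y) ≡ (a + n * x) * y
    lemma = solve-∀

  bounded-≤ : ∀ {f g} → (∀ n → f n ≤ g n) → PolynomiallyBounded g → PolynomiallyBounded f
  bounded-≤ f≤g (p , g≤p) = p , λ n → ℕ.≤-trans (f≤g n) (g≤p n)

  bounded-eval : ∀ p → PolynomiallyBounded (evalℕ p)
  bounded-eval p = p , λ n → ℕ.≤-refl

  bounded-const : ∀ a → PolynomiallyBounded (λ _ → a)
  bounded-const a = [ a ] , λ n → ℕ.m≤m+n a _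

  bounded-id : PolynomiallyBounded id
  bounded-id = (0 ∷ 1 ∷ []) , λ n → ℕ.≤-reflexive (lemma n)
    where
    lemma : ∀ n → n ≡ 0 + n * (1 + n * 0)
    lemma = solve-∀

  bounded-+ : ∀ {f g} → PolynomiallyBounded f → PolynomiallyBounded g → PolynomiallyBounded (λ n → f n + g n)
  bounded-+ (p , f≤p) (q , g≤q) = p ⊞ q , λ n →
    ℕ.≤-trans (ℕ.+-mono-≤ (f≤p n) (g≤q n)) (ℕ.≤-reflexive (≡.sym (evalℕ-⊞ p q n)))

  bounded-* : ∀ {f g} → PolynomiallyBounded f → PolynomiallyBounded g → PolynomiallyBounded (λ n → f n * g n)
  bounded-* (p , f≤p) (q , g≤q) = p ⊠ q , λ n →
    ℕ.≤-trans (ℕ.*-mono-≤ (f≤p n) (g≤q n)) (ℕ.≤-reflexive (≡.sym (evalℕ-⊠ p q n)))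

open PolynomialGrowth

-- Membership in VNP and hardness

module Completeness {c ℓ} (K : Field c ℓ) where

  open Valiant K
  open PolynomialRing K
  open Substitution K using (substitute-cong)
  open Complexity K
  open VertexCoverPolynomial K
  open CoverPolynomials K

  private
    degree-mono : ∀ {n d e} {f : Poly n} → d ≤ e → DegreeAtMost d f → DegreeAtMost e f
    degree-mono d≤e deg m e<m = deg m (ℕ.≤-<-trans d≤e e<m)

  module _ (G : ℕ → Graph) (order-bounded : PolynomiallyBounded (λ n → order (G n))) where

    private
      N : ℕ → ℕ
      N n = order (G n)

      formulaSize : ℕ → ℕ
      formulaSize n = length (coveringFormula (G n))

    formula-bounded : PolynomiallyBounded formulaSize
    formula-bounded = bounded-≤ (λ n → length-coveringFormula (G n)) (bounded-* order-bounded order-bounded)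

    size-bounded : PolynomiallyBounded (λ n → size (G n))
    size-bounded = bounded-+ order-bounded (bounded-≤ edges≤ (bounded-* order-bounded order-bounded))
      where
      edges≤ : ∀ n → length (Graph.edges (G n)) ≤ N n ℕ.* N n
      edges≤ n = ℕ.≤-trans
        (List.length-filter (λ (i , j) → (i Fin.<? j) ×-dec Graph._~?_ (G n) i j)
          (cartesianProduct (allFin (N n)) (allFin (N n))))
        (ℕ.≤-reflexive (≡.trans (length-cartesianProduct (allFin (N n)) (allFin (N n)))
          (≡.cong₂ ℕ._*_ (List.length-tabulate {n = N n} id) (List.length-tabulate {n = N n} id))))

    VCPFamily∈VNP : VNP (VCPFamily G)
    VCPFamily∈VNP =
      (order-bounded , proj₁ order-bounded , λ n →
        degree-mono {f = VCP (G n)} (proj₂ order-bounded n) (Terms≤⇒DegreeAtMost (VCP (G n)) (VCP-terms (G n)))) ,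
      N , (λ n → coverKernel (G n)) ,
      ((bounded-+ order-bounded order-bounded ,
        proj₁ degree , λ n → degree-mono {f = coverKernel (G n)} (proj₂ degree n)
          (Terms≤⇒DegreeAtMost (coverKernel (G n)) (coverKernel-terms (G n)))) ,
       proj₁ complexity , λ n →
        complexity-mono (coverKernel (G n)) (proj₂ complexity n) (coverKernel-complexity (G n))) ,
      (λ n → coeffs (VCP≋booleanSum (G n)))
      where
      allFin-bounded : PolynomiallyBounded (λ n → length (allFin (N n)))
      allFin-bounded = bounded-≤ (λ n → ℕ.≤-reflexive (List.length-tabulate {n = N n} id)) order-bounded
      degree : PolynomiallyBounded (λ n → formulaSize n ℕ.* 2 ℕ.+ length (allFin (N n)) ℕ.* 2)
      degree = bounded-+ (bounded-* formula-bounded (bounded-const 2)) (bounded-* allFin-bounded (bounded-const 2))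
      complexity : PolynomiallyBounded (λ n →
        suc (suc (formulaSize n ℕ.* 10) ℕ.+ suc (length (allFin (N n)) ℕ.* 10)))
      complexity = bounded-+ (bounded-const 1) (bounded-+
        (bounded-+ (bounded-const 1) (bounded-* formula-bounded (bounded-const 10)))
        (bounded-+ (bounded-const 1) (bounded-* allFin-bounded (bounded-const 10))))

  universal : ℕ → Graph
  universal = UniversalGraph.graph

  universal-bounded : PolynomiallyBounded (λ n → order (universal n))
  universal-bounded = bounded-+ bounded-id (bounded-+ square (bounded-+ square square))
    where square = bounded-* bounded-id bounded-id

  -- The circuit for the `n`-th polynomial determines the index `t n` only through the number of its
  -- conflict vertices; its structure goes into the substituted weights.
  universal-hard : ∀ f → VNP f → IsPProjection f (VCPFamily universal)
  universal-hard f (_ , q , g , ((vars-bounded , d , g-degree) , s , g-complexity) , f≈) =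
    t , t-bounded , 0 , λ n _ → labelWeight (L n) (S n) ∘ UniversalGraph.decode (t n) ,
    coeffs (projection n)
    where
    D gates : ℕ → ℕ
    -- The successor ensures a root of positive span even if the degree bound is 0.
    D n     = suc (evalℕ d n)
    gates n = suc (proj₁ (g-complexity n))
    circuit : ∀ n → Circuit (vars f n ℕ.+ q n) (gates n)
    circuit n = proj₁ (proj₂ (proj₂ (g-complexity n)))
    computes : ∀ n → output (circuit n) ≋ g n
    computes n = mk≋ (proj₂ (proj₂ (proj₂ (g-complexity n))))
    L : ∀ n → List (Vertex (Fin (vars f n) ⊎ Field.Carrier K))
    L n = BooleanSum.conflictList K (vars f n) (q n) (D n) (circuit n)
    S : ℕ → Marking
    S n = BooleanSum.rootMarking K (vars f n) (q n) (D n) (gates n)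
    t : ℕ → ℕ
    t n = length (L n)

    degree : ∀ n → DegreeAtMost (D n) (output (circuit n))
    degree n m D<m = Field.trans K (coeffs (computes n) m) (g-degree n m (ℕ.<⇒≤ D<m))

    projection : ∀ n → poly f n ≋
      substitute (⟦_⟧ʷ ∘ labelWeight (L n) (S n) ∘ UniversalGraph.decode (t n)) (VCP (universal (t n)))
    projection n = begin
      poly f n
        ≈⟨ mk≋ (f≈ n) ⟩
      booleanSum (q n) (g n)
        ≈⟨ ∑-cong (cube (q n)) (λ x →
             substitute-cong (BooleanSum.instantiate K (vars f n) (q n) (D n) x) (computes n)) ⟨
      booleanSum (q n) (output (circuit n))
        ≈⟨ BooleanSum.Z-booleanSum K (vars f n) (q n) (D n) (circuit n) (s≤s z≤n) (degree n) ⟨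
      Grammar.Z (polyRing (vars f n)) ⟦_⟧ʷ (L n) (S n)
        ≈⟨ Z-projection (L n) (S n) ⟩
      substitute (⟦_⟧ʷ ∘ labelWeight (L n) (S n) ∘ UniversalGraph.decode (t n)) (VCP (universal (t n))) ∎
      where
      open SumLemmas (polyRing (vars f n))
      open Relation.Binary.Reasoning.Setoid (CommutativeRing.setoid (polyRing (vars f n)))

    t-bounded : PolynomiallyBounded t
    t-bounded = bounded-≤
      (λ n → BooleanSum.length-conflictList K (vars f n) (q n) (D n) (circuit n))
      -- The bound on the variables of `g n` counts `vars f n` and `q n` together and so bounds
      -- `q n`.
      (bounded-+ (bounded-≤ (λ n → ℕ.m≤n+m (q n) (vars f n)) vars-bounded)
        (bounded-+ D+4 (bounded-* gates-bounded (bounded-* (bounded-* D+1 D+1) D+4))))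
      where
      D+1 : PolynomiallyBounded (λ n → suc (D n))
      D+1 = bounded-+ (bounded-const 2) (bounded-eval d)
      D+4 : PolynomiallyBounded (λ n → suc (D n) ℕ.+ 3)
      D+4 = bounded-+ D+1 (bounded-const 3)
      gates-bounded : PolynomiallyBounded gates
      gates-bounded = bounded-≤ (λ n → proj₁ (proj₂ (g-complexity n))) (bounded-eval s)

theorem4 : ∀ {c ℓ} (K : Field c ℓ) → ¬ HasCharacteristic K 2 →
    let open Valiant K in
    Σ[ G ∈ (ℕ → Graph) ]
    PolynomiallyBounded (λ n → size (G n)) ×
    (∀ n → Bipartite (G n)) ×
    VNPComplete (VCPFamily G) ×
    (Σ[ φ ∈ (∀ n → OR₀Formula (order (G n))) ]
    IsPFormulaFamily (λ n → order (G n)) φ ×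
    (∀ n → VCP (G n) ≈ₚ P ⟦ φ n ⟧))
theorem4 K _ =
  universal ,
  size-bounded universal universal-bounded ,
  UniversalGraph.bipartite ,
  (VCPFamily∈VNP universal universal-bounded , universal-hard) ,
  (λ n → coveringFormula (universal n)) ,
  (universal-bounded , formula-bounded universal universal-bounded) ,
  (λ n → coeffs (VCP≋P (universal n)))
  where
  open Completeness K
  open PolynomialRing K using (coeffs)
  open CoverPolynomials K using (VCP≋P)
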